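{- Let $r \geq 4$ be a fixed integer. Then, as $n \to \infty$, with high probability $$\alpha\big(G_{1/2}(n,r,1)\big) = \binom{n-2}{r-2}.$$
   Context: For integers $n, r, s$, the graph $G(n,r,s)$ has vertex set $\binom{[n]}{r}$ (all $r$-element subsets of $[n]=\{1,\dots,n\}$), and two vertices $A,B$ are adjacent iff $|A\cap B| = s$. For $p\in[0,1]$, $G_p(n,r,s)$ denotes the random graph obtained from $G(n,r,s)$ by deleting each edge independently with probability $1-p$. $\alpha(G)$ is the independence number of $G$. "With high probability" (w.h.p.) means with probability tending to $1$ as $n\to\infty$. -}

module Defs where

open import Data.Bool using (Bool; true; false; _∧_; _∨_; not; if_then_else_)
open import Data.Nat using (ℕ; zero; suc; _≡ᵇ_; _⊔_; _∸_)
open import Data.Nat.Combinatorics using (_C_)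
open import Data.Product using (_×_; _,_)
open import Data.Vec using (Vec; []; _∷_)
open import Data.List using (List; []; _∷_; map; _++_; filterᵇ; length; foldr)
open import Data.Bool.ListAction using (all; any)
open import Data.Fin.Subset using (Subset; ∣_∣; _∩_)

allSubsets : (n : ℕ) → List (Subset n)
allSubsets zero = [] ∷ []
allSubsets (suc n) = map (true ∷_) (allSubsets n) ++ map (false ∷_) (allSubsets n)

eqSub : {n : ℕ} → Subset n → Subset n → Bool
eqSub [] [] = true
eqSub (x ∷ xs) (y ∷ ys) = ((x ∧ y) ∨ (not x ∧ not y)) ∧ eqSub xs ys

vertices : (n r : ℕ) → List (Subset n)
vertices n r = filterᵇ (λ A → ∣ A ∣ ≡ᵇ r) (allSubsets n)

pairs : {X : Set} → List X → List (X × X)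
pairs [] = []
pairs (x ∷ xs) = map (x ,_) xs ++ pairs xs

edges : (n r s : ℕ) → List (Subset n × Subset n)
edges n r s = filterᵇ (λ { (A , B) → ∣ A ∩ B ∣ ≡ᵇ s }) (pairs (vertices n r))

select : {X : Set} → (xs : List X) → Vec Bool (length xs) → List X
select [] [] = []
select (x ∷ xs) (true ∷ c) = x ∷ select xs c
select (x ∷ xs) (false ∷ c) = select xs c

memb : {n : ℕ} → Subset n → List (Subset n) → Bool
memb A I = any (eqSub A) I

isIndependent : {n : ℕ} → List (Subset n × Subset n) → List (Subset n) → Bool
isIndependent es I = all (λ { (A , B) → not (memb A I ∧ memb B I) }) es

α : {n : ℕ} → (vs : List (Subset n)) → List (Subset n × Subset n) → ℕ
α vs es = foldr _⊔_ 0
  (map (λ c → if isIndependent es (select vs c) then length (select vs c) else 0)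
       (allSubsets (length vs)))

-- A realisation of G_p(n,r,s) is a choice, for each edge of G(n,r,s), whether it
-- is kept: a Boolean vector indexed by the edge list.  For p = 1/2 all
-- 2^|E(G(n,r,s))| realisations are equally likely.
Realisation : (n r s : ℕ) → Set
Realisation n r s = Vec Bool (length (edges n r s))

αReal : (n r s : ℕ) → Realisation n r s → ℕ
αReal n r s c = α (vertices n r) (select (edges n r s) c)

-- Number of realisations of G_{1/2}(n,r,1) with α ≠ C(n-2, r-2)
-- (the "bad event"; its probability is badCount n r / 2^|E(G(n,r,1))|).
badCount : (n r : ℕ) → ℕ
badCount n r = length (filterᵇ (λ c → not (αReal n r 1 c ≡ᵇ ((n ∸ 2) C (r ∸ 2))))
                               (allSubsets (length (edges n r 1))))

edgeCount : (n r : ℕ) → ℕ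
edgeCount n r = length (edges n r 1)

{-# OPTIONS --safe #-}

-- Let L be of order log n.  By a union bound, with high probability every independent set F of
-- G_{1/2}(n,r,1) spans few edges of G(n,r,1): at most L|J| inside each subfamily J of F, and at most
-- L|F Δ S| for each star S = {A : p, q ∈ A}.  It remains to show that such an F has at most |S| members.
--
-- Call T rich if F contains a sunflower with kernel T and many (polylogarithmically many) petals.
-- Sparseness forbids two rich sets meeting in exactly one vertex, since their sunflowers would span
-- too many edges.  If T is not rich, the members of F containing T are hit by a small set, so branching
-- shows that all but n^(r-3) polylog(n) members A of F are governed by rich pairs: either A contains a
-- rich pair P and P ∪ {v} is rich for all other v ∈ A, or r = 4 and A is the union of two rich pairs.
-- The territories {v : v ∈ P or P ∪ {v} is rich} of distinct rich pairs are disjoint, and double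
-- counting shows that |F| > |S| is only possible if one of them misses only polylog(n) vertices.
-- Then F lies within n^(r-3) polylog(n) sets of the star of that pair, with b sets outside the star
-- and fewer than b sets of the star missing.  Most outside sets have few neighbours in F, so almost all
-- of their neighbours in the star are missing; there are too few missing sets for this.
module Submission where

open import Defs
open import Data.Bool using (Bool; true; false; _∧_; _∨_; not; if_then_else_; _xor_)
open import Data.Bool.ListAction using (all; any)
open import Data.Bool.Properties using (xor-comm)
open import Data.Empty using () renaming (⊥ to Absurd; ⊥-elim to absurd)
open import Data.Fin using (Fin; zero; suc)
open import Data.Fin.Properties using () renaming (any? to anyFin?; _≟_ to _≟ᶠ_)
open import Data.Fin.Subset using (Subset; ∣_∣; _∩_; _∪_; ⁅_⁆; ∁; ⊥; ⊤; _⊆_; _∉_) renaming (_∈_ to _∈ˢ_)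
open import Data.Fin.Subset.Properties using (_∈?_; p⊆q⇒∣p∣≤∣q∣; drop-∷-⊆; ⊆-antisym; x∈p∩q⁺; x∈p∩q⁻; x∈p∪q⁺; x∈p∪q⁻; p∩q⊆q; ∩-comm; ∩-idem; ∪-identityˡ; x∈⁅x⁆; x∈⁅y⁆⇒x≡y; ∣⁅x⁆∣≡1; ∉⊥; ∣⊥∣≡0; ∈⊤; ∣⊤∣≡n; x∉p⇒x∈∁p; x∈∁p⇒x∉p; ∣∁p∣≡n∸∣p∣)
open import Data.List using (List; []; _∷_; map; _++_; filterᵇ; length; concatMap; foldr; take)
open import Data.List.Membership.Propositional using (_∈_)
open import Data.List.Membership.Propositional.Properties using (∈-++⁺ˡ; ∈-++⁺ʳ; ∈-++⁻; ∈-map⁺; ∈-map⁻; ∈-concat⁺′)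
open import Data.List.Properties using (length-++; length-map; length-take)
open import Data.List.Relation.Binary.Sublist.Propositional using ([]; _∷_; _∷ʳ_; minimum) renaming (_⊆_ to _⊑_; ⊆-trans to ⊑-trans)
open import Data.List.Relation.Unary.Any using (here; there)
open import Data.Nat
open import Data.Nat.Combinatorics using (_C_; nCn≡1; nC1≡n; nCk+nC[k+1]≡[n+1]C[k+1])
open import Data.Nat.Combinatorics.Specification using (k>n⇒nCk≡0)
open import Data.Nat.Properties
open import Data.Nat.Tactic.RingSolver using (solve-∀)
open import Data.Product using (_×_; _,_; proj₁; proj₂; ∃-syntax)
open import Data.Sum using (_⊎_; inj₁; inj₂; [_,_]′)
open import Data.Vec using (Vec; []; _∷_; here; there; tabulate)
open import Data.Vec.Properties using ([]=⇒lookup; lookup⇒[]=; lookup∘tabulate)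
open import Function using (_∘_; id)
open import Relation.Binary.PropositionalEquality hiding (J)
open import Relation.Nullary using (Dec; yes; no; does; ¬_; contradiction)
open import Relation.Nullary.Decidable using (_×-dec_; _⊎-dec_; ¬?; decidable-stable)

-- Sums over lists

-- Stars are independent in G(n,r,1) itself, so chance matters only for the upper bound. The scale
-- of the proof is n^(r-3). Disjoint territories allow about n C(n-3,r-3)/(r-2) sets, while the star
-- has (n-2) C(n-3,r-3)/(r-2). The gap is itself of order n^(r-3), so double counting alone cannot
-- decide: sets may be discarded only up to n^(r-3) polylog(n), which is why branching stops after
-- three constrained vertices, and the deficit is recovered from territories that omit `d` =
-- polylog(n) vertices.
--
-- If some territory is almost everything, this gain is lost, and the bound L|J| is too weak because
-- |F| can be of order n^(r-2). Hence the separate sparseness relative to stars; the union bound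
-- affords it because the families at distance j from a given star number at most N^j, where N =
-- C(n,r).
--
-- The last contradiction is a bootstrap: b is at first n^(r-3) polylog(n); this confines the
-- outside sets of low degree to polylog(n) vertices, so b is polylog(n), although a single such set
-- forces about n^(r-3) missing sets.

∑ : {X : Set} → List X → (X → ℕ) → ℕ
∑ []       f = 0
∑ (x ∷ xs) f = f x + ∑ xs f

⟦_⟧ : Bool → ℕ
⟦ true ⟧  = 1
⟦ false ⟧ = 0

private
  +-swap-middle : ∀ a b c d → (a + b) + (c + d) ≡ (a + c) + (b + d)
  +-swap-middle a b c d = begin
    (a + b) + (c + d) ≡⟨ +-assoc a b (c + d) ⟩
    a + (b + (c + d)) ≡⟨ cong (a +_) (sym (+-assoc b c d)) ⟩
    a + ((b + c) + d) ≡⟨ cong (λ z → a + (z + d)) (+-comm b c) ⟩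
    a + ((c + b) + d) ≡⟨ cong (a +_) (+-assoc c b d) ⟩
    a + (c + (b + d)) ≡⟨ sym (+-assoc a c (b + d)) ⟩
    (a + c) + (b + d) ∎
    where open ≡-Reasoning

module _ {X : Set} where

  ∑-mono : ∀ (xs : List X) {f g : X → ℕ} → (∀ {x} → x ∈ xs → f x ≤ g x) → ∑ xs f ≤ ∑ xs g
  ∑-mono []       h = z≤n
  ∑-mono (x ∷ xs) h = +-mono-≤ (h (here refl)) (∑-mono xs (h ∘ there))

  ∑-cong : ∀ (xs : List X) {f g : X → ℕ} → (∀ {x} → x ∈ xs → f x ≡ g x) → ∑ xs f ≡ ∑ xs g
  ∑-cong []       h = refl
  ∑-cong (x ∷ xs) h = cong₂ _+_ (h (here refl)) (∑-cong xs (h ∘ there))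

  ∑-+ : ∀ (xs : List X) (f g : X → ℕ) → ∑ xs (λ x → f x + g x) ≡ ∑ xs f + ∑ xs g
  ∑-+ []       f g = refl
  ∑-+ (x ∷ xs) f g =
    trans (cong (f x + g x +_) (∑-+ xs f g)) (+-swap-middle (f x) (g x) (∑ xs f) (∑ xs g))

  ∑-*ˡ : ∀ (xs : List X) c (f : X → ℕ) → ∑ xs (λ x → c * f x) ≡ c * ∑ xs f
  ∑-*ˡ []       c f = sym (*-zeroʳ c)
  ∑-*ˡ (x ∷ xs) c f = trans (cong (c * f x +_) (∑-*ˡ xs c f)) (sym (*-distribˡ-+ c (f x) (∑ xs f)))

  ∑-*ʳ : ∀ (xs : List X) c (f : X → ℕ) → ∑ xs (λ x → f x * c) ≡ ∑ xs f * c
  ∑-*ʳ []       c f = refl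
  ∑-*ʳ (x ∷ xs) c f = trans (cong (f x * c +_) (∑-*ʳ xs c f)) (sym (*-distribʳ-+ c (f x) (∑ xs f)))

  ∑-const : ∀ (xs : List X) c → ∑ xs (λ _ → c) ≡ length xs * c
  ∑-const []       c = refl
  ∑-const (x ∷ xs) c = cong (c +_) (∑-const xs c)

  ∑-≤-const : ∀ (xs : List X) {f : X → ℕ} c → (∀ {x} → x ∈ xs → f x ≤ c) → ∑ xs f ≤ length xs * c
  ∑-≤-const xs c h = ≤-trans (∑-mono xs h) (≤-reflexive (∑-const xs c))

  ∑-zero : ∀ (xs : List X) {f : X → ℕ} → (∀ {x} → x ∈ xs → f x ≤ 0) → ∑ xs f ≤ 0
  ∑-zero xs h = ≤-trans (∑-≤-const xs 0 h) (≤-reflexive (*-zeroʳ (length xs)))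

  ∑-member : ∀ {xs : List X} {x} (f : X → ℕ) → x ∈ xs → f x ≤ ∑ xs f
  ∑-member f (here refl) = m≤m+n _ _
  ∑-member {y ∷ _} f (there x∈) = ≤-trans (∑-member f x∈) (m≤n+m _ (f y))

  ∑-++ : ∀ (xs ys : List X) (f : X → ℕ) → ∑ (xs ++ ys) f ≡ ∑ xs f + ∑ ys f
  ∑-++ []       ys f = refl
  ∑-++ (x ∷ xs) ys f = trans (cong (f x +_) (∑-++ xs ys f)) (sym (+-assoc (f x) _ _))

  ∑-filterᵇ : ∀ (p : X → Bool) (xs : List X) (f : X → ℕ) →
              ∑ (filterᵇ p xs) f ≡ ∑ xs (λ x → ⟦ p x ⟧ * f x)
  ∑-filterᵇ p []       f = refl
  ∑-filterᵇ p (x ∷ xs) f with p x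
  ... | true  = cong₂ _+_ (sym (+-identityʳ (f x))) (∑-filterᵇ p xs f)
  ... | false = ∑-filterᵇ p xs f

  length≡∑1 : ∀ (xs : List X) → length xs ≡ ∑ xs (λ _ → 1)
  length≡∑1 xs = sym (trans (∑-const xs 1) (*-identityʳ (length xs)))

  length-filterᵇ : ∀ (p : X → Bool) (xs : List X) → length (filterᵇ p xs) ≡ ∑ xs (λ x → ⟦ p x ⟧)
  length-filterᵇ p []       = refl
  length-filterᵇ p (x ∷ xs) with p x
  ... | true  = cong suc (length-filterᵇ p xs)
  ... | false = length-filterᵇ p xs

  -- Because `xs` is a sublist and not merely a subset, each entry is charged to its own occurrence
  -- in `ys`, with no separate argument about repetitions.
  ∑-sublist : ∀ {xs ys : List X} (g : X → Bool) (f : X → ℕ) → xs ⊑ ys →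
              (∀ {x} → x ∈ xs → g x ≡ true) → ∑ xs f ≤ ∑ ys (λ y → ⟦ g y ⟧ * f y)
  ∑-sublist g f []           h = z≤n
  ∑-sublist g f (y ∷ʳ σ)     h = ≤-trans (∑-sublist g f σ h) (m≤n+m _ _)
  ∑-sublist {x ∷ _} g f (refl ∷ σ) h rewrite h (here refl) | +-identityʳ (f x) =
    +-monoʳ-≤ (f x) (∑-sublist g f σ (h ∘ there))

∑-map : ∀ {X Y : Set} (h : X → Y) (xs : List X) (f : Y → ℕ) → ∑ (map h xs) f ≡ ∑ xs (f ∘ h)
∑-map h []       f = refl
∑-map h (x ∷ xs) f = cong (f (h x) +_) (∑-map h xs f)

∑-swap : ∀ {X Y : Set} (xs : List X) (ys : List Y) (f : X → Y → ℕ) →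
         ∑ xs (λ x → ∑ ys (f x)) ≡ ∑ ys (λ y → ∑ xs (λ x → f x y))
∑-swap []       ys f = sym (trans (∑-const ys 0) (*-zeroʳ (length ys)))
∑-swap (x ∷ xs) ys f = trans (cong (∑ ys (f x) +_) (∑-swap xs ys f)) (sym (∑-+ ys (f x) _))

length-concatMap-≤ : ∀ {X Y : Set} (f : X → List Y) (xs : List X) c →
                     (∀ {x} → x ∈ xs → length (f x) ≤ c) → length (concatMap f xs) ≤ length xs * c
length-concatMap-≤ f []       c h = z≤n
length-concatMap-≤ f (x ∷ xs) c h rewrite length-++ (f x) {concatMap f xs} =
  +-mono-≤ (h (here refl)) (length-concatMap-≤ f xs c (h ∘ there))

∈-concatMap : ∀ {X Y : Set} (f : X → List Y) {xs : List X} {x y} → x ∈ xs → y ∈ f x → y ∈ concatMap f xs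
∈-concatMap f x∈ y∈ = ∈-concat⁺′ y∈ (∈-map⁺ f x∈)

⟦⟧≤1 : ∀ b → ⟦ b ⟧ ≤ 1
⟦⟧≤1 true  = ≤-refl
⟦⟧≤1 false = z≤n

⟦⟧-≤ : ∀ {b x} → (b ≡ true → 1 ≤ x) → ⟦ b ⟧ ≤ x
⟦⟧-≤ {true}  h = h refl
⟦⟧-≤ {false} h = z≤n

⟦⟧-true : ∀ {b} → b ≡ true → 1 ≤ ⟦ b ⟧
⟦⟧-true refl = ≤-refl

does-true : ∀ {P : Set} (d : Dec P) → P → does d ≡ true
does-true (yes _) p = refl
does-true (no ¬p) p = contradiction p ¬p

true-does : ∀ {P : Set} (d : Dec P) → does d ≡ true → P
true-does (yes p) _ = p

𝟙 : ∀ {P : Set} → Dec P → ℕ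
𝟙 d = ⟦ does d ⟧

𝟙-≤ : ∀ {P : Set} (d : Dec P) {x} → (P → 1 ≤ x) → 𝟙 d ≤ x
𝟙-≤ (yes p) h = h p
𝟙-≤ (no _)  h = z≤n

∧-true⁻ : ∀ {a b} → a ∧ b ≡ true → a ≡ true × b ≡ true
∧-true⁻ {true} e = refl , e

∧-true⁺ : ∀ {a b} → a ≡ true → b ≡ true → a ∧ b ≡ true
∧-true⁺ refl refl = refl

-- Binomial coefficients

C-step : ∀ n k → n C k ≤ suc n C k
C-step n zero    = ≤-refl
C-step n (suc k) = ≤-trans (m≤n+m _ (n C k)) (≤-reflexive (nCk+nC[k+1]≡[n+1]C[k+1] n k))

C-monoˡ-≤ : ∀ k {m n} → m ≤ n → m C k ≤ n C k
C-monoˡ-≤ k {m} {n} m≤n with ≤⇒≤′ m≤n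
... | p = go p
  where
  go : ∀ {n} → m ≤′ n → m C k ≤ n C k
  go ≤′-refl     = ≤-refl
  go (≤′-step q) = ≤-trans (go q) (C-step _ k)

C≤^ : ∀ n k → n C k ≤ n ^ k
C≤^ n       zero    = ≤-refl
C≤^ zero    (suc k) = ≤-reflexive (k>n⇒nCk≡0 {0} {suc k} (s≤s z≤n))
C≤^ (suc n) (suc k) = begin
  suc n C suc k            ≡⟨ sym (nCk+nC[k+1]≡[n+1]C[k+1] n k) ⟩
  n C k + n C suc k        ≤⟨ +-mono-≤ (C≤^ n k) (C≤^ n (suc k)) ⟩
  suc n * n ^ k            ≤⟨ *-monoʳ-≤ (suc n) (^-monoˡ-≤ k (n≤1+n n)) ⟩
  suc n * suc n ^ k        ∎
  where open ≤-Reasoning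

C≤2^ : ∀ n k → n C k ≤ 2 ^ n
C≤2^ n       zero    = m^n>0 2 n
C≤2^ zero    (suc k) = ≤-trans (≤-reflexive (k>n⇒nCk≡0 {0} {suc k} (s≤s z≤n))) z≤n
C≤2^ (suc n) (suc k) = begin
  suc n C suc k            ≡⟨ sym (nCk+nC[k+1]≡[n+1]C[k+1] n k) ⟩
  n C k + n C suc k        ≤⟨ +-mono-≤ (C≤2^ n k) (≤-trans (C≤2^ n (suc k)) (m≤m+n _ 0)) ⟩
  2 * 2 ^ n                ∎
  where open ≤-Reasoning

-- The absorption identity, through which the size C(n-2,r-2) of the star is later compared with
-- C(n-3,r-3).
C-absorb : ∀ n k → suc k * (suc n C suc k) ≡ suc n * (n C k)
C-absorb n zero = begin
  suc n C 1 + 0 ≡⟨ +-identityʳ _ ⟩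
  suc n C 1     ≡⟨ nC1≡n (suc n) ⟩
  suc n         ≡⟨ sym (*-identityʳ (suc n)) ⟩
  suc n * 1     ∎
  where open ≡-Reasoning
C-absorb zero (suc k)
  rewrite k>n⇒nCk≡0 {1} {suc (suc k)} (s≤s (s≤s z≤n)) | k>n⇒nCk≡0 {0} {suc k} (s≤s z≤n) = *-zeroʳ k
C-absorb (suc m) (suc k) = begin
  suc (suc k) * (suc (suc m) C suc (suc k))
    ≡⟨ cong (suc (suc k) *_) (sym (nCk+nC[k+1]≡[n+1]C[k+1] (suc m) (suc k))) ⟩
  suc (suc k) * (x + suc m C suc (suc k))
    ≡⟨ *-distribˡ-+ (suc (suc k)) x _ ⟩
  (x + suc k * x) + suc (suc k) * (suc m C suc (suc k))
    ≡⟨ cong₂ (λ a b → (x + a) + b) (C-absorb m k) (C-absorb m (suc k)) ⟩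
  (x + suc m * (m C k)) + suc m * (m C suc k)
    ≡⟨ +-assoc x _ _ ⟩
  x + (suc m * (m C k) + suc m * (m C suc k))
    ≡⟨ cong (x +_) (sym (*-distribˡ-+ (suc m) (m C k) (m C suc k))) ⟩
  x + suc m * (m C k + m C suc k)
    ≡⟨ cong (λ z → x + suc m * z) (nCk+nC[k+1]≡[n+1]C[k+1] m k) ⟩
  x + suc m * x ∎
  where
  open ≡-Reasoning
  x = suc m C suc k

-- The right side is the product (h+1)(h+2)...(h+j).
^≤!*C : ∀ h j → h ^ j ≤ j ! * ((h + j) C j)
^≤!*C h zero    = ≤-refl
^≤!*C h (suc j) = begin
  h * h ^ j                              ≤⟨ *-mono-≤ (≤-trans (m≤m+n h j) (n≤1+n _)) (^≤!*C h j) ⟩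
  suc (h + j) * (j ! * ((h + j) C j))    ≡⟨ sym (*-assoc (suc (h + j)) (j !) _) ⟩
  (suc (h + j) * j !) * ((h + j) C j)    ≡⟨ cong (_* ((h + j) C j)) (*-comm (suc (h + j)) (j !)) ⟩
  (j ! * suc (h + j)) * ((h + j) C j)    ≡⟨ *-assoc (j !) _ _ ⟩
  j ! * (suc (h + j) * ((h + j) C j))    ≡⟨ cong (j ! *_) (sym (C-absorb (h + j) j)) ⟩
  j ! * (suc j * (suc (h + j) C suc j))  ≡⟨ sym (*-assoc (j !) (suc j) _) ⟩
  (j ! * suc j) * (suc (h + j) C suc j)  ≡⟨ cong₂ _*_ (*-comm (j !) (suc j)) (cong (_C suc j) (sym (+-suc h j))) ⟩
  suc j ! * ((h + suc j) C suc j)        ∎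
  where open ≤-Reasoning

-- Each of the `d` Pascal steps from m to d + m adds at least C(m,j). This measures what is saved
-- when a territory omits `d` vertices.
C-gain : ∀ m d j → m C suc j + d * (m C j) ≤ (d + m) C suc j
C-gain m zero    j = ≤-reflexive (+-identityʳ _)
C-gain m (suc d) j = begin
  m C suc j + (m C j + d * (m C j))  ≡⟨ cong (m C suc j +_) (+-comm (m C j) _) ⟩
  m C suc j + (d * (m C j) + m C j)  ≡⟨ sym (+-assoc (m C suc j) _ _) ⟩
  m C suc j + d * (m C j) + m C j    ≤⟨ +-mono-≤ (C-gain m d j) (C-monoˡ-≤ j (m≤n+m m d)) ⟩
  (d + m) C suc j + (d + m) C j      ≡⟨ +-comm _ ((d + m) C j) ⟩
  (d + m) C j + (d + m) C suc j      ≡⟨ nCk+nC[k+1]≡[n+1]C[k+1] (d + m) j ⟩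
  suc (d + m) C suc j ∎
  where open ≤-Reasoning

C>0 : ∀ {j m} → j ≤ m → 1 ≤ m C j
C>0 {j} {m} j≤m = subst (_≤ m C j) (nCn≡1 j) (C-monoˡ-≤ j j≤m)

n≤C : ∀ {j m} → suc j < m → m ≤ m C suc j
n≤C {zero}  {m}     lt = ≤-reflexive (sym (nC1≡n m))
n≤C {suc j} {suc m} (s≤s lt) = begin
  suc m                          ≡⟨ +-comm 1 m ⟩
  m + 1                          ≤⟨ +-mono-≤ (n≤C {j} lt) (C>0 lt) ⟩
  m C suc j + m C suc (suc j)    ≡⟨ nCk+nC[k+1]≡[n+1]C[k+1] m (suc j) ⟩
  suc m C suc (suc j)            ∎
  where open ≤-Reasoning

-- Finite sets as Boolean vectors

fins : ∀ n → List (Fin n)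
fins zero    = []
fins (suc n) = zero ∷ map suc (fins n)

∈-fins : ∀ {n} (v : Fin n) → v ∈ fins n
∈-fins zero    = here refl
∈-fins (suc v) = there (∈-map⁺ suc (∈-fins v))

length-fins : ∀ n → length (fins n) ≡ n
length-fins zero    = refl
length-fins (suc n) = cong suc (trans (length-map suc (fins n)) (length-fins n))

elems : ∀ {n} → Subset n → List (Fin n)
elems []          = []
elems (true ∷ A)  = zero ∷ map suc (elems A)
elems (false ∷ A) = map suc (elems A)

∈-elems : ∀ {n} {v : Fin n} {A} → v ∈ˢ A → v ∈ elems A
∈-elems here = here refl
∈-elems {A = true ∷ A}  (there v∈) = there (∈-map⁺ suc (∈-elems v∈))
∈-elems {A = false ∷ A} (there v∈) = ∈-map⁺ suc (∈-elems v∈)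

elems-∈ : ∀ {n} {v : Fin n} (A : Subset n) → v ∈ elems A → v ∈ˢ A
elems-∈ (true ∷ A) (here refl) = here
elems-∈ (true ∷ A) (there v∈) with ∈-map⁻ suc v∈
... | _ , u∈ , refl = there (elems-∈ A u∈)
elems-∈ (false ∷ A) v∈ with ∈-map⁻ suc v∈
... | _ , u∈ , refl = there (elems-∈ A u∈)

length-elems : ∀ {n} (A : Subset n) → length (elems A) ≡ ∣ A ∣
length-elems []          = refl
length-elems (true ∷ A)  = cong suc (trans (length-map suc (elems A)) (length-elems A))
length-elems (false ∷ A) = trans (length-map suc (elems A)) (length-elems A)

∑-∈? : ∀ {n} (A : Subset n) → ∑ (fins n) (λ v → 𝟙 (v ∈? A)) ≡ ∣ A ∣
∑-∈? [] = refl
∑-∈? {suc n} (true ∷ A)  = cong suc (trans (∑-map Fin.suc (fins n) (λ v → 𝟙 (v ∈? (true ∷ A)))) (∑-∈? A))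
∑-∈? {suc n} (false ∷ A) = trans (∑-map Fin.suc (fins n) (λ v → 𝟙 (v ∈? (false ∷ A)))) (∑-∈? A)

sub : ∀ {n} → Subset n → Subset n → Bool
sub []      []      = true
sub (x ∷ p) (y ∷ q) = (not x ∨ y) ∧ sub p q

sub⇒⊆ : ∀ {n} (p q : Subset n) → sub p q ≡ true → p ⊆ q
sub⇒⊆ (true ∷ p) (true ∷ q) e here = here
sub⇒⊆ (true ∷ p) (true ∷ q) e (there v∈) = there (sub⇒⊆ p q e v∈)
sub⇒⊆ (false ∷ p) (y ∷ q) e (there v∈) = there (sub⇒⊆ p q e v∈)

⊆⇒sub : ∀ {n} (p q : Subset n) → p ⊆ q → sub p q ≡ true
⊆⇒sub []          []      h = refl
⊆⇒sub (true ∷ p)  (y ∷ q) h with h here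
... | here = ⊆⇒sub p q (drop-∷-⊆ h)
⊆⇒sub (false ∷ p) (y ∷ q) h = ⊆⇒sub p q (drop-∷-⊆ h)

eqSub⇒≡ : ∀ {n} (A B : Subset n) → eqSub A B ≡ true → A ≡ B
eqSub⇒≡ []          []          e = refl
eqSub⇒≡ (true ∷ A)  (true ∷ B)  e = cong (true ∷_) (eqSub⇒≡ A B e)
eqSub⇒≡ (false ∷ A) (false ∷ B) e = cong (false ∷_) (eqSub⇒≡ A B e)

eqSub-refl : ∀ {n} (A : Subset n) → eqSub A A ≡ true
eqSub-refl []          = refl
eqSub-refl (true ∷ A)  = eqSub-refl A
eqSub-refl (false ∷ A) = eqSub-refl A

memb⇒∈ : ∀ {n} (A : Subset n) I → memb A I ≡ true → A ∈ I
memb⇒∈ A (B ∷ I) e with eqSub A B in eq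
... | true  = here (eqSub⇒≡ A B eq)
... | false = there (memb⇒∈ A I e)

∈⇒memb : ∀ {n} {A : Subset n} {I} → A ∈ I → memb A I ≡ true
∈⇒memb {A = A} (here refl) rewrite eqSub-refl A = refl
∈⇒memb {A = A} {B ∷ I} (there A∈) with eqSub A B
... | true  = refl
... | false = ∈⇒memb A∈

∈-allSubsets : ∀ {n} (A : Subset n) → A ∈ allSubsets n
∈-allSubsets []          = here refl
∈-allSubsets (true ∷ A)  = ∈-++⁺ˡ (∈-map⁺ (true ∷_) (∈-allSubsets A))
∈-allSubsets (false ∷ A) = ∈-++⁺ʳ (map (true ∷_) (allSubsets _)) (∈-map⁺ (false ∷_) (∈-allSubsets A))

∑-allSubsets : ∀ n (f : Subset (suc n) → ℕ) →
  ∑ (allSubsets (suc n)) f ≡ ∑ (allSubsets n) (λ A → f (true ∷ A)) + ∑ (allSubsets n) (λ A → f (false ∷ A))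
∑-allSubsets n f = trans (∑-++ (map (true ∷_) (allSubsets n)) _ f)
  (cong₂ _+_ (∑-map (true ∷_) (allSubsets n) f) (∑-map (false ∷_) (allSubsets n) f))

∑-eqSub : ∀ {n} (B : Subset n) → ∑ (allSubsets n) (λ A → ⟦ eqSub A B ⟧) ≤ 1
∑-eqSub [] = ≤-refl
∑-eqSub {suc n} (true ∷ B) rewrite ∑-allSubsets n (λ A → ⟦ eqSub A (true ∷ B) ⟧) =
  +-mono-≤ (∑-eqSub B) (∑-zero (allSubsets n) (λ _ → z≤n))
∑-eqSub {suc n} (false ∷ B) rewrite ∑-allSubsets n (λ A → ⟦ eqSub A (false ∷ B) ⟧) =
  +-mono-≤ (∑-zero (allSubsets n) (λ _ → z≤n)) (∑-eqSub B)

≡ᵇ-refl : ∀ m → (m ≡ᵇ m) ≡ true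
≡ᵇ-refl zero    = refl
≡ᵇ-refl (suc m) = ≡ᵇ-refl m

≡ᵇ-true : ∀ m n → (m ≡ᵇ n) ≡ true → m ≡ n
≡ᵇ-true zero    zero    e = refl
≡ᵇ-true (suc m) (suc n) e = cong suc (≡ᵇ-true m n e)

filterᵇ-∈⁻ : ∀ {X : Set} (p : X → Bool) xs {x} → x ∈ filterᵇ p xs → x ∈ xs × p x ≡ true
filterᵇ-∈⁻ p (y ∷ xs) x∈ with p y in eq
filterᵇ-∈⁻ p (y ∷ xs) (here refl) | true = here refl , eq
filterᵇ-∈⁻ p (y ∷ xs) (there x∈)  | true = let a , b = filterᵇ-∈⁻ p xs x∈ in there a , b
filterᵇ-∈⁻ p (y ∷ xs) x∈          | false = let a , b = filterᵇ-∈⁻ p xs x∈ in there a , b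

filterᵇ-∈⁺ : ∀ {X : Set} (p : X → Bool) {xs x} → x ∈ xs → p x ≡ true → x ∈ filterᵇ p xs
filterᵇ-∈⁺ p {y ∷ xs} (here refl) e rewrite e = here refl
filterᵇ-∈⁺ p {y ∷ xs} (there x∈)  e with p y
... | true  = there (filterᵇ-∈⁺ p x∈ e)
... | false = filterᵇ-∈⁺ p x∈ e

∈-vertices⁺ : ∀ {n r} {A : Subset n} → ∣ A ∣ ≡ r → A ∈ vertices n r
∈-vertices⁺ {A = A} refl = filterᵇ-∈⁺ _ (∈-allSubsets A) (≡ᵇ-refl ∣ A ∣)

∈-vertices⁻ : ∀ {n r} {A : Subset n} → A ∈ vertices n r → ∣ A ∣ ≡ r
∈-vertices⁻ {n} {r} {A} A∈ = ≡ᵇ-true ∣ A ∣ r (proj₂ (filterᵇ-∈⁻ _ (allSubsets n) A∈))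

-- Every counted set equals an entry of `ys`, and an entry is met at most once because
-- `vertices n r` lists no set twice (`once`); `ys` itself may contain repetitions.
count-≤-length : ∀ n r (J : Subset n → Bool) (ys : List (Subset n)) →
  (∀ {A} → A ∈ vertices n r → J A ≡ true → A ∈ ys) → ∑ (vertices n r) (λ A → ⟦ J A ⟧) ≤ length ys
count-≤-length n r J ys h = begin
  ∑ V (λ A → ⟦ J A ⟧)                       ≤⟨ ∑-mono V (λ A∈ → ⟦⟧-≤ (λ e → covered (h A∈ e))) ⟩
  ∑ V (λ A → ∑ ys (λ B → ⟦ eqSub A B ⟧))    ≡⟨ ∑-swap V ys _ ⟩
  ∑ ys (λ B → ∑ V (λ A → ⟦ eqSub A B ⟧))    ≤⟨ ∑-≤-const ys 1 (λ {B} _ → once B) ⟩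
  length ys * 1                             ≡⟨ *-identityʳ _ ⟩
  length ys                                 ∎
  where
  open ≤-Reasoning
  V = vertices n r
  covered : ∀ {A} → A ∈ ys → 1 ≤ ∑ ys (λ B → ⟦ eqSub A B ⟧)
  covered {A} A∈ = ≤-trans (⟦⟧-true (eqSub-refl A)) (∑-member (λ B → ⟦ eqSub A B ⟧) A∈)
  once : ∀ B → ∑ V (λ A → ⟦ eqSub A B ⟧) ≤ 1
  once B = begin
    ∑ V (λ A → ⟦ eqSub A B ⟧)
      ≡⟨ ∑-filterᵇ _ (allSubsets n) _ ⟩
    ∑ (allSubsets n) (λ A → ⟦ ∣ A ∣ ≡ᵇ r ⟧ * ⟦ eqSub A B ⟧)
      ≤⟨ ∑-mono (allSubsets n) (λ {A} _ → *-monoˡ-≤ ⟦ eqSub A B ⟧ (⟦⟧≤1 (∣ A ∣ ≡ᵇ r))) ⟩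
    ∑ (allSubsets n) (λ A → 1 * ⟦ eqSub A B ⟧)
      ≡⟨ ∑-cong (allSubsets n) (λ _ → *-identityˡ _) ⟩
    ∑ (allSubsets n) (λ A → ⟦ eqSub A B ⟧)
      ≤⟨ ∑-eqSub B ⟩
    1 ∎

-- A coordinate in both T and W, or in neither, is forced; a coordinate of W outside T is taken or
-- not, which is Pascal's rule. Sizes are written as sums to keep truncated subtraction out of the
-- induction.
interval-allSubsets : ∀ {n} (T W : Subset n) w j → sub T W ≡ true → ∣ W ∣ ≡ ∣ T ∣ + w →
  ∑ (allSubsets n) (λ A → ⟦ (sub T A ∧ sub A W) ∧ (∣ A ∣ ≡ᵇ ∣ T ∣ + j) ⟧) ≡ w C j
interval-allSubsets [] [] .0 zero    e refl = refl
interval-allSubsets [] [] .0 (suc j) e refl = sym (k>n⇒nCk≡0 {0} {suc j} (s≤s z≤n))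
interval-allSubsets {suc n} (true ∷ T) (true ∷ W) w j e eq =
  trans (∑-allSubsets n _)
    (trans (cong₂ _+_ (interval-allSubsets T W w j e (suc-injective eq))
                      (n≤0⇒n≡0 (∑-zero (allSubsets n) (λ _ → z≤n))))
      (+-identityʳ _))
interval-allSubsets {suc n} (false ∷ T) (false ∷ W) w j e eq =
  trans (∑-allSubsets n _)
    (cong₂ _+_ (n≤0⇒n≡0 (∑-zero (allSubsets n) (λ {A} _ → dead A))) (interval-allSubsets T W w j e eq))
  where
  dead : ∀ A → ⟦ (sub T A ∧ false) ∧ (suc ∣ A ∣ ≡ᵇ ∣ T ∣ + j) ⟧ ≤ 0
  dead A with sub T A
  ... | true  = z≤n
  ... | false = z≤n
interval-allSubsets {suc n} (false ∷ T) (true ∷ W) zero j e eq =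
  contradiction (p⊆q⇒∣p∣≤∣q∣ (sub⇒⊆ T W e))
    (<⇒≱ (subst (∣ W ∣ <_) (+-identityʳ ∣ T ∣) (≤-reflexive eq)))
interval-allSubsets {suc n} (false ∷ T) (true ∷ W) (suc w) zero e eq =
  trans (∑-allSubsets n _)
    (cong₂ _+_ (n≤0⇒n≡0 (∑-zero (allSubsets n) (λ {A} _ → dead A)))
               (interval-allSubsets T W w 0 e (suc-injective (trans eq (+-suc ∣ T ∣ w)))))
  where
  dead : ∀ A → ⟦ (sub T A ∧ sub A W) ∧ (suc ∣ A ∣ ≡ᵇ ∣ T ∣ + 0) ⟧ ≤ 0
  dead A = ⟦⟧-≤ (λ e → let e₁ , e₂ = ∧-true⁻ e in
    contradiction (≤-reflexive (trans (≡ᵇ-true (suc ∣ A ∣) _ e₂) (+-identityʳ ∣ T ∣)))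
      (≤⇒≯ (p⊆q⇒∣p∣≤∣q∣ (sub⇒⊆ T A (proj₁ (∧-true⁻ e₁))))))
interval-allSubsets {suc n} (false ∷ T) (true ∷ W) (suc w) (suc j) e eq
  rewrite +-suc ∣ T ∣ j =
  trans (∑-allSubsets n _)
    (trans (cong₂ _+_ (interval-allSubsets T W w j e eq′)
             (trans (∑-cong (allSubsets n) (λ {A} _ →
                cong (λ m → ⟦ (sub T A ∧ sub A W) ∧ (∣ A ∣ ≡ᵇ m) ⟧) (sym (+-suc ∣ T ∣ j))))
              (interval-allSubsets T W w (suc j) e eq′)))
      (nCk+nC[k+1]≡[n+1]C[k+1] w j))
  where
  eq′ : ∣ W ∣ ≡ ∣ T ∣ + w
  eq′ = suc-injective (trans eq (+-suc ∣ T ∣ w))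

⟦∧⟧ : ∀ a b → ⟦ a ∧ b ⟧ ≡ ⟦ b ⟧ * ⟦ a ⟧
⟦∧⟧ true  true  = refl
⟦∧⟧ true  false = refl
⟦∧⟧ false true  = refl
⟦∧⟧ false false = refl

count-interval : ∀ {n r} (T W : Subset n) w j → T ⊆ W → ∣ W ∣ ≡ ∣ T ∣ + w → r ≡ ∣ T ∣ + j →
  ∑ (vertices n r) (λ A → ⟦ sub T A ∧ sub A W ⟧) ≡ w C j
count-interval {n} T W w j T⊆W eq refl =
  trans (∑-filterᵇ _ (allSubsets n) _)
    (trans (∑-cong (allSubsets n) (λ {A} _ → sym (⟦∧⟧ (sub T A ∧ sub A W) _)))
      (interval-allSubsets T W w j (⊆⇒sub T W T⊆W) eq))

all-true⁻ : ∀ {X : Set} (p : X → Bool) xs {x} → all p xs ≡ true → x ∈ xs → p x ≡ true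
all-true⁻ p (y ∷ xs) e (here refl) = proj₁ (∧-true⁻ e)
all-true⁻ p (y ∷ xs) e (there x∈)  = all-true⁻ p xs (proj₂ (∧-true⁻ {p y} e)) x∈

all-true⁺ : ∀ {X : Set} (p : X → Bool) xs → (∀ {x} → x ∈ xs → p x ≡ true) → all p xs ≡ true
all-true⁺ p []       h = refl
all-true⁺ p (y ∷ xs) h = ∧-true⁺ (h (here refl)) (all-true⁺ p xs (h ∘ there))

all-false : ∀ {X : Set} (p : X → Bool) xs → all p xs ≡ false → ∃[ x ] (x ∈ xs × p x ≡ false)
all-false p (y ∷ xs) e with p y in eq
... | false = y , here refl , eq
... | true  = let x , x∈ , ex = all-false p xs e in x , there x∈ , ex

sub-false : ∀ {n} (p q : Subset n) → sub p q ≡ false → ∃[ v ] (v ∈ˢ p × v ∉ q)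
sub-false []          []          ()
sub-false (true ∷ p)  (false ∷ q) e = zero , here , λ ()
sub-false (true ∷ p)  (true ∷ q)  e with sub-false p q e
... | v , v∈ , v∉ = suc v , there v∈ , λ { (there w) → v∉ w }
sub-false (false ∷ p) (y ∷ q)     e with sub-false p q e
... | v , v∈ , v∉ = suc v , there v∈ , λ { (there w) → v∉ w }

∃-outside : ∀ {n} (p q : Subset n) → ∣ q ∣ < ∣ p ∣ → ∃[ v ] (v ∈ˢ p × v ∉ q)
∃-outside p q lt with sub p q in eq
... | true  = contradiction lt (≤⇒≯ (p⊆q⇒∣p∣≤∣q∣ (sub⇒⊆ p q eq)))
... | false = sub-false p q eq

-- Adjacency and degree sums

adj : ∀ {n} → Subset n → Subset n → Bool
adj A B = ∣ A ∩ B ∣ ≡ᵇ 1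

singleton-∩⇒adj : ∀ {n} (A B : Subset n) a → a ∈ˢ A → a ∈ˢ B → (∀ w → w ∈ˢ A → w ∈ˢ B → w ≡ a) → adj A B ≡ true
singleton-∩⇒adj A B a a∈A a∈B unique = is-adj
  where
  A∩B≡a : A ∩ B ≡ ⁅ a ⁆
  A∩B≡a = ⊆-antisym
    (λ {w} w∈ → let w∈A , w∈B = x∈p∩q⁻ A B w∈ in subst (_∈ˢ ⁅ a ⁆) (sym (unique w w∈A w∈B)) (x∈⁅x⁆ a))
    (λ w∈ → subst (_∈ˢ A ∩ B) (sym (x∈⁅y⁆⇒x≡y a w∈)) (x∈p∩q⁺ (a∈A , a∈B)))
  is-adj : adj A B ≡ true
  is-adj rewrite A∩B≡a | ∣⁅x⁆∣≡1 a = refl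

card : ∀ n r → (Subset n → Bool) → ℕ
card n r J = ∑ (vertices n r) (λ A → ⟦ J A ⟧)

-- For r other than 1 this is twice the number of edges spanned by J. Ordered pairs avoid the
-- asymmetric edge list until the probabilistic part.
degreeSum : ∀ n r → (Subset n → Bool) → ℕ
degreeSum n r J = ∑ (vertices n r) (λ A → ⟦ J A ⟧ * ∑ (vertices n r) (λ B → ⟦ J B ⟧ * ⟦ adj A B ⟧))

take-⊑ : ∀ {X : Set} m (xs : List X) → take m xs ⊑ xs
take-⊑ zero    xs       = minimum xs
take-⊑ (suc m) []       = []
take-⊑ (suc m) (x ∷ xs) = refl ∷ take-⊑ m xs

⊑-∈ : ∀ {X : Set} {xs ys : List X} {x} → xs ⊑ ys → x ∈ xs → x ∈ ys
⊑-∈ (y ∷ʳ σ)   x∈          = there (⊑-∈ σ x∈)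
⊑-∈ (refl ∷ σ) (here refl) = here refl
⊑-∈ (refl ∷ σ) (there x∈)  = there (⊑-∈ σ x∈)

⊑-∑ : ∀ {X : Set} {xs ys : List X} (f : X → ℕ) → xs ⊑ ys → ∑ xs f ≤ ∑ ys f
⊑-∑ f []         = z≤n
⊑-∑ f (y ∷ʳ σ)   = ≤-trans (⊑-∑ f σ) (m≤n+m _ (f y))
⊑-∑ f (refl ∷ σ) = +-monoʳ-≤ _ (⊑-∑ f σ)

-- Sunflowers in sparse families

module Sunflowers {n : ℕ} (F : Subset n → Bool) where

  fits : Subset n → List (Subset n) → Subset n → Bool
  fits T ps A = (F A ∧ sub T A) ∧ all (λ B → sub (A ∩ B) T) ps

  -- A maximal sunflower with kernel T, built from the end of the list.
  greedy : Subset n → List (Subset n) → List (Subset n)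
  greedy T []       = []
  greedy T (A ∷ As) = if fits T (greedy T As) A then A ∷ greedy T As else greedy T As

  greedy-⊑ : ∀ T As → greedy T As ⊑ As
  greedy-⊑ T []       = []
  greedy-⊑ T (A ∷ As) with fits T (greedy T As) A
  ... | true  = refl ∷ greedy-⊑ T As
  ... | false = A ∷ʳ greedy-⊑ T As

  greedy-∈ : ∀ T As {B} → B ∈ greedy T As → F B ≡ true × T ⊆ B
  greedy-∈ T (A ∷ As) B∈ with fits T (greedy T As) A in eq
  greedy-∈ T (A ∷ As) (here refl) | true =
    let e = proj₁ (∧-true⁻ eq) in proj₁ (∧-true⁻ e) , sub⇒⊆ T A (proj₂ (∧-true⁻ {F A} e))
  greedy-∈ T (A ∷ As) (there B∈)  | true  = greedy-∈ T As B∈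
  greedy-∈ T (A ∷ As) B∈          | false = greedy-∈ T As B∈

  greedy-once : ∀ T As v → v ∉ T → ∑ (greedy T As) (λ B → 𝟙 (v ∈? B)) ≤ 1
  greedy-once T []       v v∉ = z≤n
  greedy-once T (A ∷ As) v v∉ with fits T (greedy T As) A in eq
  ... | false = greedy-once T As v v∉
  ... | true with v ∈? A
  ...   | no  _   = greedy-once T As v v∉
  ...   | yes v∈A = s≤s (∑-zero (greedy T As) (λ {B} B∈ → 𝟙-≤ (v ∈? B) (λ v∈B →
            contradiction (sub⇒⊆ (A ∩ B) T
              (all-true⁻ (λ B → sub (A ∩ B) T) (greedy T As) (proj₂ (∧-true⁻ {F A ∧ sub T A} eq)) B∈)
              (x∈p∩q⁺ (v∈A , v∈B))) v∉)))

  -- A member of F above T is either chosen, and then meets itself outside T, or was rejected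
  -- because of a chosen petal that it meets outside T.
  greedy-maximal : ∀ T As {A} → A ∈ As → F A ≡ true → T ⊆ A → ∣ T ∣ < ∣ A ∣ →
    ∃[ B ] ∃[ v ] (B ∈ greedy T As × v ∈ˢ A × v ∈ˢ B × v ∉ T)
  greedy-maximal T (A ∷ As) (here refl) FA T⊆A lt with fits T (greedy T As) A in eq
  ... | true = let v , v∈ , v∉ = ∃-outside A T lt in A , v , here refl , v∈ , v∈ , v∉
  ... | false rewrite FA | ⊆⇒sub T A T⊆A =
    let B , B∈ , e = all-false _ (greedy T As) eq
        v , v∈ , v∉ = sub-false (A ∩ B) T e
        a , b = x∈p∩q⁻ A B v∈
    in B , v , B∈ , a , b , v∉
  greedy-maximal T (A ∷ As) (there A∈) FA T⊆A lt with fits T (greedy T As) A | greedy-maximal T As A∈ FA T⊆A lt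
  ... | true  | B , v , B∈ , rest = B , v , there B∈ , rest
  ... | false | B , v , B∈ , rest = B , v , B∈ , rest

  new : Subset n → Fin n → Subset n → ℕ
  new T v A = ⟦ does (v ∈? A) ∧ not (does (v ∈? T)) ⟧

  new-intro : ∀ {T v A} → v ∈ˢ A → v ∉ T → 1 ≤ new T v A
  new-intro {T} {v} {A} v∈ v∉ with v ∈? A | v ∈? T
  ... | yes _ | no _  = ≤-refl
  ... | no ¬p | _     = contradiction v∈ ¬p
  ... | yes _ | yes p = contradiction p v∉

  new-once : ∀ T As v → ∑ (greedy T As) (new T v) ≤ 1
  new-once T As v with v ∈? T in eq
  ... | yes v∈ = ≤-trans (∑-zero (greedy T As) (λ {B} _ → dead (does (v ∈? B)))) z≤n
    where
    dead : ∀ b → ⟦ b ∧ false ⟧ ≤ 0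
    dead true  = z≤n
    dead false = z≤n
  ... | no v∉ = ≤-trans (∑-mono (greedy T As) (λ {B} _ → same (does (v ∈? B)))) (greedy-once T As v v∉)
    where
    same : ∀ b → ⟦ b ∧ true ⟧ ≤ ⟦ b ⟧
    same true  = ≤-refl
    same false = z≤n

module SparseFamily {n : ℕ} (r L : ℕ) (F : Subset n → Bool)
  (F-size : ∀ {A} → F A ≡ true → ∣ A ∣ ≡ r)
  (sparse : ∀ J → (∀ {A} → J A ≡ true → F A ≡ true) → degreeSum n r J ≤ 2 * L * card n r J) where

  open Sunflowers F public

  V : List (Subset n)
  V = vertices n r

  opaque
    -- One more than the bound that `no-singleton-intersection` derives for the common number of
    -- petals of two sunflowers.
    s : ℕ
    s = suc (4 * L + 2 * r)

    s-def : s ≡ suc (4 * L + 2 * r)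
    s-def = refl

    petals : Subset n → List (Subset n)
    petals T = greedy T V

    petals-⊑ : ∀ T → petals T ⊑ V
    petals-⊑ T = greedy-⊑ T V

    petals-∈ : ∀ T {B} → B ∈ petals T → F B ≡ true × T ⊆ B
    petals-∈ T = greedy-∈ T V

    petals-once : ∀ T v → ∑ (petals T) (new T v) ≤ 1
    petals-once T = new-once T V

    petals-maximal : ∀ T {A} → F A ≡ true → T ⊆ A → ∣ T ∣ < r →
      ∃[ B ] ∃[ v ] (B ∈ petals T × v ∈ˢ A × v ∈ˢ B × v ∉ T)
    petals-maximal T FA T⊆A lt =
      greedy-maximal T V (∈-vertices⁺ (F-size FA)) FA T⊆A (subst (∣ T ∣ <_) (sym (F-size FA)) lt)

  1≤s : 1 ≤ s
  1≤s = subst (1 ≤_) (sym s-def) (s≤s z≤n)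

  petals-size : ∀ {T A} → A ∈ petals T → ∣ A ∣ ≡ r
  petals-size {T} A∈ = F-size (proj₁ (petals-∈ T A∈))

  -- Of the s * s pairs of a petal A of T and a petal B of T′, all are adjacent through `a` except
  -- those where A meets T′ outside T (counted by `x`) or B meets A outside T′ (counted by `y`). As
  -- petals are disjoint outside their kernel, each exception occurs at most s * r times. Sparseness
  -- of the union of the two sunflowers allows 4 L s adjacent pairs, so s would be at most 4 L + 2
  -- r.
  no-singleton-intersection : ∀ T T′ → s ≤ length (petals T) → s ≤ length (petals T′) →
    ∀ a → a ∈ˢ T → a ∈ˢ T′ → (∀ w → w ∈ˢ T → w ∈ˢ T′ → w ≡ a) → Absurd
  no-singleton-intersection T T′ hT hT′ a a∈T a∈T′ unique = <-irrefl refl (subst (_≤ 4 * L + 2 * r) s-def bound′)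
    where
    ps = take s (petals T)
    qs = take s (petals T′)
    ps⊑V : ps ⊑ V
    ps⊑V = ⊑-trans (take-⊑ s (petals T)) (petals-⊑ T)
    qs⊑V : qs ⊑ V
    qs⊑V = ⊑-trans (take-⊑ s (petals T′)) (petals-⊑ T′)
    ps⊑ = take-⊑ s (petals T)
    qs⊑ = take-⊑ s (petals T′)
    len-ps : length ps ≡ s
    len-ps = trans (length-take s (petals T)) (m≤n⇒m⊓n≡m hT)
    len-qs : length qs ≡ s
    len-qs = trans (length-take s (petals T′)) (m≤n⇒m⊓n≡m hT′)
    ys = ps ++ qs
    J : Subset n → Bool
    J A = memb A ys
    J⊆F : ∀ {A} → J A ≡ true → F A ≡ true
    J⊆F {A} e with ∈-++⁻ ps (memb⇒∈ A ys e)
    ... | inj₁ A∈ = proj₁ (petals-∈ T (⊑-∈ ps⊑ A∈))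
    ... | inj₂ A∈ = proj₁ (petals-∈ T′ (⊑-∈ qs⊑ A∈))
    cardJ : card n r J ≤ s + s
    cardJ = ≤-trans (count-≤-length n r J ys (λ {A} _ e → memb⇒∈ A ys e))
              (≤-reflexive (trans (length-++ ps) (cong₂ _+_ len-ps len-qs)))
    T′-size : ∣ T′ ∣ ≤ r
    T′-size with petals T′ in eq
    ... | [] = contradiction (≤-trans 1≤s hT′) λ ()
    ... | B ∷ _ = let B∈ = subst (B ∈_) (sym eq) (here refl) in
      ≤-trans (p⊆q⇒∣p∣≤∣q∣ (proj₂ (petals-∈ T′ B∈))) (≤-reflexive (petals-size {T′} B∈))
    x : Subset n → ℕ
    x A = ∑ (elems T′) (λ v → new T v A)
    y : Subset n → Subset n → ℕ
    y A B = ∑ (elems A) (λ v → new T′ v B)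
    pointwise : ∀ {A B} → A ∈ ps → B ∈ qs → 1 ≤ ⟦ adj A B ⟧ + (x A + y A B)
    pointwise {A} {B} A∈ B∈ with sub (A ∩ T′) T in eq₁
    ... | false =
      let v , v∈ , v∉ = sub-false (A ∩ T′) T eq₁
          v∈A , v∈T′ = x∈p∩q⁻ A T′ v∈
      in ≤-trans (≤-trans (≤-trans (new-intro v∈A v∉) (∑-member (λ v → new T v A) (∈-elems v∈T′)))
                          (m≤m+n (x A) (y A B))) (m≤n+m _ ⟦ adj A B ⟧)
    ... | true with sub (A ∩ B) T′ in eq₂
    ...   | false =
      let v , v∈ , v∉ = sub-false (A ∩ B) T′ eq₂
          v∈A , v∈B = x∈p∩q⁻ A B v∈
      in ≤-trans (≤-trans (≤-trans (new-intro v∈B v∉) (∑-member (λ v → new T′ v B) (∈-elems v∈A)))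
                          (m≤n+m (y A B) (x A))) (m≤n+m _ ⟦ adj A B ⟧)
    ...   | true = ≤-trans (⟦⟧-true (singleton-∩⇒adj A B a
        (proj₂ (petals-∈ T (⊑-∈ ps⊑ A∈)) a∈T) (proj₂ (petals-∈ T′ (⊑-∈ qs⊑ B∈)) a∈T′)
        (λ w w∈A w∈B → let w∈T′ = sub⇒⊆ (A ∩ B) T′ eq₂ (x∈p∩q⁺ (w∈A , w∈B)) in
          unique w (sub⇒⊆ (A ∩ T′) T eq₁ (x∈p∩q⁺ (w∈A , w∈T′))) w∈T′)))
      (m≤m+n _ (x A + y A B))
    open ≤-Reasoning
    adj-sum : ∑ ps (λ A → ∑ qs (λ B → ⟦ adj A B ⟧)) ≤ 2 * L * (s + s)
    adj-sum = begin
      ∑ ps (λ A → ∑ qs (λ B → ⟦ adj A B ⟧))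
        ≤⟨ ∑-sublist J _ ps⊑V (λ A∈ → ∈⇒memb (∈-++⁺ˡ A∈)) ⟩
      ∑ V (λ A → ⟦ J A ⟧ * ∑ qs (λ B → ⟦ adj A B ⟧))
        ≤⟨ ∑-mono V (λ {A} _ → *-monoʳ-≤ ⟦ J A ⟧ (∑-sublist J _ qs⊑V (λ B∈ → ∈⇒memb (∈-++⁺ʳ ps B∈)))) ⟩
      degreeSum n r J
        ≤⟨ sparse J J⊆F ⟩
      2 * L * card n r J
        ≤⟨ *-monoʳ-≤ (2 * L) cardJ ⟩
      2 * L * (s + s) ∎
    x-sum : ∑ ps (λ A → ∑ qs (λ _ → x A)) ≤ s * r
    x-sum = begin
      ∑ ps (λ A → ∑ qs (λ _ → x A))  ≡⟨ ∑-cong ps (λ {A} _ → trans (∑-const qs (x A)) (cong (_* x A) len-qs)) ⟩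
      ∑ ps (λ A → s * x A)           ≡⟨ ∑-*ˡ ps s x ⟩
      s * ∑ ps x                     ≡⟨ cong (s *_) (∑-swap ps (elems T′) _) ⟩
      s * ∑ (elems T′) (λ v → ∑ ps (new T v))
        ≤⟨ *-monoʳ-≤ s (∑-≤-const (elems T′) 1 (λ {v} _ → ≤-trans (⊑-∑ (new T v) ps⊑) (petals-once T v))) ⟩
      s * (length (elems T′) * 1)    ≡⟨ cong (s *_) (trans (*-identityʳ _) (length-elems T′)) ⟩
      s * ∣ T′ ∣                     ≤⟨ *-monoʳ-≤ s T′-size ⟩
      s * r                          ∎
    y-sum : ∑ ps (λ A → ∑ qs (y A)) ≤ s * r
    y-sum = begin
      ∑ ps (λ A → ∑ qs (y A))
        ≤⟨ ∑-≤-const ps r (λ {A} A∈ → y-row A A∈) ⟩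
      length ps * r ≡⟨ cong (_* r) len-ps ⟩
      s * r ∎
      where
      y-row : ∀ A → A ∈ ps → ∑ qs (y A) ≤ r
      y-row A A∈ = begin
        ∑ qs (y A) ≡⟨ ∑-swap qs (elems A) _ ⟩
        ∑ (elems A) (λ v → ∑ qs (new T′ v))
          ≤⟨ ∑-≤-const (elems A) 1 (λ {v} _ → ≤-trans (⊑-∑ (new T′ v) qs⊑) (petals-once T′ v)) ⟩
        length (elems A) * 1 ≡⟨ trans (*-identityʳ _) (length-elems A) ⟩
        ∣ A ∣ ≡⟨ petals-size {T} (⊑-∈ ps⊑ A∈) ⟩
        r ∎
    bound : s * s ≤ s * (4 * L + 2 * r)
    bound = begin
      s * s ≡⟨ cong₂ _*_ (sym len-ps) (trans (sym len-qs) (sym (*-identityʳ _))) ⟩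
      length ps * (length qs * 1) ≡⟨ sym (∑-const ps _) ⟩
      ∑ ps (λ _ → length qs * 1) ≡⟨ ∑-cong ps (λ _ → sym (∑-const qs 1)) ⟩
      ∑ ps (λ _ → ∑ qs (λ _ → 1))
        ≤⟨ ∑-mono ps (λ A∈ → ∑-mono qs (λ B∈ → pointwise A∈ B∈)) ⟩
      ∑ ps (λ A → ∑ qs (λ B → ⟦ adj A B ⟧ + (x A + y A B)))
        ≡⟨ ∑-cong ps (λ {A} _ → trans (∑-+ qs _ _) (cong (∑ qs (λ B → ⟦ adj A B ⟧) +_) (∑-+ qs _ _))) ⟩
      ∑ ps (λ A → ∑ qs (λ B → ⟦ adj A B ⟧) + (∑ qs (λ _ → x A) + ∑ qs (y A)))
        ≡⟨ trans (∑-+ ps _ _) (cong (∑ ps (λ A → ∑ qs (λ B → ⟦ adj A B ⟧)) +_) (∑-+ ps _ _)) ⟩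
      ∑ ps (λ A → ∑ qs (λ B → ⟦ adj A B ⟧)) + (∑ ps (λ A → ∑ qs (λ _ → x A)) + ∑ ps (λ A → ∑ qs (y A)))
        ≤⟨ +-mono-≤ adj-sum (+-mono-≤ x-sum y-sum) ⟩
      2 * L * (s + s) + (s * r + s * r)
        ≡⟨ arith L s r ⟩
      s * (4 * L + 2 * r) ∎
      where
      arith : ∀ L s r → 2 * L * (s + s) + (s * r + s * r) ≡ s * (4 * L + 2 * r)
      arith = solve-∀
    bound′ : s ≤ 4 * L + 2 * r
    bound′ = *-cancelˡ-≤ s {{>-nonZero 1≤s}} bound

-- Rich pairs and triples

∣p∪q∣≤∣p∣+∣q∣ : ∀ {n} (p q : Subset n) → ∣ p ∪ q ∣ ≤ ∣ p ∣ + ∣ q ∣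
∣p∪q∣≤∣p∣+∣q∣ []          []          = z≤n
∣p∪q∣≤∣p∣+∣q∣ (true ∷ p)  (true ∷ q)  = s≤s (≤-trans (∣p∪q∣≤∣p∣+∣q∣ p q) (+-monoʳ-≤ ∣ p ∣ (n≤1+n _)))
∣p∪q∣≤∣p∣+∣q∣ (true ∷ p)  (false ∷ q) = s≤s (∣p∪q∣≤∣p∣+∣q∣ p q)
∣p∪q∣≤∣p∣+∣q∣ (false ∷ p) (true ∷ q)  = ≤-trans (s≤s (∣p∪q∣≤∣p∣+∣q∣ p q)) (≤-reflexive (sym (+-suc ∣ p ∣ _)))
∣p∪q∣≤∣p∣+∣q∣ (false ∷ p) (false ∷ q) = ∣p∪q∣≤∣p∣+∣q∣ p q

∣⁅v⁆∪p∣ : ∀ {n} (v : Fin n) (p : Subset n) → v ∉ p → ∣ ⁅ v ⁆ ∪ p ∣ ≡ suc ∣ p ∣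
∣⁅v⁆∪p∣ zero    (true ∷ p)  v∉ = contradiction here v∉
∣⁅v⁆∪p∣ zero    (false ∷ p) v∉ = cong (λ q → suc ∣ q ∣) (∪-identityˡ p)
∣⁅v⁆∪p∣ (suc v) (true ∷ p)  v∉ = cong suc (∣⁅v⁆∪p∣ v p (v∉ ∘ there))
∣⁅v⁆∪p∣ (suc v) (false ∷ p) v∉ = ∣⁅v⁆∪p∣ v p (v∉ ∘ there)

⊆-card-≡ : ∀ {n} (p q : Subset n) → p ⊆ q → ∣ q ∣ ≤ ∣ p ∣ → p ≡ q
⊆-card-≡ p q p⊆q le = ⊆-antisym p⊆q (λ {v} v∈q → decidable-stable (v ∈? p) (λ v∉p →
  <⇒≱ (≤-trans (≤-reflexive (sym (∣⁅v⁆∪p∣ v p v∉p)))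
        (p⊆q⇒∣p∣≤∣q∣ {p = ⁅ v ⁆ ∪ p} {q} (λ w∈ → [ (λ w∈v → subst (_∈ˢ q) (sym (x∈⁅y⁆⇒x≡y v w∈v)) v∈q) , p⊆q ]′ (x∈p∪q⁻ ⁅ v ⁆ p w∈)))) le))

-- Vertex sets given by tuples

opaque
  -- Tuples can be counted as successive choices of vertices; the head is the vertex chosen last.
  toSet : ∀ {n m} → Vec (Fin n) m → Subset n
  toSet []      = ⊥
  toSet (v ∷ t) = ⁅ v ⁆ ∪ toSet t

module _ {n : ℕ} where

  opaque
    unfolding toSet

    headˢ : ∀ {m} {v : Fin n} {t : Vec (Fin n) m} → v ∈ˢ toSet (v ∷ t)
    headˢ {v = v} = x∈p∪q⁺ (inj₁ (x∈⁅x⁆ v))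

    tailˢ : ∀ {m} {v w : Fin n} {t : Vec (Fin n) m} → w ∈ˢ toSet t → w ∈ˢ toSet (v ∷ t)
    tailˢ w∈ = x∈p∪q⁺ (inj₂ w∈)

    unconsˢ : ∀ {m} {v w : Fin n} {t : Vec (Fin n) m} → w ∈ˢ toSet (v ∷ t) → w ≡ v ⊎ w ∈ˢ toSet t
    unconsˢ {v = v} {t = t} w∈ with x∈p∪q⁻ ⁅ v ⁆ (toSet t) w∈
    ... | inj₁ p = inj₁ (x∈⁅y⁆⇒x≡y v p)
    ... | inj₂ p = inj₂ p

    nil∉ : ∀ {w : Fin n} → w ∉ toSet []
    nil∉ = ∉⊥

  fresh : ∀ {m} {v w : Fin n} {t : Vec (Fin n) m} → w ≢ v → w ∉ toSet t → w ∉ toSet (v ∷ t)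
  fresh w≢ w∉ w∈ = [ w≢ , w∉ ]′ (unconsˢ w∈)

  fresh₁ : ∀ {v w : Fin n} → w ≢ v → w ∉ toSet (v ∷ [])
  fresh₁ w≢ = fresh w≢ nil∉

  sing⁻ : ∀ {v w : Fin n} → w ∈ˢ toSet (v ∷ []) → w ≡ v
  sing⁻ w∈ = [ id , (λ q → absurd (nil∉ q)) ]′ (unconsˢ w∈)

  pair⁻ : ∀ {u v w : Fin n} → w ∈ˢ toSet (u ∷ v ∷ []) → w ≡ u ⊎ w ≡ v
  pair⁻ w∈ = [ inj₁ , (λ q → inj₂ (sing⁻ q)) ]′ (unconsˢ w∈)

  cons⊆ : ∀ {m} {v : Fin n} {t : Vec (Fin n) m} {A} → v ∈ˢ A → toSet t ⊆ A → toSet (v ∷ t) ⊆ A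
  cons⊆ {A = A} v∈ t⊆ w∈ = [ (λ { refl → v∈ }) , t⊆ ]′ (unconsˢ w∈)

  nil⊆ : ∀ {A : Subset n} → toSet [] ⊆ A
  nil⊆ w∈ = absurd (nil∉ w∈)

  opaque
    unfolding toSet

    ∣toSet∣≤ : ∀ {m} (t : Vec (Fin n) m) → ∣ toSet t ∣ ≤ m
    ∣toSet∣≤ []      = ≤-reflexive (∣⊥∣≡0 n)
    ∣toSet∣≤ (v ∷ t) = ≤-trans (∣p∪q∣≤∣p∣+∣q∣ ⁅ v ⁆ (toSet t))
                         (+-mono-≤ (≤-reflexive (∣⁅x⁆∣≡1 v)) (∣toSet∣≤ t))

    ∣toSet∣-∷ : ∀ {m v} {t : Vec (Fin n) m} → v ∉ toSet t → ∣ toSet (v ∷ t) ∣ ≡ suc ∣ toSet t ∣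
    ∣toSet∣-∷ {v = v} {t} = ∣⁅v⁆∪p∣ v (toSet t)

    ∣toSet[]∣ : ∣ toSet {n} [] ∣ ≡ 0
    ∣toSet[]∣ = ∣⊥∣≡0 n

  subs : ∀ {m} → Vec (Fin n) m → List (Subset n)
  subs []      = ⊥ ∷ []
  subs (v ∷ t) = subs t ++ map (⁅ v ⁆ ∪_) (subs t)

  length-subs : ∀ {m} (t : Vec (Fin n) m) → length (subs t) ≡ 2 ^ m
  length-subs []      = refl
  length-subs (v ∷ t) = trans (length-++ (subs t))
    (cong₂ _+_ (length-subs t) (trans (length-map _ (subs t)) (trans (length-subs t) (sym (+-identityʳ _)))))

  opaque
    unfolding toSet

    ∈-subs : ∀ {m} (t : Vec (Fin n) m) {S} → S ⊆ toSet t → S ∈ subs t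
    ∈-subs []      {S} S⊆ = here (⊆-antisym S⊆ (λ v∈ → absurd (∉⊥ v∈)))
    ∈-subs (v ∷ t) {S} S⊆ with v ∈? S
    ... | no v∉ = ∈-++⁺ˡ (∈-subs t (λ {w} w∈ → [ (λ { refl → contradiction w∈ v∉ }) , id ]′ (unconsˢ {t = t} (S⊆ w∈))))
    ... | yes v∈ = ∈-++⁺ʳ (subs t) (subst (_∈ map (⁅ v ⁆ ∪_) (subs t)) eq
                     (∈-map⁺ (⁅ v ⁆ ∪_) (∈-subs t (p∩q⊆q S (toSet t)))))
      where
      eq : ⁅ v ⁆ ∪ (S ∩ toSet t) ≡ S
      eq = ⊆-antisym
        (λ w∈ → [ (λ p → subst (_∈ˢ S) (sym (x∈⁅y⁆⇒x≡y v p)) v∈) , (λ p → proj₁ (x∈p∩q⁻ S (toSet t) p)) ]′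
                  (x∈p∪q⁻ ⁅ v ⁆ _ w∈))
        (λ {w} w∈ → x∈p∪q⁺ ([ (λ { refl → inj₁ (x∈⁅x⁆ v) }) , (λ q → inj₂ (x∈p∩q⁺ (w∈ , q))) ]′ (unconsˢ {t = t} (S⊆ w∈))))

  setOf : {P : Fin n → Set} → (∀ v → Dec (P v)) → Subset n
  setOf P? = tabulate (λ v → does (P? v))

  setOf⁺ : ∀ {P : Fin n → Set} (P? : ∀ v → Dec (P v)) {v} → P v → v ∈ˢ setOf P?
  setOf⁺ P? {v} p = lookup⇒[]= v _ (trans (lookup∘tabulate (λ v → does (P? v)) v) (does-true (P? v) p))

  setOf⁻ : ∀ {P : Fin n → Set} (P? : ∀ v → Dec (P v)) {v} → v ∈ˢ setOf P? → P v
  setOf⁻ P? {v} v∈ = true-does (P? v) (trans (sym (lookup∘tabulate (λ v → does (P? v)) v)) ([]=⇒lookup v∈))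

module Structure {n : ℕ} (r L : ℕ) (4≤r : 4 ≤ r) (F : Subset n → Bool)
  (F-size : ∀ {A} → F A ≡ true → ∣ A ∣ ≡ r)
  (sparse : ∀ J → (∀ {A} → J A ≡ true → F A ≡ true) → degreeSum n r J ≤ 2 * L * card n r J) where

  open SparseFamily r L F F-size sparse public

  -- The factor suc r makes the cover of a poor set smaller than the sunflower of a rich superset.
  opaque
    s₂ s₃ : ℕ
    s₂ = suc r * s
    s₃ = suc r * s₂

    s₂-def : s₂ ≡ suc r * s
    s₂-def = refl

    s₃-def : s₃ ≡ suc r * s₂
    s₃-def = refl

    s≤s₂ : s ≤ s₂
    s≤s₂ = m≤m+n s _

    s₂≤s₃ : s₂ ≤ s₃
    s₂≤s₃ = m≤m+n s₂ _

  1≤s₂ : 1 ≤ s₂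
  1≤s₂ = ≤-trans 1≤s s≤s₂

  s≤s₃ : s ≤ s₃
  s≤s₃ = ≤-trans s≤s₂ s₂≤s₃

  Rich : ℕ → Subset n → Set
  Rich k T = k ≤ length (petals T)

  rich? : ∀ k T → Dec (Rich k T)
  rich? k T = k ≤? length (petals T)

  unless-rich : ∀ {k S} → Dec (Rich k S) → List (Fin n) → List (Fin n)
  unless-rich (yes _) xs = []
  unless-rich (no _)  xs = xs

  opaque
    -- The vertices of a maximal sunflower with kernel S. Emptying the list for `s₃`-rich S bounds
    -- its length for every S, so that `extend-by-cover` may run over all subsets.
    cover : Subset n → List (Fin n)
    cover S = unless-rich (rich? s₃ S) (concatMap elems (petals S))

  length-cover-≤ : ∀ {k} S → ¬ Rich k S → length (concatMap elems (petals S)) ≤ k * r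
  length-cover-≤ {k} S ¬R = ≤-trans
    (length-concatMap-≤ elems (petals S) r
      (λ {A} A∈ → ≤-reflexive (trans (length-elems A) (petals-size {S} A∈))))
    (*-monoˡ-≤ r (<⇒≤ (≰⇒> ¬R)))

  opaque
    unfolding cover

    length-cover : ∀ S → length (cover S) ≤ s₃ * r
    length-cover S = go (rich? s₃ S)
      where
      go : (d : Dec (Rich s₃ S)) → length (unless-rich d (concatMap elems (petals S))) ≤ s₃ * r
      go (yes _) = z≤n
      go (no ¬R) = length-cover-≤ S ¬R

    cover-poor : ∀ {k} S → k ≤ s₃ → ¬ Rich k S → cover S ≡ concatMap elems (petals S)
    cover-poor S k≤ ¬R = go (rich? s₃ S)
      where
      go : (d : Dec (Rich s₃ S)) → unless-rich d (concatMap elems (petals S)) ≡ concatMap elems (petals S)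
      go (yes R) = contradiction (≤-trans k≤ R) ¬R
      go (no _)  = refl

  opaque
    cover-hits : ∀ {k} S → k ≤ s₃ → ¬ Rich k S → ∣ S ∣ < r → ∀ {A} → F A ≡ true → S ⊆ A →
      ∃[ v ] (v ∈ cover S × v ∈ˢ A × v ∉ S)
    cover-hits S k≤ ¬R S<r {A} FA S⊆A rewrite cover-poor S k≤ ¬R =
      let B , v , B∈ , v∈A , v∈B , v∉S = petals-maximal S FA S⊆A S<r
      in v , ∈-concatMap elems B∈ (∈-elems v∈B) , v∈A , v∉S

  -- The petals of T are disjoint outside T, and there are too many of them to be hit one by one.
  opaque
    cover-hits-rich : ∀ {k} S T → k ≤ s₃ → ¬ Rich k S → ∣ S ∣ < r → 1 ≤ k → Rich (suc r * k) T → S ⊆ T →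
      ∃[ v ] (v ∈ cover S × v ∈ˢ T × v ∉ S)
    cover-hits-rich {k} S T k≤ ¬R S<r 1≤k RT S⊆T
      with all (λ v → not (does (v ∈? T) ∧ not (does (v ∈? S)))) (cover S) in eq
    ... | false = let v , v∈ , e = all-false _ (cover S) eq in v , v∈ , found v e
      where
      found : ∀ v → not (does (v ∈? T) ∧ not (does (v ∈? S))) ≡ false → v ∈ˢ T × v ∉ S
      found v e with v ∈? T | v ∈? S
      ... | yes p | no q = p , q
    ... | true = contradiction bound (<⇒≱ (m<n+m (k * r) 1≤k))
      where
      open ≤-Reasoning
      hit : ∀ {A} → A ∈ petals T → 1 ≤ ∑ (cover S) (λ v → new T v A)
      hit {A} A∈ =
        let FA , T⊆A = petals-∈ T A∈
            v , v∈ , v∈A , v∉S = cover-hits S k≤ ¬R S<r FA (λ u∈ → T⊆A (S⊆T u∈))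
        in ≤-trans (new-intro v∈A (λ v∈T → avoids v∈ v∈T v∉S)) (∑-member (λ v → new T v A) v∈)
        where
        avoids : ∀ {v} → v ∈ cover S → v ∈ˢ T → v ∉ S → Absurd
        avoids {v} v∈ v∈T v∉S with all-true⁻ _ (cover S) eq v∈
        ... | e with v ∈? T | v ∈? S
        ...   | yes _ | yes q = v∉S q
        ...   | no q  | _     = q v∈T
      bound : k + k * r ≤ k * r
      bound = begin
        k + k * r                                        ≡⟨ cong (k +_) (*-comm k r) ⟩
        suc r * k                                        ≤⟨ RT ⟩
        length (petals T)                                ≡⟨ length≡∑1 (petals T) ⟩
        ∑ (petals T) (λ _ → 1)                           ≤⟨ ∑-mono (petals T) hit ⟩
        ∑ (petals T) (λ A → ∑ (cover S) (λ v → new T v A)) ≡⟨ ∑-swap (petals T) (cover S) _ ⟩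
        ∑ (cover S) (λ v → ∑ (petals T) (new T v))       ≤⟨ ∑-≤-const (cover S) 1 (λ {v} _ → petals-once T v) ⟩
        length (cover S) * 1                             ≡⟨ *-identityʳ _ ⟩
        length (cover S)                                 ≡⟨ cong length (cover-poor S k≤ ¬R) ⟩
        length (concatMap elems (petals S))              ≤⟨ length-cover-≤ S ¬R ⟩
        k * r                                            ∎

  -- Enumeration of the negligible sets

  extend-freely : ∀ {m} → Vec (Fin n) m → List (Vec (Fin n) (suc m))
  extend-freely t = map (_∷ t) (fins n)

  extend-by-cover : ∀ {m} → Vec (Fin n) m → List (Vec (Fin n) (suc m))
  extend-by-cover t = concatMap (λ S → map (_∷ t) (cover S)) (subs t)

  -- Sequences of m vertices, g of which are constrained to the cover of a subset of their predecessors: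
  -- each such vertex costs a polylogarithmic factor instead of n.
  generated : ∀ m → ℕ → List (Vec (Fin n) m)
  generated zero    zero    = [] ∷ []
  generated zero    (suc g) = []
  generated (suc m) zero    = concatMap extend-freely (generated m zero)
  generated (suc m) (suc g) =
    concatMap extend-freely (generated m (suc g)) ++ concatMap extend-by-cover (generated m g)

  -- Choices for one constrained vertex: at most 2^r subsets of the earlier vertices, and at most s₃
  -- * r vertices in the cover of each.
  c₀ : ℕ
  c₀ = 2 ^ r * (s₃ * r)

  -- The factor 2^m pays for the choice of the constrained positions; n^g stands on the left to
  -- avoid the exponent m - g.
  length-generated : ∀ m g → m ≤ r → length (generated m g) * n ^ g ≤ 2 ^ m * c₀ ^ g * n ^ m
  length-generated zero    zero    m≤r = ≤-refl
  length-generated zero    (suc g) m≤r = z≤n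
  length-generated (suc m) zero    m≤r = begin
    length (concatMap extend-freely (generated m 0)) * 1 ≡⟨ *-identityʳ _ ⟩
    length (concatMap extend-freely (generated m 0))
      ≤⟨ length-concatMap-≤ extend-freely (generated m 0) n
           (λ {t} _ → ≤-reflexive (trans (length-map (_∷ t) (fins n)) (length-fins n))) ⟩
    length (generated m 0) * n         ≡⟨ cong (_* n) (sym (*-identityʳ (length (generated m 0)))) ⟩
    length (generated m 0) * 1 * n     ≤⟨ *-monoˡ-≤ n (length-generated m 0 (≤-trans (n≤1+n m) m≤r)) ⟩
    2 ^ m * 1 * n ^ m * n              ≤⟨ ≤-trans (m≤m+n _ _) (≤-reflexive (arith (2 ^ m) (n ^ m) n)) ⟩
    2 * 2 ^ m * 1 * (n * n ^ m)        ∎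
    where
    open ≤-Reasoning
    arith : ∀ a b c → a * 1 * b * c + a * 1 * b * c ≡ 2 * a * 1 * (c * b)
    arith = solve-∀
  length-generated (suc m) (suc g) m≤r = begin
    length (concatMap extend-freely (generated m (suc g)) ++ concatMap extend-by-cover (generated m g)) * n ^ suc g
      ≡⟨ cong (_* n ^ suc g) (length-++ (concatMap extend-freely (generated m (suc g)))) ⟩
    (length (concatMap extend-freely (generated m (suc g))) + length (concatMap extend-by-cover (generated m g))) * n ^ suc g
      ≤⟨ *-monoˡ-≤ (n ^ suc g) (+-mono-≤
          (length-concatMap-≤ extend-freely (generated m (suc g)) n
           (λ {t} _ → ≤-reflexive (trans (length-map (_∷ t) (fins n)) (length-fins n))))
          (length-concatMap-≤ extend-by-cover (generated m g) c₀ (λ {t} _ → by-cover t))) ⟩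
    (a * n + b * c₀) * (n * n ^ g)
      ≡⟨ arith₁ a n b c₀ (n ^ g) ⟩
    n * (a * (n * n ^ g)) + c₀ * n * (b * n ^ g)
      ≤⟨ +-mono-≤ (*-monoʳ-≤ n (length-generated m (suc g) m≤r′)) (*-monoʳ-≤ (c₀ * n) (length-generated m g m≤r′)) ⟩
    n * (2 ^ m * c₀ ^ suc g * n ^ m) + c₀ * n * (2 ^ m * c₀ ^ g * n ^ m)
      ≡⟨ arith₂ n (2 ^ m) c₀ (c₀ ^ g) (n ^ m) ⟩
    2 * 2 ^ m * (c₀ * c₀ ^ g) * (n * n ^ m) ∎
    where
    open ≤-Reasoning
    m≤r′ = ≤-trans (n≤1+n m) m≤r
    a = length (generated m (suc g))
    b = length (generated m g)
    arith₁ : ∀ a n b c x → (a * n + b * c) * (n * x) ≡ n * (a * (n * x)) + c * n * (b * x)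
    arith₁ = solve-∀
    arith₂ : ∀ n p c x y → n * (p * (c * x) * y) + c * n * (p * x * y) ≡ 2 * p * (c * x) * (n * y)
    arith₂ = solve-∀
    by-cover : ∀ (t : Vec (Fin n) m) → length (extend-by-cover t) ≤ c₀
    by-cover t = ≤-trans
      (length-concatMap-≤ (λ S → map (_∷ t) (cover S)) (subs t) (s₃ * r)
        (λ {S} _ → ≤-trans (≤-reflexive (length-map (_∷ t) (cover S))) (length-cover S)))
      (*-monoˡ-≤ (s₃ * r) (≤-trans (≤-reflexive (length-subs t)) (^-monoʳ-≤ 2 m≤r′)))

  opaque
    negligible : List (Subset n)
    negligible = map toSet (generated r 3)

    negligible-∈ : ∀ {t} → t ∈ generated r 3 → toSet t ∈ negligible
    negligible-∈ = ∈-map⁺ toSet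

    length-negligible : length negligible * n ^ 3 ≤ 2 ^ r * c₀ ^ 3 * n ^ r
    length-negligible rewrite length-map toSet (generated r 3) = length-generated r 3 ≤-refl

  -- A state of the branching: the vertices of A found so far, `g` of them constrained. Since they
  -- are distinct, r of them exhaust a member of F.
  record Reach (A : Subset n) (g : ℕ) {m : ℕ} (t : Vec (Fin n) m) : Set where
    constructor reached
    field
      is-generated : t ∈ generated m g
      is-subset    : toSet t ⊆ A
      is-simple    : ∣ toSet t ∣ ≡ m

  start : ∀ {A} → Reach A 0 []
  start {A} = reached (here refl) (nil⊆ {A = A}) ∣toSet[]∣

  step-free : ∀ {A g m v} {t : Vec (Fin n) m} → v ∈ˢ A → v ∉ toSet t → Reach A g t → Reach A g (v ∷ t)
  step-free {A} {g} {m} {v} {t} v∈ v∉ (reached t∈ t⊆ sz) =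
    reached (gen g t∈) (cons⊆ {A = A} v∈ t⊆) (trans (∣toSet∣-∷ v∉) (cong suc sz))
    where
    gen : ∀ g → t ∈ generated m g → (v ∷ t) ∈ generated (suc m) g
    gen zero    t∈ = ∈-concatMap extend-freely t∈ (∈-map⁺ (_∷ t) (∈-fins v))
    gen (suc g) t∈ = ∈-++⁺ˡ (∈-concatMap extend-freely t∈ (∈-map⁺ (_∷ t) (∈-fins v)))

  step-cover : ∀ {A g m v S} {t : Vec (Fin n) m} → v ∈ cover S → S ⊆ toSet t → v ∈ˢ A → v ∉ toSet t →
    Reach A g t → Reach A (suc g) (v ∷ t)
  step-cover {A} {g} {m} {v} {S} {t} v∈S S⊆ v∈ v∉ (reached t∈ t⊆ sz) = reached
    (∈-++⁺ʳ (concatMap extend-freely (generated m (suc g)))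
      (∈-concatMap extend-by-cover t∈
        (∈-concatMap (λ S → map (_∷ t) (cover S)) (∈-subs t S⊆) (∈-map⁺ (_∷ t) v∈S))))
    (cons⊆ {A = A} v∈ t⊆) (trans (∣toSet∣-∷ v∉) (cong suc sz))

  -- After three constrained vertices the rest of A is added by free steps.
  finish : ∀ {A m} {t : Vec (Fin n) m} → F A ≡ true → Reach A 3 t → A ∈ negligible
  finish {A} {m} {t} FA R = go (r ∸ m) (m+[n∸m]≡n m≤r) R
    where
    m≤r : m ≤ r
    m≤r = subst₂ _≤_ (Reach.is-simple R) (F-size FA) (p⊆q⇒∣p∣≤∣q∣ (Reach.is-subset R))
    go : ∀ d {m} {t : Vec (Fin n) m} → m + d ≡ r → Reach A 3 t → A ∈ negligible
    go zero {m} {t} eq (reached t∈ t⊆ sz) with trans (sym (+-identityʳ m)) eq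
    ... | refl = subst (_∈ negligible)
      (⊆-card-≡ (toSet t) A t⊆ (≤-reflexive (trans (F-size FA) (sym sz)))) (negligible-∈ t∈)
    go (suc d) {m} {t} eq R@(reached t∈ t⊆ sz) =
      let v , v∈ , v∉ = ∃-outside A (toSet t)
            (subst₂ _<_ (sym sz) (sym (F-size FA)) (subst (m <_) eq (m<m+n m (s≤s z≤n))))
      in go d (trans (sym (+-suc m d)) eq) (step-free v∈ v∉ R)

  -- Two copies of {x} meet in exactly one vertex.
  poor-singleton : ∀ x → ¬ Rich s (toSet (x ∷ []))
  poor-singleton x R = no-singleton-intersection _ _ R R x headˢ headˢ (λ w w∈ _ → sing⁻ w∈)

  small : ∀ {m} (t : Vec (Fin n) m) → m ≤ 3 → ∣ toSet t ∣ < r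
  small t m≤3 = ≤-trans (s≤s (≤-trans (∣toSet∣≤ t) m≤3)) 4≤r

  -- Branching towards rich pairs

  RichPair : Fin n → Fin n → Set
  RichPair p q = p ≢ q × Rich s₂ (toSet (q ∷ p ∷ []))

  RichTriple : Fin n → Fin n → Fin n → Set
  RichTriple p q v = Rich s₃ (toSet (v ∷ q ∷ p ∷ []))

  -- Outcomes of branching from `x`. Each poor set on the way supplies a constrained next vertex;
  -- three poor sets in a row make A negligible, and otherwise a rich pair or triple stops the
  -- process. The cover memberships kept in `triple` let a caller continue with the two constraints
  -- already spent.
  data Link (A : Subset n) (x : Fin n) : Set where
    neg    : A ∈ negligible → Link A x
    pair   : ∀ y → y ∈ˢ A → RichPair x y → Link A x
    triple : ∀ y z → y ∈ˢ A → z ∈ˢ A → y ≢ x → z ∉ toSet (y ∷ x ∷ []) →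
             y ∈ cover (toSet (x ∷ [])) → z ∈ cover (toSet (y ∷ x ∷ [])) → RichTriple x y z → Link A x

  opaque
    link : ∀ {A x} → F A ≡ true → x ∈ˢ A → Link A x
    link {A} {x} FA x∈
      with cover-hits (toSet (x ∷ [])) s≤s₃ (poor-singleton x) (small (x ∷ []) (s≤s z≤n)) FA (cons⊆ {A = A} x∈ nil⊆)
    ... | y , y∈c , y∈ , y∉ with rich? s₂ (toSet (y ∷ x ∷ []))
    ...   | yes R = pair y y∈ ((λ { refl → y∉ headˢ }) , R)
    ...   | no ¬R with cover-hits (toSet (y ∷ x ∷ [])) s₂≤s₃ ¬R (small (y ∷ x ∷ []) (s≤s (s≤s z≤n))) FA
                        (cons⊆ {A = A} y∈ (cons⊆ {A = A} x∈ nil⊆))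
    ...     | z , z∈c , z∈ , z∉ with rich? s₃ (toSet (z ∷ y ∷ x ∷ []))
    ...       | yes R = triple y z y∈ z∈ (λ { refl → y∉ headˢ }) z∉ y∈c z∈c R
    ...       | no ¬R′ with cover-hits (toSet (z ∷ y ∷ x ∷ [])) ≤-refl ¬R′ (small (z ∷ y ∷ x ∷ []) ≤-refl) FA
                             (cons⊆ {A = A} z∈ (cons⊆ {A = A} y∈ (cons⊆ {A = A} x∈ nil⊆)))
    ...         | w , w∈c , w∈ , w∉ = neg (finish FA
      (step-cover w∈c id w∈ w∉ (step-cover z∈c id z∈ z∉ (step-cover y∈c id y∈ y∉
        (step-free x∈ nil∉ start)))))

  opaque
    -- If branching from `x` stops at a rich triple, branch again from a vertex `d` outside it,
    -- which exists as r is at least 4. The first triple already carries two constraints, so one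
    -- more suffices; a second rich triple through `d` must therefore take its other vertices from
    -- the first.
    ∃-richPair : ∀ {A} → F A ≡ true →
      A ∈ negligible ⊎ ∃[ p ] ∃[ q ] (p ∈ˢ A × q ∈ˢ A × RichPair p q)
    ∃-richPair {A} FA with ∃-outside A ⊥ (subst₂ _<_ (sym (∣⊥∣≡0 n)) (sym (F-size FA)) (≤-trans (s≤s z≤n) 4≤r))
    ... | x , x∈ , _ with link FA x∈
    ...   | neg N        = inj₁ N
    ...   | pair y y∈ R  = inj₂ (x , y , x∈ , y∈ , R)
    ...   | triple y z y∈ z∈ y≢x z∉ y∈c z∈c R
            with ∃-outside A (toSet (z ∷ y ∷ x ∷ [])) (subst (_ <_) (sym (F-size FA)) (small (z ∷ y ∷ x ∷ []) ≤-refl))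
    ...     | d , d∈ , d∉ with link FA d∈
    ...       | neg N        = inj₁ N
    ...       | pair e e∈ R′ = inj₂ (d , e , d∈ , e∈ , R′)
    ...       | triple e f e∈ f∈ e≢d f∉ e∈c f∈c R′ = cases (e ∈? (toSet (z ∷ y ∷ x ∷ []))) (f ∈? (toSet (z ∷ y ∷ x ∷ []))) (rich? s₂ (toSet (f ∷ e ∷ [])))
      where
      reach-T : Reach A 2 (z ∷ y ∷ x ∷ [])
      reach-T = step-cover z∈c id z∈ z∉ (step-cover y∈c id y∈ (fresh₁ y≢x) (step-free x∈ nil∉ start))
      cases : Dec (e ∈ˢ (toSet (z ∷ y ∷ x ∷ []))) → Dec (f ∈ˢ (toSet (z ∷ y ∷ x ∷ []))) → Dec (Rich s₂ (toSet (f ∷ e ∷ []))) →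
        A ∈ negligible ⊎ ∃[ p ] ∃[ q ] (p ∈ˢ A × q ∈ˢ A × RichPair p q)
      -- With `d` added freely, `e` comes from the cover of {d}: the third constraint.
      cases (no e∉) _ _ = inj₁ (finish FA
        (step-cover e∈c (cons⊆ {A = toSet (d ∷ z ∷ y ∷ x ∷ [])} headˢ nil⊆) e∈ (fresh e≢d e∉) (step-free d∈ d∉ reach-T)))
      -- Neither `d` nor `f` lies in the first triple, so the two triples share only `e`.
      cases (yes e∈T) (no f∉T) _ = absurd (no-singleton-intersection (toSet (f ∷ e ∷ d ∷ [])) (toSet (z ∷ y ∷ x ∷ [])) (≤-trans s≤s₃ R′) (≤-trans s≤s₃ R)
        e (tailˢ headˢ) e∈T (λ w w∈ w∈T → [ (λ { refl → contradiction w∈T f∉T })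
          , (λ w∈′ → [ id , (λ { refl → contradiction w∈T d∉ }) ]′ (pair⁻ w∈′)) ]′ (unconsˢ w∈)))
      cases (yes e∈T) (yes f∈T) (yes R″) = inj₂ (e , f , e∈ , f∈ , (λ { refl → f∉ headˢ }) , R″)
      -- The triple {d,e,f} is so much richer than {e,f} that the cover of {e,f} contains its
      -- remaining vertex `d`, which becomes the third constrained vertex.
      cases (yes e∈T) (yes f∈T) (no ¬R″)
        with cover-hits-rich (toSet (f ∷ e ∷ [])) (toSet (f ∷ e ∷ d ∷ [])) s₂≤s₃ ¬R″ (small (f ∷ e ∷ []) (s≤s (s≤s z≤n)))
               1≤s₂ (subst (_≤ _) s₃-def R′) (cons⊆ {A = toSet (f ∷ e ∷ d ∷ [])} headˢ (cons⊆ {A = toSet (f ∷ e ∷ d ∷ [])} (tailˢ headˢ) nil⊆))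
      ... | v , v∈c , v∈ , v∉ = inj₁ (finish FA
        (step-cover (subst (_∈ cover (toSet (f ∷ e ∷ []))) v≡d v∈c)
          (cons⊆ {A = (toSet (z ∷ y ∷ x ∷ []))} f∈T (cons⊆ {A = (toSet (z ∷ y ∷ x ∷ []))} e∈T nil⊆)) d∈ d∉ reach-T))
        where
        v≡d : v ≡ d
        v≡d = [ (λ { refl → contradiction headˢ v∉ })
              , (λ v∈′ → [ (λ { refl → contradiction (tailˢ headˢ) v∉ }) , id ]′ (pair⁻ v∈′)) ]′ (unconsˢ v∈)

  opaque
    -- {p} is poor and {p,q} is rich, so the cover of {p} meets the pair in `q`. A rich pair
    -- therefore costs one free and one constrained vertex.
    partner-cover : ∀ {p q} → RichPair p q → q ∈ cover (toSet (p ∷ []))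
    partner-cover {p} {q} (_ , R)
      with cover-hits-rich (toSet (p ∷ [])) (toSet (q ∷ p ∷ [])) s≤s₃ (poor-singleton p) (small (p ∷ []) (s≤s z≤n))
             1≤s (subst (_≤ _) s₂-def R) (cons⊆ {A = toSet (q ∷ p ∷ [])} (tailˢ headˢ) nil⊆)
    ... | v , v∈c , v∈ , v∉ = subst (_∈ cover (toSet (p ∷ [])))
      ([ id , (λ { refl → contradiction headˢ v∉ }) ]′ (pair⁻ v∈)) v∈c

  opaque
    -- Branch from `v`. A rich pair or triple through `v` cannot share exactly one vertex with
    -- {p,q}. A triple sharing none yields, together with `q`, three constrained vertices; a triple
    -- sharing two is {p,q,v}.
    beyond-pair : ∀ {A p q v} → F A ≡ true → p ∈ˢ A → q ∈ˢ A → RichPair p q → v ∈ˢ A → v ∉ toSet (q ∷ p ∷ []) →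
      A ∈ negligible ⊎ RichTriple p q v ⊎ ∃[ u ] (u ∈ˢ A × RichPair v u × u ∉ toSet (q ∷ p ∷ []))
    beyond-pair {A} {p} {q} {v} FA p∈ q∈ R@(p≢q , RP) v∈ v∉ with link FA v∈
    ... | neg N = inj₁ N
    ... | pair y y∈ R′@(_ , RY) = inj₂ (inj₂ (y , y∈ , R′ , λ y∈P →
      no-singleton-intersection _ _ (≤-trans s≤s₂ RY) (≤-trans s≤s₂ RP) y headˢ y∈P
        (λ w w∈ w∈P → [ id , (λ { refl → contradiction w∈P v∉ }) ]′ (pair⁻ w∈))))
    ... | triple y z y∈ z∈ y≢v z∉ y∈c z∈c RT = cases (y ∈? (toSet (q ∷ p ∷ []))) (z ∈? (toSet (q ∷ p ∷ [])))
      where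
      T⁻ : ∀ {w} → w ∈ˢ (toSet (z ∷ y ∷ v ∷ [])) → w ≡ z ⊎ w ≡ y ⊎ w ≡ v
      T⁻ w∈ = [ inj₁ , (λ w∈′ → inj₂ (pair⁻ w∈′)) ]′ (unconsˢ w∈)
      cases : Dec (y ∈ˢ (toSet (q ∷ p ∷ []))) → Dec (z ∈ˢ (toSet (q ∷ p ∷ []))) →
        A ∈ negligible ⊎ RichTriple p q v ⊎ ∃[ u ] (u ∈ˢ A × RichPair v u × u ∉ (toSet (q ∷ p ∷ [])))
      cases (no y∉P) (no z∉P) = inj₁ (finish FA
        (step-cover z∈c (cons⊆ {A = toSet (y ∷ v ∷ q ∷ p ∷ [])} headˢ (cons⊆ {A = toSet (y ∷ v ∷ q ∷ p ∷ [])} (tailˢ headˢ) nil⊆)) z∈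
            (fresh (λ { refl → z∉ headˢ }) (fresh (λ { refl → z∉ (tailˢ headˢ) }) z∉P))
          (step-cover y∈c (cons⊆ {A = toSet (v ∷ q ∷ p ∷ [])} headˢ nil⊆) y∈ (fresh y≢v y∉P)
            (step-free v∈ v∉
              (step-cover (partner-cover R) id q∈ (fresh₁ (λ e → p≢q (sym e))) (step-free p∈ nil∉ start))))))
      cases (yes y∈P) (no z∉P) = absurd (no-singleton-intersection (toSet (z ∷ y ∷ v ∷ [])) (toSet (q ∷ p ∷ [])) (≤-trans s≤s₃ RT) (≤-trans s≤s₂ RP) y (tailˢ headˢ) y∈P
        (λ w w∈ w∈P → [ (λ { refl → contradiction w∈P z∉P })
                      , [ id , (λ { refl → contradiction w∈P v∉ }) ]′ ]′ (T⁻ w∈)))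
      cases (no y∉P) (yes z∈P) = absurd (no-singleton-intersection (toSet (z ∷ y ∷ v ∷ [])) (toSet (q ∷ p ∷ [])) (≤-trans s≤s₃ RT) (≤-trans s≤s₂ RP) z headˢ z∈P
        (λ w w∈ w∈P → [ id
                      , [ (λ { refl → contradiction w∈P y∉P }) , (λ { refl → contradiction w∈P v∉ }) ]′ ]′ (T⁻ w∈)))
      cases (yes y∈P) (yes z∈P) = inj₂ (inj₁ (subst (Rich s₃) eq RT))
        where
        both : ∀ {w} → w ∈ˢ (toSet (q ∷ p ∷ [])) → w ∈ˢ (toSet (z ∷ y ∷ v ∷ []))
        both w∈ with pair⁻ w∈ | pair⁻ y∈P | pair⁻ z∈P
        ... | inj₁ refl | inj₁ refl | _         = tailˢ headˢ
        ... | inj₁ refl | inj₂ refl | inj₁ refl = headˢ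
        ... | inj₁ refl | inj₂ refl | inj₂ refl = contradiction headˢ z∉
        ... | inj₂ refl | inj₂ refl | _         = tailˢ headˢ
        ... | inj₂ refl | inj₁ refl | inj₂ refl = headˢ
        ... | inj₂ refl | inj₁ refl | inj₁ refl = contradiction headˢ z∉
        eq : (toSet (z ∷ y ∷ v ∷ [])) ≡ (toSet (v ∷ q ∷ p ∷ []))
        eq = ⊆-antisym
          (cons⊆ {A = (toSet (v ∷ q ∷ p ∷ []))} (tailˢ z∈P) (cons⊆ {A = (toSet (v ∷ q ∷ p ∷ []))} (tailˢ y∈P) (cons⊆ {A = (toSet (v ∷ q ∷ p ∷ []))} headˢ nil⊆)))
          (cons⊆ {A = (toSet (z ∷ y ∷ v ∷ []))} (tailˢ (tailˢ headˢ)) both)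

  opaque
    -- If `w` has a partner outside {p,q}, three disjoint rich pairs give one constraint each. If
    -- {p,q,w} is rich, start from `w`: the covers of the poor sets {w} and {w,v} supply both
    -- vertices of {p,q}, and `q′` is constrained by `p′`.
    two-pairs-and-more : ∀ {A p q p′ q′ w} → F A ≡ true → p ∈ˢ A → q ∈ˢ A → RichPair p q →
      p′ ∈ˢ A → q′ ∈ˢ A → RichPair p′ q′ → p′ ∉ toSet (q ∷ p ∷ []) → q′ ∉ toSet (q ∷ p ∷ []) →
      w ∈ˢ A → w ∉ toSet (q ∷ p ∷ []) → w ∉ toSet (q′ ∷ p′ ∷ []) → A ∈ negligible
    two-pairs-and-more {A} {p} {q} {p′} {q′} {w} FA p∈ q∈ R@(p≢q , RP) p′∈ q′∈ R′@(p′≢q′ , RP′) p′∉ q′∉ w∈ w∉ w∉′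
      with beyond-pair FA p∈ q∈ R w∈ w∉
    ... | inj₁ N = N
    ... | inj₂ (inj₂ (u , u∈ , Rw@(w≢u , RW) , u∉)) = finish FA
      (step-cover (partner-cover Rw) (cons⊆ {A = toSet (w ∷ q′ ∷ p′ ∷ q ∷ p ∷ [])} headˢ nil⊆) u∈
          (fresh (λ e → w≢u (sym e)) (fresh (λ { refl → u∉′ headˢ }) (fresh (λ { refl → u∉′ (tailˢ headˢ) }) u∉)))
        (step-free w∈ (fresh (λ { refl → w∉′ headˢ }) (fresh (λ { refl → w∉′ (tailˢ headˢ) }) w∉))
          (step-cover (partner-cover R′) (cons⊆ {A = toSet (p′ ∷ q ∷ p ∷ [])} headˢ nil⊆) q′∈
              (fresh (λ e → p′≢q′ (sym e)) q′∉)
            (step-free p′∈ p′∉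
              (step-cover (partner-cover R) id q∈ (fresh₁ (λ e → p≢q (sym e))) (step-free p∈ nil∉ start))))))
      where
      u∉′ : u ∉ toSet (q′ ∷ p′ ∷ [])
      u∉′ u∈P′ = no-singleton-intersection _ _ (≤-trans s≤s₂ RW) (≤-trans s≤s₂ RP′) u headˢ u∈P′
        (λ x x∈ x∈P′ → [ id , (λ { refl → contradiction x∈P′ w∉′ }) ]′ (pair⁻ x∈))
    ... | inj₂ (inj₁ RT)
      with cover-hits-rich (toSet (w ∷ [])) (toSet (w ∷ q ∷ p ∷ [])) s≤s₃ (poor-singleton w) (small (w ∷ []) (s≤s z≤n))
             1≤s (subst (_≤ _) s₂-def (≤-trans s₂≤s₃ RT)) (cons⊆ {A = toSet (w ∷ q ∷ p ∷ [])} headˢ nil⊆)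
    ...   | v , v∈c , v∈ , v∉ = second v∈P
      where
      P⊆A : (toSet (q ∷ p ∷ [])) ⊆ A
      P⊆A = cons⊆ {A = A} q∈ (cons⊆ {A = A} p∈ nil⊆)
      v∈P : v ∈ˢ (toSet (q ∷ p ∷ []))
      v∈P = [ (λ { refl → contradiction headˢ v∉ }) , id ]′ (unconsˢ v∈)
      second : v ∈ˢ (toSet (q ∷ p ∷ [])) → A ∈ negligible
      second v∈P
        with cover-hits-rich (toSet (v ∷ w ∷ [])) (toSet (w ∷ q ∷ p ∷ [])) s₂≤s₃
               (λ R → no-singleton-intersection _ _ (≤-trans s≤s₂ R) (≤-trans s≤s₂ RP) v headˢ v∈P
                        (λ x x∈ x∈P → [ id , (λ { refl → contradiction x∈P w∉ }) ]′ (pair⁻ x∈)))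
               (small (v ∷ w ∷ []) (s≤s (s≤s z≤n))) 1≤s₂ (subst (_≤ _) s₃-def RT)
               (cons⊆ {A = toSet (w ∷ q ∷ p ∷ [])} v∈ (cons⊆ {A = toSet (w ∷ q ∷ p ∷ [])} headˢ nil⊆))
      ... | u , u∈c , u∈ , u∉ = finish FA
        (step-cover (partner-cover R′) (cons⊆ {A = toSet (p′ ∷ u ∷ v ∷ w ∷ [])} headˢ nil⊆) q′∈
            (fresh (λ e → p′≢q′ (sym e)) (new-vertex q′∉ (λ { refl → w∉′ headˢ })))
          (step-free p′∈ (new-vertex p′∉ (λ { refl → w∉′ (tailˢ headˢ) }))
            (step-cover u∈c id (P⊆A u∈P) u∉
              (step-cover v∈c id (P⊆A v∈P) v∉ (step-free w∈ nil∉ start)))))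
        where
        u∈P : u ∈ˢ (toSet (q ∷ p ∷ []))
        u∈P = [ (λ { refl → contradiction (tailˢ headˢ) u∉ }) , id ]′ (unconsˢ u∈)
        new-vertex : ∀ {x} → x ∉ (toSet (q ∷ p ∷ [])) → x ≢ w → x ∉ toSet (u ∷ v ∷ w ∷ [])
        new-vertex x∉ x≢ = fresh (λ { refl → x∉ u∈P }) (fresh (λ { refl → x∉ v∈P }) (fresh₁ x≢))

  data Good (A : Subset n) : Set where
    star : ∀ p q → p ∈ˢ A → q ∈ˢ A → RichPair p q →
           (∀ v → v ∈ˢ A → v ∈ˢ toSet (q ∷ p ∷ []) ⊎ RichTriple p q v) → Good A
    twin : ∀ p q p′ q′ → p ∈ˢ A → q ∈ˢ A → RichPair p q → p′ ∈ˢ A → q′ ∈ˢ A → RichPair p′ q′ →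
           (∀ v → v ∈ˢ A → v ∈ˢ toSet (q ∷ p ∷ []) ⊎ v ∈ˢ toSet (q′ ∷ p′ ∷ [])) → Good A

  opaque
    classify : ∀ {A} → F A ≡ true → A ∈ negligible ⊎ Good A
    classify {A} FA with ∃-richPair FA
    ... | inj₁ N = inj₁ N
    ... | inj₂ (p , q , p∈ , q∈ , R)
      with anyFin? (λ v → (v ∈? A) ×-dec (¬? (v ∈? toSet (q ∷ p ∷ []))) ×-dec (¬? (rich? s₃ (toSet (v ∷ q ∷ p ∷ [])))))
    ...   | no none = inj₂ (star p q p∈ q∈ R (λ v v∈ → decidable-stable
              ((v ∈? toSet (q ∷ p ∷ [])) ⊎-dec (rich? s₃ (toSet (v ∷ q ∷ p ∷ []))))
              (λ ¬h → none (v , v∈ , (λ x → ¬h (inj₁ x)) , (λ x → ¬h (inj₂ x))))))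
    ...   | yes (v , v∈ , v∉ , ¬R) with beyond-pair FA p∈ q∈ R v∈ v∉
    ...     | inj₁ N = inj₁ N
    ...     | inj₂ (inj₁ RT) = contradiction RT ¬R
    ...     | inj₂ (inj₂ (u , u∈ , R′ , u∉))
      with anyFin? (λ w → (w ∈? A) ×-dec (¬? (w ∈? toSet (q ∷ p ∷ []))) ×-dec (¬? (w ∈? toSet (u ∷ v ∷ []))))
    ...       | yes (w , w∈ , w∉ , w∉′) = inj₁ (two-pairs-and-more FA p∈ q∈ R v∈ u∈ R′ v∉ u∉ w∈ w∉ w∉′)
    ...       | no none = inj₂ (twin p q v u p∈ q∈ R v∈ u∈ R′ (λ w w∈ → decidable-stable
              ((w ∈? toSet (q ∷ p ∷ [])) ⊎-dec (w ∈? toSet (u ∷ v ∷ [])))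
              (λ ¬h → none (w , w∈ , (λ x → ¬h (inj₁ x)) , (λ x → ¬h (inj₂ x))))))

  -- Territories of rich pairs

  governed? : ∀ p q v → Dec (v ∈ˢ toSet (q ∷ p ∷ []) ⊎ RichTriple p q v)
  governed? p q v = (v ∈? toSet (q ∷ p ∷ [])) ⊎-dec (rich? s₃ (toSet (v ∷ q ∷ p ∷ [])))

  territory : Fin n → Fin n → Subset n
  territory p q = setOf (governed? p q)

  kernel : ∀ {p q a} → RichPair p q → a ∈ˢ toSet (q ∷ p ∷ []) ⊎ RichTriple p q a →
    ∃[ T ] (Rich s T × a ∈ˢ T × (∀ w → w ∈ˢ T → w ∈ˢ toSet (q ∷ p ∷ []) ⊎ w ≡ a))
  kernel {p} {q} (_ , R) (inj₁ a∈) = toSet (q ∷ p ∷ []) , ≤-trans s≤s₂ R , a∈ , λ w w∈ → inj₁ w∈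
  kernel {p} {q} {a} _   (inj₂ R)  = toSet (a ∷ q ∷ p ∷ []) , ≤-trans s≤s₃ R , headˢ ,
    λ w w∈ → [ inj₂ , inj₁ ]′ (unconsˢ w∈)

  -- Pairs with exactly one common vertex are excluded. For disjoint pairs, the rich kernels through
  -- `a` lie in {p,q,a} and {p′,q′,a}, so they would meet in `a` alone.
  territory-unique : ∀ {p q p′ q′ a} → RichPair p q → RichPair p′ q′ →
    a ∈ˢ toSet (q ∷ p ∷ []) ⊎ RichTriple p q a → a ∈ˢ toSet (q′ ∷ p′ ∷ []) ⊎ RichTriple p′ q′ a →
    toSet (q ∷ p ∷ []) ⊆ toSet (q′ ∷ p′ ∷ [])
  territory-unique {p} {q} {p′} {q′} {a} R@(_ , RP) R′@(_ , RP′) a∈ a∈′ = cases (p ∈? P′) (q ∈? P′)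
    where
    P = toSet (q ∷ p ∷ [])
    P′ = toSet (q′ ∷ p′ ∷ [])
    cases : Dec (p ∈ˢ P′) → Dec (q ∈ˢ P′) → P ⊆ P′
    cases (yes p∈) (yes q∈) = cons⊆ {A = P′} q∈ (cons⊆ {A = P′} p∈ nil⊆)
    cases (yes p∈) (no q∉) = absurd (no-singleton-intersection P P′ (≤-trans s≤s₂ RP) (≤-trans s≤s₂ RP′) p (tailˢ headˢ) p∈
      (λ w w∈ w∈′ → [ (λ { refl → contradiction w∈′ q∉ }) , id ]′ (pair⁻ w∈)))
    cases (no p∉) (yes q∈) = absurd (no-singleton-intersection P P′ (≤-trans s≤s₂ RP) (≤-trans s≤s₂ RP′) q headˢ q∈
      (λ w w∈ w∈′ → [ id , (λ { refl → contradiction w∈′ p∉ }) ]′ (pair⁻ w∈)))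
    cases (no p∉) (no q∉) =
      let T , RT , a∈T , hT = kernel R a∈
          T′ , RT′ , a∈T′ , hT′ = kernel R′ a∈′
      in absurd (no-singleton-intersection T T′ RT RT′ a a∈T a∈T′ (λ w w∈ w∈′ →
           [ (λ w∈P → [ (λ w∈P′ → absurd ([ (λ { refl → q∉ w∈P′ }) , (λ { refl → p∉ w∈P′ }) ]′ (pair⁻ w∈P))) , id ]′ (hT′ w w∈′))
           , id ]′ (hT w w∈)))

-- Counting the sets governed by rich pairs

module Counting {n : ℕ} (r L : ℕ) (4≤r : 4 ≤ r) (F : Subset n → Bool)
  (F-size : ∀ {A} → F A ≡ true → ∣ A ∣ ≡ r)
  (sparse : ∀ J → (∀ {A} → J A ≡ true → F A ≡ true) → degreeSum n r J ≤ 2 * L * card n r J) where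

  open Structure r L 4≤r F F-size sparse public

  RichPair-sym : ∀ {p q} → RichPair p q → RichPair q p
  RichPair-sym {p} {q} (p≢q , R) = (λ e → p≢q (sym e)) , subst (Rich s₂) (⊆-antisym
    (cons⊆ (tailˢ headˢ) (cons⊆ headˢ nil⊆)) (cons⊆ (tailˢ headˢ) (cons⊆ headˢ nil⊆))) R

  Paired : Fin n → Set
  Paired v = ∃[ q ] RichPair v q

  opaque
    paired? : ∀ v → Dec (Paired v)
    paired? v = anyFin? (λ q → ¬? (v ≟ᶠ q) ×-dec rich? s₂ (toSet (q ∷ v ∷ [])))

  paired-∈ : ∀ {p q v} → RichPair p q → v ∈ˢ toSet (q ∷ p ∷ []) → Paired v
  paired-∈ {p} {q} R v∈ with pair⁻ v∈
  ... | inj₁ refl = p , RichPair-sym R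
  ... | inj₂ refl = q , R

  -- A rich pair at `v` would have `v` in its territory as well, and so would be contained in {p,q}.
  unpaired-triple : ∀ {p q v} → RichPair p q → v ∉ toSet (q ∷ p ∷ []) → RichTriple p q v → ¬ Paired v
  unpaired-triple R v∉ RT (u , R′) = v∉ (territory-unique R′ R (inj₁ (tailˢ headˢ)) (inj₂ RT) (tailˢ headˢ))

  same-pair : ∀ {p q p′ q′ a} → RichPair p q → RichPair p′ q′ → a ∈ˢ toSet (q ∷ p ∷ []) → a ∈ˢ toSet (q′ ∷ p′ ∷ []) →
    toSet (q ∷ p ∷ []) ⊆ toSet (q′ ∷ p′ ∷ [])
  same-pair R R′ a∈ a∈′ = territory-unique R R′ (inj₁ a∈) (inj₁ a∈′)

  all-paired : Subset n → Bool
  all-paired A = all (λ v → does (paired? v)) (elems A)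

  -- A set made of two rich pairs (which forces r = 4) gets weight 1 at each vertex, other good sets
  -- get weight 2 at each unpaired vertex; hence every good set has total weight at least 2 (r - 2).
  opaque
    weight : Fin n → Subset n → ℕ
    weight v A = 𝟙 (v ∈? A) * (if does (paired? v) then ⟦ all-paired A ⟧ else 2)

    weight-unpaired : ∀ {v A} → v ∈ˢ A → ¬ Paired v → 2 ≤ weight v A
    weight-unpaired {v} {A} v∈ ¬P with v ∈? A | paired? v
    ... | yes _ | no _  = ≤-refl
    ... | no v∉ | _     = contradiction v∈ v∉
    ... | yes _ | yes P = contradiction P ¬P

    weight-paired : ∀ {v A} → v ∈ˢ A → (∀ u → u ∈ˢ A → Paired u) → 1 ≤ weight v A
    weight-paired {v} {A} v∈ P
      rewrite all-true⁺ (λ v → does (paired? v)) (elems A) (λ {u} u∈ → does-true (paired? u) (P u (elems-∈ A u∈)))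
      with v ∈? A | paired? v
    ... | yes _ | yes _ = ≤-refl
    ... | no v∉ | _     = contradiction v∈ v∉
    ... | yes _ | no ¬P = contradiction (P v v∈) ¬P

    weight-≤-unpaired : ∀ {v A x} → ¬ Paired v → (v ∈ˢ A → 1 ≤ x) → weight v A ≤ 2 * x
    weight-≤-unpaired {v} {A} {x} ¬P h with v ∈? A | paired? v
    ... | _      | yes P = contradiction P ¬P
    ... | no _   | no _  = z≤n
    ... | yes v∈ | no _  = *-monoʳ-≤ 2 (h v∈)

    weight-≤-paired : ∀ {v A x} → Paired v → (v ∈ˢ A → (∀ u → u ∈ˢ A → Paired u) → 1 ≤ x) → weight v A ≤ x
    weight-≤-paired {v} {A} {x} P h with v ∈? A | paired? v
    ... | _      | no ¬P = contradiction P ¬P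
    ... | no _   | yes _ = z≤n
    ... | yes v∈ | yes _ = ≤-trans (≤-reflexive (+-identityʳ _)) (⟦⟧-≤ (λ e → h v∈ (λ u u∈ →
            true-does (paired? u) (all-true⁻ (λ v → does (paired? v)) (elems A) e (∈-elems u∈)))))

  -- In a set of the first kind, all vertices outside the pair are unpaired, which gives 2 (r - 2).
  -- A set made of two pairs has r at most 4 and weight 1 everywhere, and 2 r is at most r + 4.
  weight-total : ∀ {A} → ∣ A ∣ ≡ r → Good A → 2 * r ≤ ∑ (fins n) (λ v → weight v A) + 4
  weight-total {A} refl (star p q p∈ q∈ R gov) = begin
    2 * ∣ A ∣                                       ≡⟨ cong (2 *_) (sym (∑-∈? A)) ⟩
    2 * ∑ (fins n) (λ v → 𝟙 (v ∈? A))              ≡⟨ sym (∑-*ˡ (fins n) 2 _) ⟩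
    ∑ (fins n) (λ v → 2 * 𝟙 (v ∈? A))              ≤⟨ ∑-mono (fins n) (λ {v} _ → pointwise v) ⟩
    ∑ (fins n) (λ v → weight v A + 2 * 𝟙 (v ∈? P)) ≡⟨ ∑-+ (fins n) _ _ ⟩
    ∑ (fins n) (λ v → weight v A) + ∑ (fins n) (λ v → 2 * 𝟙 (v ∈? P))
      ≡⟨ cong (∑ (fins n) (λ v → weight v A) +_) (trans (∑-*ˡ (fins n) 2 _) (cong (2 *_) (∑-∈? P))) ⟩
    ∑ (fins n) (λ v → weight v A) + 2 * ∣ P ∣      ≤⟨ +-monoʳ-≤ _ (*-monoʳ-≤ 2 (∣toSet∣≤ (q ∷ p ∷ []))) ⟩
    ∑ (fins n) (λ v → weight v A) + 4              ∎
    where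
    open ≤-Reasoning
    P = toSet (q ∷ p ∷ [])
    pointwise : ∀ v → 2 * 𝟙 (v ∈? A) ≤ weight v A + 2 * 𝟙 (v ∈? P)
    pointwise v with v ∈? A
    ... | no _ = z≤n
    ... | yes v∈ with v ∈? P
    ...   | yes _ = m≤n+m 2 _
    ...   | no v∉ with gov v v∈
    ...     | inj₁ v∈P = contradiction v∈P v∉
    ...     | inj₂ RT  = ≤-trans (weight-unpaired v∈ (unpaired-triple R v∉ RT)) (m≤m+n _ _)
  weight-total {A} refl (twin p q p′ q′ p∈ q∈ R p′∈ q′∈ R′ gov) = begin
    2 * ∣ A ∣                               ≡⟨ cong (∣ A ∣ +_) (+-identityʳ ∣ A ∣) ⟩
    ∣ A ∣ + ∣ A ∣                           ≡⟨ cong (_+ ∣ A ∣) (sym (∑-∈? A)) ⟩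
    ∑ (fins n) (λ v → 𝟙 (v ∈? A)) + ∣ A ∣
      ≤⟨ +-mono-≤ (∑-mono (fins n) (λ {v} _ → 𝟙-≤ (v ∈? A) (λ v∈ → weight-paired v∈ paired)))
                  (≤-trans (p⊆q⇒∣p∣≤∣q∣ A⊆) (∣toSet∣≤ (q ∷ p ∷ q′ ∷ p′ ∷ []))) ⟩
    ∑ (fins n) (λ v → weight v A) + 4       ∎
    where
    open ≤-Reasoning
    paired : ∀ u → u ∈ˢ A → Paired u
    paired u u∈ = [ paired-∈ R , paired-∈ R′ ]′ (gov u u∈)
    A⊆ : A ⊆ toSet (q ∷ p ∷ q′ ∷ p′ ∷ [])
    A⊆ {v} v∈ = [ (cons⊆ headˢ (cons⊆ (tailˢ headˢ) nil⊆)) , (tailˢ ∘ tailˢ) ]′ (gov v v∈)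

  opaque
    good : Subset n → Bool
    good A = F A ∧ not (memb A negligible)

    good-F : ∀ {A} → good A ≡ true → F A ≡ true
    good-F e = proj₁ (∧-true⁻ e)

    good⁻ : ∀ {A} → good A ≡ true → Good A
    good⁻ {A} e with classify (proj₁ (∧-true⁻ e))
    ... | inj₂ G = G
    ... | inj₁ N with trans (sym (proj₂ (∧-true⁻ {F A} e))) (cong not (∈⇒memb N))
    ...   | ()

    good-or-negligible : ∀ A → ⟦ F A ⟧ ≤ ⟦ good A ⟧ + ⟦ memb A negligible ⟧
    good-or-negligible A with F A | memb A negligible
    ... | false | _     = z≤n
    ... | true  | true  = ≤-refl
    ... | true  | false = ≤-refl

  card-negligible : card n r (λ A → memb A negligible) ≤ length negligible
  card-negligible = count-≤-length n r _ negligible (λ {A} _ e → memb⇒∈ A negligible e)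

  card-F-≤ : card n r F ≤ card n r good + length negligible
  card-F-≤ = begin
    card n r F                                                 ≤⟨ ∑-mono V (λ {A} _ → good-or-negligible A) ⟩
    ∑ V (λ A → ⟦ good A ⟧ + ⟦ memb A negligible ⟧)             ≡⟨ ∑-+ V _ _ ⟩
    card n r good + card n r (λ A → memb A negligible)         ≤⟨ +-monoʳ-≤ _ card-negligible ⟩
    card n r good + length negligible                          ∎
    where open ≤-Reasoning

  load : Fin n → ℕ
  load v = ∑ V (λ A → ⟦ good A ⟧ * weight v A)

  good*-≤ : ∀ {A x y} → (good A ≡ true → x ≤ y) → ⟦ good A ⟧ * x ≤ y
  good*-≤ {A} {x} {y} h = go (good A) h
    where
    go : ∀ b → (b ≡ true → x ≤ y) → ⟦ b ⟧ * x ≤ y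
    go true  h = ≤-trans (≤-reflexive (+-identityʳ x)) (h refl)
    go false h = z≤n

  -- At a paired vertex the choice is immaterial by `same-pair`; elsewhere `w` is a default.
  partner : Fin n → Fin n
  partner w with paired? w
  ... | yes (u , _) = u
  ... | no _        = w

  partner-rich : ∀ {w} → Paired w → RichPair w (partner w)
  partner-rich {w} P with paired? w
  ... | yes (u , R) = R
  ... | no ¬P       = contradiction P ¬P

  -- Only sets made of two rich pairs have weight at a paired vertex: the others contain an unpaired
  -- vertex. One of the two pairs is that of `v`, and the other is determined by any of its vertices
  -- `w`.
  load-paired : ∀ v → Paired v → load v ≤ n
  load-paired v (u , Rv) = begin
    load v                            ≤⟨ ∑-mono V (λ {A} _ → good*-≤ (λ g → weight-≤-paired (u , Rv)
                                            (λ v∈ P → ⟦⟧-true (∈⇒memb (is-listed (good-F g) (good⁻ g) v∈ P))))) ⟩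
    card n r (λ A → memb A listed)    ≤⟨ count-≤-length n r _ listed (λ {A} _ e → memb⇒∈ A listed e) ⟩
    length listed                     ≡⟨ trans (length-map (λ w → toSet (u ∷ v ∷ partner w ∷ w ∷ [])) (fins n)) (length-fins n) ⟩
    n                                 ∎
    where
    open ≤-Reasoning
    listed : List (Subset n)
    listed = map (λ w → toSet (u ∷ v ∷ partner w ∷ w ∷ [])) (fins n)
    twin-listed : ∀ {A} p q p′ q′ → p ∈ˢ A → q ∈ˢ A → RichPair p q → p′ ∈ˢ A → q′ ∈ˢ A → RichPair p′ q′ →
      (∀ w → w ∈ˢ A → w ∈ˢ toSet (q ∷ p ∷ []) ⊎ w ∈ˢ toSet (q′ ∷ p′ ∷ [])) → v ∈ˢ toSet (q ∷ p ∷ []) → A ∈ listed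
    twin-listed {A} p q p′ q′ p∈ q∈ R p′∈ q′∈ R′ gov v∈P =
      subst (_∈ listed) (⊆-antisym ⊆A A⊆) (∈-map⁺ (λ w → toSet (u ∷ v ∷ partner w ∷ w ∷ [])) (∈-fins p′))
      where
      Rp : RichPair p′ (partner p′)
      Rp = partner-rich (q′ , R′)
      P⊆A : toSet (q ∷ p ∷ []) ⊆ A
      P⊆A = cons⊆ q∈ (cons⊆ p∈ nil⊆)
      P′⊆A : toSet (q′ ∷ p′ ∷ []) ⊆ A
      P′⊆A = cons⊆ q′∈ (cons⊆ p′∈ nil⊆)
      ⊆A : toSet (u ∷ v ∷ partner p′ ∷ p′ ∷ []) ⊆ A
      ⊆A = cons⊆ (P⊆A (same-pair Rv R (tailˢ headˢ) v∈P headˢ)) (cons⊆ (P⊆A v∈P)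
             (cons⊆ (P′⊆A (same-pair Rp R′ (tailˢ headˢ) (tailˢ headˢ) headˢ)) (cons⊆ p′∈ nil⊆)))
      A⊆ : A ⊆ toSet (u ∷ v ∷ partner p′ ∷ p′ ∷ [])
      A⊆ {w} w∈ with gov w w∈
      ... | inj₁ w∈P  = cons⊆ headˢ (cons⊆ (tailˢ headˢ) nil⊆) (same-pair R Rv v∈P (tailˢ headˢ) w∈P)
      ... | inj₂ w∈P′ = tailˢ (tailˢ (same-pair R′ Rp (tailˢ headˢ) (tailˢ headˢ) w∈P′))
    is-listed : ∀ {A} → F A ≡ true → Good A → v ∈ˢ A → (∀ w → w ∈ˢ A → Paired w) → A ∈ listed
    is-listed {A} FA (star p q p∈ q∈ R gov) v∈ P =
      let w , w∈ , w∉ = ∃-outside A (toSet (q ∷ p ∷ []))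
            (subst (_ <_) (sym (F-size FA)) (small (q ∷ p ∷ []) (s≤s (s≤s z≤n))))
      in [ (λ w∈P → contradiction w∈P w∉) , (λ RT → contradiction (P w w∈) (unpaired-triple R w∉ RT)) ]′ (gov w w∈)
    is-listed {A} FA (twin p q p′ q′ p∈ q∈ R p′∈ q′∈ R′ gov) v∈ P with gov v v∈
    ... | inj₁ v∈P = twin-listed p q p′ q′ p∈ q∈ R p′∈ q′∈ R′ gov v∈P
    ... | inj₂ v∈P′ = twin-listed p′ q′ p q p′∈ q′∈ R′ p∈ q∈ R
            (λ w w∈ → [ inj₂ , inj₁ ]′ (gov w w∈)) v∈P′

  governor : ∀ {A} → Good A → ∀ a → a ∈ˢ A →
    ∃[ p ] ∃[ q ] (RichPair p q × toSet (q ∷ p ∷ []) ⊆ A × (a ∈ˢ toSet (q ∷ p ∷ []) ⊎ RichTriple p q a))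
  governor (star p q p∈ q∈ R gov) a a∈ = p , q , R , cons⊆ q∈ (cons⊆ p∈ nil⊆) , gov a a∈
  governor (twin p q p′ q′ p∈ q∈ R p′∈ q′∈ R′ gov) a a∈ with gov a a∈
  ... | inj₁ a∈P  = p , q , R , cons⊆ q∈ (cons⊆ p∈ nil⊆) , inj₁ a∈P
  ... | inj₂ a∈P′ = p′ , q′ , R′ , cons⊆ q′∈ (cons⊆ p′∈ nil⊆) , inj₁ a∈P′

  module _ (w j : ℕ) (r≡ : r ≡ 3 + j)
    (small-territory : ∀ p q → RichPair p q → ∣ territory p q ∣ ≤ 3 + w) where

    -- As territories are disjoint, all good sets through `v` are governed by one rich pair {p,q}.
    -- They contain p, q and v and lie in the territory, whose remaining vertices number at most
    -- `w`; the factor 2 is the weight.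
    load-unpaired : ∀ v → ¬ Paired v → load v ≤ 2 * (w C j)
    load-unpaired v ¬P
      with anyFin? (λ p → anyFin? (λ q → (¬? (p ≟ᶠ q) ×-dec rich? s₂ (toSet (q ∷ p ∷ []))) ×-dec rich? s₃ (toSet (v ∷ q ∷ p ∷ []))))
    ... | no none = ≤-trans (∑-zero V (λ {A} _ → good*-≤ (λ g → weight-≤-unpaired {x = 0} ¬P (λ v∈ → dead (good⁻ g) v∈)))) z≤n
      where
      dead : ∀ {A} → Good A → v ∈ˢ A → 1 ≤ 0
      dead G v∈ with governor G v v∈
      ... | p , q , R , _ , inj₁ v∈P = contradiction (paired-∈ R v∈P) ¬P
      ... | p , q , R , _ , inj₂ RT  = contradiction (p , q , R , RT) none
    ... | yes (p , q , R , RT) = begin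
      load v                                     ≤⟨ ∑-mono V (λ {A} _ → good*-≤ (λ g → weight-≤-unpaired ¬P (λ v∈ →
                                                      ⟦⟧-true (inside (good⁻ g) v∈)))) ⟩
      ∑ V (λ A → 2 * ⟦ sub T A ∧ sub A U ⟧)      ≡⟨ ∑-*ˡ V 2 _ ⟩
      2 * ∑ V (λ A → ⟦ sub T A ∧ sub A U ⟧)
        ≡⟨ cong (2 *_) (count-interval T U (∣ U ∣ ∸ ∣ T ∣) j T⊆U (sym (m+[n∸m]≡n (p⊆q⇒∣p∣≤∣q∣ T⊆U)))
             (trans r≡ (cong (_+ j) (sym ∣T∣)))) ⟩
      2 * ((∣ U ∣ ∸ ∣ T ∣) C j)
        ≤⟨ *-monoʳ-≤ 2 (C-monoˡ-≤ j (≤-trans (∸-monoˡ-≤ ∣ T ∣ (small-territory p q R))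
             (≤-reflexive (cong (3 + w ∸_) ∣T∣)))) ⟩
      2 * (w C j)                                ∎
      where
      open ≤-Reasoning
      T U : Subset n
      T = toSet (v ∷ q ∷ p ∷ [])
      U = territory p q
      v∉ : v ∉ toSet (q ∷ p ∷ [])
      v∉ v∈ = ¬P (paired-∈ R v∈)
      ∣T∣ : ∣ T ∣ ≡ 3
      ∣T∣ = trans (∣toSet∣-∷ v∉) (cong suc (trans (∣toSet∣-∷ (fresh₁ (λ e → proj₁ R (sym e))))
              (cong suc (trans (∣toSet∣-∷ nil∉) (cong suc ∣toSet[]∣)))))
      T⊆U : T ⊆ U
      T⊆U = cons⊆ (setOf⁺ (governed? p q) (inj₂ RT)) (λ w∈ → setOf⁺ (governed? p q) (inj₁ w∈))
      inside : ∀ {A} → Good A → v ∈ˢ A → sub T A ∧ sub A U ≡ true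
      inside {A} G v∈ = ∧-true⁺ (⊆⇒sub T A (cons⊆ v∈ (proj₁ (proj₂ (both G)))))
                                (⊆⇒sub A U (λ w∈ → setOf⁺ (governed? p q) (proj₂ (proj₂ (both G)) w∈)))
        where
        both : Good A → Good A × toSet (q ∷ p ∷ []) ⊆ A × (∀ {w} → w ∈ˢ A → w ∈ˢ toSet (q ∷ p ∷ []) ⊎ RichTriple p q w)
        both G@(twin p′ q′ p″ q″ _ _ R′ _ _ R″ gov) =
          contradiction ([ paired-∈ R′ , paired-∈ R″ ]′ (gov v v∈)) ¬P
        both G@(star p′ q′ p′∈ q′∈ R′ gov) = G , subst (_⊆ A) (sym P≡P′) (cons⊆ q′∈ (cons⊆ p′∈ nil⊆)) , gov′
          where
          RT′ : RichTriple p′ q′ v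
          RT′ = [ (λ v∈P → contradiction (paired-∈ R′ v∈P) ¬P) , id ]′ (gov v v∈)
          P≡P′ : toSet (q ∷ p ∷ []) ≡ toSet (q′ ∷ p′ ∷ [])
          P≡P′ = ⊆-antisym (territory-unique R R′ (inj₂ RT) (inj₂ RT′)) (territory-unique R′ R (inj₂ RT′) (inj₂ RT))
          gov′ : ∀ {w} → w ∈ˢ A → w ∈ˢ toSet (q ∷ p ∷ []) ⊎ RichTriple p q w
          gov′ {w} w∈ with gov w w∈
          ... | inj₁ w∈P = inj₁ (subst (w ∈ˢ_) (sym P≡P′) w∈P)
          ... | inj₂ RW  with w ∈? toSet (q ∷ p ∷ [])
          ...   | yes w∈P = inj₁ w∈P
          ...   | no _    = inj₂ (subst (Rich s₃) (⊆-antisym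
                     (cons⊆ headˢ (λ x∈ → tailˢ (subst (_ ∈ˢ_) (sym P≡P′) x∈)))
                     (cons⊆ headˢ (λ x∈ → tailˢ (subst (_ ∈ˢ_) P≡P′ x∈)))) RW)

    -- Double counting of the weights. The total of each good set is at least 2 r - 4; the 4 is
    -- moved to the right to avoid subtraction.
    card-good-≤ : 2 * r * card n r good ≤ n * (n ⊔ 2 * (w C j)) + 4 * card n r good
    card-good-≤ = begin
      2 * r * card n r good
        ≡⟨ sym (∑-*ˡ V (2 * r) _) ⟩
      ∑ V (λ A → 2 * r * ⟦ good A ⟧)
        ≤⟨ ∑-mono V (λ {A} _ → pointwise A) ⟩
      ∑ V (λ A → ∑ (fins n) (λ v → ⟦ good A ⟧ * weight v A) + 4 * ⟦ good A ⟧)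
        ≡⟨ trans (∑-+ V _ _) (cong₂ _+_ (∑-swap V (fins n) _) (∑-*ˡ V 4 _)) ⟩
      ∑ (fins n) load + 4 * card n r good
        ≤⟨ +-monoˡ-≤ _ (≤-trans (∑-≤-const (fins n) (n ⊔ 2 * (w C j)) (λ {v} _ → load-≤ v))
                         (≤-reflexive (cong (_* (n ⊔ 2 * (w C j))) (length-fins n)))) ⟩
      n * (n ⊔ 2 * (w C j)) + 4 * card n r good ∎
      where
      open ≤-Reasoning
      load-≤ : ∀ v → load v ≤ n ⊔ 2 * (w C j)
      load-≤ v with paired? v
      ... | yes P = ≤-trans (load-paired v P) (m≤m⊔n n _)
      ... | no ¬P = ≤-trans (load-unpaired v ¬P) (m≤n⊔m n _)
      pointwise : ∀ A → 2 * r * ⟦ good A ⟧ ≤ ∑ (fins n) (λ v → ⟦ good A ⟧ * weight v A) + 4 * ⟦ good A ⟧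
      pointwise A = ≤-trans (go (good A) (λ e → weight-total (F-size (good-F e)) (good⁻ e)))
                      (≤-reflexive (cong (_+ 4 * ⟦ good A ⟧) (sym (∑-*ˡ (fins n) ⟦ good A ⟧ _))))
        where
        go : ∀ b → (b ≡ true → 2 * r ≤ ∑ (fins n) (λ v → weight v A) + 4) →
             2 * r * ⟦ b ⟧ ≤ ⟦ b ⟧ * ∑ (fins n) (λ v → weight v A) + 4 * ⟦ b ⟧
        go true  h = ≤-trans (≤-reflexive (*-identityʳ (2 * r))) (≤-trans (h refl)
                       (≤-reflexive (cong (_+ 4) (sym (+-identityʳ _)))))
        go false h = ≤-trans (≤-reflexive (*-zeroʳ (2 * r))) z≤n

  -- A member that is not negligible and meets the territory contains the pair governing a common
  -- vertex, and this pair is {p,q} by uniqueness. All other such members live on the at most `d`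
  -- vertices outside the territory.
  card-outside-star-≤ : ∀ p q d → RichPair p q → n ≤ ∣ territory p q ∣ + d →
    card n r (λ A → F A ∧ not (sub (toSet (q ∷ p ∷ [])) A)) ≤ length negligible + d ^ r
  card-outside-star-≤ p q d R big = begin
    card n r (λ A → F A ∧ not (sub P A))
      ≤⟨ ∑-mono V (λ {A} _ → ⟦⟧-≤ (λ e → pointwise A e)) ⟩
    ∑ V (λ A → ⟦ memb A negligible ⟧ + ⟦ sub ⊥ A ∧ sub A (∁ U) ⟧)
      ≡⟨ ∑-+ V _ _ ⟩
    card n r (λ A → memb A negligible) + ∑ V (λ A → ⟦ sub ⊥ A ∧ sub A (∁ U) ⟧)
      ≤⟨ +-mono-≤ card-negligible (≤-reflexive (count-interval ⊥ (∁ U) ∣ ∁ U ∣ r (λ v∈ → contradiction v∈ ∉⊥)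
            (cong (_+ ∣ ∁ U ∣) (sym (∣⊥∣≡0 n))) (cong (_+ r) (sym (∣⊥∣≡0 n))))) ⟩
    length negligible + ∣ ∁ U ∣ C r
      ≤⟨ +-monoʳ-≤ _ (≤-trans (C≤^ ∣ ∁ U ∣ r) (^-monoˡ-≤ r (≤-trans (≤-reflexive (∣∁p∣≡n∸∣p∣ U))
            (m≤n+o⇒m∸n≤o n ∣ U ∣ big)))) ⟩
    length negligible + d ^ r ∎
    where
    open ≤-Reasoning
    P U : Subset n
    P = toSet (q ∷ p ∷ [])
    U = territory p q
    pointwise : ∀ A → F A ∧ not (sub P A) ≡ true → 1 ≤ ⟦ memb A negligible ⟧ + ⟦ sub ⊥ A ∧ sub A (∁ U) ⟧
    pointwise A e with classify (proj₁ (∧-true⁻ e))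
    ... | inj₁ N = ≤-trans (⟦⟧-true (∈⇒memb N)) (m≤m+n _ _)
    ... | inj₂ G = ≤-trans (⟦⟧-true (∧-true⁺ (⊆⇒sub ⊥ A (λ v∈ → contradiction v∈ ∉⊥))
                      (⊆⇒sub A (∁ U) (λ {a} a∈ → x∉p⇒x∈∁p (λ a∈U → outside a a∈ a∈U))))) (m≤n+m _ _)
      where
      outside : ∀ a → a ∈ˢ A → a ∈ˢ U → Absurd
      outside a a∈ a∈U =
        let p′ , q′ , R′ , P′⊆A , a∈′ = governor G a a∈
            P⊆A = λ {w} (w∈ : w ∈ˢ P) → P′⊆A (territory-unique R R′ (setOf⁻ (governed? p q) a∈U) a∈′ w∈)
        in contradiction (trans (sym (proj₂ (∧-true⁻ {F A} e))) (cong not (⊆⇒sub P A P⊆A))) λ ()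

-- Families close to a star

∑-positive : ∀ {X : Set} (p : X → Bool) xs → 1 ≤ ∑ xs (λ x → ⟦ p x ⟧) → ∃[ x ] (x ∈ xs × p x ≡ true)
∑-positive p (y ∷ xs) h with p y in eq
... | true  = y , here refl , eq
... | false = let x , x∈ , e = ∑-positive p xs h in x , there x∈ , e

card-star : ∀ {n} r j (P : Subset n) → ∣ P ∣ ≡ 2 → r ≡ 2 + j → card n r (sub P) ≡ (n ∸ 2) C j
card-star {n} r j P ∣P∣ r≡ = trans
  (∑-cong (vertices n r) (λ {A} _ → cong ⟦_⟧ (sym (trans (cong (sub P A ∧_) (⊆⇒sub A ⊤ (λ _ → ∈⊤))) (∧-id (sub P A))))))
  (count-interval P ⊤ (n ∸ 2) j (λ _ → ∈⊤)
    (trans (∣⊤∣≡n n) (trans (sym (m+[n∸m]≡n 2≤n)) (cong (_+ (n ∸ 2)) (sym ∣P∣))))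
    (trans r≡ (cong (_+ j) (sym ∣P∣))))
  where
  ∧-id : ∀ b → b ∧ true ≡ b
  ∧-id true  = refl
  ∧-id false = refl
  2≤n : 2 ≤ n
  2≤n = subst₂ _≤_ ∣P∣ (∣⊤∣≡n n) (p⊆q⇒∣p∣≤∣q∣ {p = P} {⊤} (λ _ → ∈⊤))

-- F differs from the star of {p,q} by b sets outside the star and by fewer missing sets.
-- A set outside the star with few neighbours in F forces many missing sets through each of its vertices.
module NearStar {n : ℕ} (j L : ℕ) (F : Subset n → Bool)
  (F-size : ∀ {A} → F A ≡ true → ∣ A ∣ ≡ 3 + j) (p q : Fin n) (p≢q : p ≢ q)
  (large : (n ∸ 2) C suc j < card n (3 + j) F)
  (sparse-near-star : 1 ≤ card n (3 + j) (λ A → F A xor sub (toSet (q ∷ p ∷ [])) A) →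
    degreeSum n (3 + j) F ≤ 2 * L * card n (3 + j) (λ A → F A xor sub (toSet (q ∷ p ∷ [])) A)) where

  r : ℕ
  r = 3 + j

  V : List (Subset n)
  V = vertices n r

  P : Subset n
  P = toSet (q ∷ p ∷ [])

  ∣P∣ : ∣ P ∣ ≡ 2
  ∣P∣ = trans (∣toSet∣-∷ (fresh₁ (λ e → p≢q (sym e)))) (cong suc (trans (∣toSet∣-∷ nil∉) (cong suc ∣toSet[]∣)))

  inner outer missing : Subset n → Bool
  inner A   = F A ∧ sub P A
  outer A   = F A ∧ not (sub P A)
  missing A = not (F A) ∧ sub P A

  b m : ℕ
  b = card n r outer
  m = card n r missing

  private
    split-star : ∀ x y → ⟦ x ∧ y ⟧ + ⟦ not x ∧ y ⟧ ≡ ⟦ y ⟧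
    split-star true  true  = refl
    split-star true  false = refl
    split-star false true  = refl
    split-star false false = refl

    split-F : ∀ x y → ⟦ x ∧ y ⟧ + ⟦ x ∧ not y ⟧ ≡ ⟦ x ⟧
    split-F true  true  = refl
    split-F true  false = refl
    split-F false true  = refl
    split-F false false = refl

    split-xor : ∀ x y → ⟦ x xor y ⟧ ≡ ⟦ x ∧ not y ⟧ + ⟦ not x ∧ y ⟧
    split-xor true  true  = refl
    split-xor true  false = refl
    split-xor false true  = refl
    split-xor false false = refl

  -- F and the star share the inner sets, and F is larger.
  m<b : m < b
  m<b = +-cancelˡ-< (card n r inner) m b (subst₂ _<_
    (sym (trans (sym (∑-+ V _ _)) (trans (∑-cong V (λ {A} _ → split-star (F A) (sub P A))) (card-star r (suc j) P ∣P∣ refl))))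
    (sym (trans (sym (∑-+ V _ _)) (∑-cong V (λ {A} _ → split-F (F A) (sub P A))))) large)

  card-xor : card n r (λ A → F A xor sub P A) ≡ b + m
  card-xor = trans (∑-cong V (λ {A} _ → split-xor (F A) (sub P A))) (∑-+ V _ _)

  degree : Subset n → ℕ
  degree B = ∑ V (λ A → ⟦ inner A ⟧ * ⟦ adj B A ⟧)

  -- Here sparseness is measured by the distance b + m < 2 b from the star.
  degree-sum-≤ : ∑ V (λ B → ⟦ outer B ⟧ * degree B) ≤ 4 * L * b
  degree-sum-≤ = begin
    ∑ V (λ B → ⟦ outer B ⟧ * degree B)
      ≤⟨ ∑-mono V (λ {B} _ → *-mono-≤ (∧-≤ (F B) _) (∑-mono V (λ {A} _ → *-monoˡ-≤ ⟦ adj B A ⟧ (∧-≤ (F A) _)))) ⟩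
    degreeSum n r F          ≤⟨ sparse-near-star (≤-trans (≤-trans (s≤s z≤n) m<b) (≤-trans (m≤m+n b m) (≤-reflexive (sym card-xor)))) ⟩
    2 * L * card n r (λ A → F A xor sub P A) ≡⟨ cong (2 * L *_) card-xor ⟩
    2 * L * (b + m)          ≤⟨ *-monoʳ-≤ (2 * L) (+-monoʳ-≤ b (<⇒≤ m<b)) ⟩
    2 * L * (b + b)          ≡⟨ arith L b ⟩
    4 * L * b                ∎
    where
    open ≤-Reasoning
    ∧-≤ : ∀ x y → ⟦ x ∧ y ⟧ ≤ ⟦ x ⟧
    ∧-≤ true  true  = ≤-refl
    ∧-≤ true  false = z≤n
    ∧-≤ false _     = z≤n
    arith : ∀ L b → 2 * L * (b + b) ≡ 4 * L * b
    arith = solve-∀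

  low : Subset n → Bool
  low B = outer B ∧ does (degree B ≤? 8 * L)

  b′ : ℕ
  b′ = card n r low

  -- Markov's inequality: outside sets have mean degree at most 4 L. The factor 8 L + 1 is the least
  -- degree that is not low, and it can be cancelled even when L = 0.
  b≤2b′ : b ≤ 2 * b′
  b≤2b′ = *-cancelˡ-≤ (suc (8 * L)) (+-cancelʳ-≤ (8 * L * b) _ _ (begin
    suc (8 * L) * b + 8 * L * b            ≤⟨ +-monoʳ-≤ (suc (8 * L) * b) (m≤n+m _ b) ⟩
    suc (8 * L) * b + (b + 8 * L * b)      ≡⟨ arith₁ (suc (8 * L)) b ⟩
    2 * (suc (8 * L) * b)                  ≡⟨ cong (2 *_) (sym (∑-*ˡ V (suc (8 * L)) _)) ⟩
    2 * ∑ V (λ B → suc (8 * L) * ⟦ outer B ⟧)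
      ≤⟨ *-monoʳ-≤ 2 (∑-mono V (λ {B} _ → pointwise B)) ⟩
    2 * ∑ V (λ B → suc (8 * L) * ⟦ low B ⟧ + ⟦ outer B ⟧ * degree B)
      ≡⟨ cong (2 *_) (trans (∑-+ V _ _) (cong (_+ ∑ V (λ B → ⟦ outer B ⟧ * degree B)) (∑-*ˡ V (suc (8 * L)) _))) ⟩
    2 * (suc (8 * L) * b′ + ∑ V (λ B → ⟦ outer B ⟧ * degree B))
      ≤⟨ *-monoʳ-≤ 2 (+-monoʳ-≤ (suc (8 * L) * b′) degree-sum-≤) ⟩
    2 * (suc (8 * L) * b′ + 4 * L * b)     ≡⟨ arith₂ (suc (8 * L)) b′ L b ⟩
    suc (8 * L) * (2 * b′) + 8 * L * b     ∎))
    where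
    open ≤-Reasoning
    arith₁ : ∀ x b → x * b + x * b ≡ 2 * (x * b)
    arith₁ = solve-∀
    arith₂ : ∀ x c L b → 2 * (x * c + 4 * L * b) ≡ x * (2 * c) + 8 * L * b
    arith₂ = solve-∀
    pointwise : ∀ B → suc (8 * L) * ⟦ outer B ⟧ ≤ suc (8 * L) * ⟦ low B ⟧ + ⟦ outer B ⟧ * degree B
    pointwise B = go (outer B) (degree B ≤? 8 * L)
      where
      go : ∀ x → (d : Dec (degree B ≤ 8 * L)) →
        suc (8 * L) * ⟦ x ⟧ ≤ suc (8 * L) * ⟦ x ∧ does d ⟧ + ⟦ x ⟧ * degree B
      go false d       = ≤-trans (≤-reflexive (*-zeroʳ (8 * L))) z≤n
      go true  (yes _) = m≤m+n _ _
      go true  (no ¬d) = ≤-trans (≤-reflexive (*-identityʳ (suc (8 * L)))) (≤-trans (≰⇒> ¬d)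
        (≤-trans (≤-reflexive (sym (+-identityʳ (degree B)))) (m≤n+m _ (suc (8 * L) * 0))))

  low⁻ : ∀ {B} → low B ≡ true → F B ≡ true × sub P B ≡ false × degree B ≤ 8 * L
  low⁻ {B} e =
    let e₁ , e₂ = ∧-true⁻ {outer B} e
        e₃ , e₄ = ∧-true⁻ {F B} e₁
    in e₃ , not-true e₄ , true-does (degree B ≤? 8 * L) e₂
    where
    not-true : ∀ {x} → not x ≡ true → x ≡ false
    not-true {false} _ = refl

  missing-through : Fin n → ℕ
  missing-through v = ∑ V (λ A → ⟦ missing A ⟧ * 𝟙 (v ∈? A))

  missing-through-≤ : ∀ v → missing-through v ≤ m
  missing-through-≤ v = ∑-mono V (λ {A} _ → ≤-trans (*-monoʳ-≤ ⟦ missing A ⟧ (⟦⟧≤1 (does (v ∈? A)))) (≤-reflexive (*-identityʳ _)))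

  -- The whole interval consists of star sets adjacent to B. At most 8 L of them belong to F; the
  -- others are missing and contain `v`.
  forced : ∀ B v T W → degree B ≤ 8 * L → T ⊆ W → v ∈ˢ T → P ⊆ T →
    (∀ A → T ⊆ A → A ⊆ W → adj B A ≡ true) → ∑ V (λ A → ⟦ sub T A ∧ sub A W ⟧) ≤ 8 * L + missing-through v
  forced B v T W deg T⊆W v∈ P⊆T adjacent = begin
    ∑ V (λ A → ⟦ sub T A ∧ sub A W ⟧)  ≤⟨ ∑-mono V (λ {A} _ → ⟦⟧-≤ (λ e → pointwise A e)) ⟩
    ∑ V (λ A → ⟦ inner A ⟧ * ⟦ adj B A ⟧ + ⟦ missing A ⟧ * 𝟙 (v ∈? A)) ≡⟨ ∑-+ V _ _ ⟩
    degree B + missing-through v       ≤⟨ +-monoˡ-≤ _ deg ⟩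
    8 * L + missing-through v          ∎
    where
    open ≤-Reasoning
    pointwise : ∀ A → sub T A ∧ sub A W ≡ true → 1 ≤ ⟦ inner A ⟧ * ⟦ adj B A ⟧ + ⟦ missing A ⟧ * 𝟙 (v ∈? A)
    pointwise A e = go (F A)
      where
      T⊆A : T ⊆ A
      T⊆A = sub⇒⊆ T A (proj₁ (∧-true⁻ e))
      A⊆W : A ⊆ W
      A⊆W = sub⇒⊆ A W (proj₂ (∧-true⁻ {sub T A} e))
      go : ∀ x → 1 ≤ ⟦ x ∧ sub P A ⟧ * ⟦ adj B A ⟧ + ⟦ not x ∧ sub P A ⟧ * 𝟙 (v ∈? A)
      go true  rewrite ⊆⇒sub P A (λ w∈ → T⊆A (P⊆T w∈)) | adjacent A T⊆A A⊆W = s≤s z≤n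
      go false rewrite ⊆⇒sub P A (λ w∈ → T⊆A (P⊆T w∈)) | does-true (v ∈? A) (T⊆A v∈) = ≤-refl

  private
    complement-size : ∀ (B W : Subset n) i → ∣ B ∣ ≡ r → ∁ B ⊆ W → n ∸ r ∸ i ≤ ∣ W ∣ ∸ i
    complement-size B W i ∣B∣ ∁B⊆W = ∸-monoˡ-≤ i (≤-trans
      (≤-reflexive (sym (trans (∣∁p∣≡n∸∣p∣ B) (cong (n ∸_) ∣B∣)))) (p⊆q⇒∣p∣≤∣q∣ ∁B⊆W))

  -- B contains exactly one of p and q, so a star set inside `∁ B ∪ P` meets B in that vertex alone.
  -- About n^(r-2) sets would have to be missing.
  touching : ∀ {B} → low B ≡ true → p ∈ˢ B ⊎ q ∈ˢ B → (n ∸ r ∸ 2) C suc j ≤ 8 * L + b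
  touching {B} e a∈ = begin
    (n ∸ r ∸ 2) C suc j            ≤⟨ C-monoˡ-≤ (suc j) (complement-size B W 2 (F-size FB) (λ v∈ → x∈p∪q⁺ (inj₁ v∈))) ⟩
    (∣ W ∣ ∸ 2) C suc j
      ≡⟨ sym (count-interval P W (∣ W ∣ ∸ 2) (suc j) P⊆W
           (trans (sym (m+[n∸m]≡n (subst (_≤ ∣ W ∣) ∣P∣ (p⊆q⇒∣p∣≤∣q∣ P⊆W)))) (cong (_+ (∣ W ∣ ∸ 2)) (sym ∣P∣)))
           (cong (_+ suc j) (sym ∣P∣))) ⟩
    ∑ V (λ A → ⟦ sub P A ∧ sub A W ⟧) ≤⟨ forced B p P W deg P⊆W (tailˢ headˢ) id adjacent ⟩
    8 * L + missing-through p      ≤⟨ +-monoʳ-≤ (8 * L) (≤-trans (missing-through-≤ p) (<⇒≤ m<b)) ⟩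
    8 * L + b                      ∎
    where
    open ≤-Reasoning
    FB = proj₁ (low⁻ e)
    deg = proj₂ (proj₂ (low⁻ e))
    W : Subset n
    W = ∁ B ∪ P
    P⊆W : P ⊆ W
    P⊆W v∈ = x∈p∪q⁺ (inj₂ v∈)
    not-both : p ∈ˢ B → q ∈ˢ B → Absurd
    not-both p∈ q∈ = contradiction (trans (sym (⊆⇒sub P B (cons⊆ q∈ (cons⊆ p∈ nil⊆)))) (proj₁ (proj₂ (low⁻ e)))) λ ()
    common : p ∈ˢ B ⊎ q ∈ˢ B → ∃[ a ] (a ∈ˢ B × a ∈ˢ P × (∀ w → w ∈ˢ B → w ∈ˢ P → w ≡ a))
    common (inj₁ p∈) = p , p∈ , tailˢ headˢ , λ w w∈B w∈P → [ (λ { refl → absurd (not-both p∈ w∈B) }) , id ]′ (pair⁻ w∈P)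
    common (inj₂ q∈) = q , q∈ , headˢ , λ w w∈B w∈P → [ id , (λ { refl → absurd (not-both w∈B q∈) }) ]′ (pair⁻ w∈P)
    adjacent : ∀ A → P ⊆ A → A ⊆ W → adj B A ≡ true
    adjacent A P⊆A A⊆W = let a , a∈B , a∈P , unique = common a∈ in
      singleton-∩⇒adj B A a a∈B (P⊆A a∈P) (λ w w∈B w∈A →
        [ (λ w∈∁ → contradiction w∈B (x∈∁p⇒x∉p w∈∁)) , unique w w∈B ]′ (x∈p∪q⁻ (∁ B) P (A⊆W w∈A)))

  c₁ : ℕ
  c₁ = (n ∸ r ∸ 3) C j

  -- If B misses the pair, a set through p, q and v whose other vertices avoid B meets B in `v`
  -- alone.
  avoiding : ∀ {B v} → low B ≡ true → p ∉ B → q ∉ B → v ∈ˢ B → c₁ ≤ 8 * L + missing-through v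
  avoiding {B} {v} e p∉ q∉ v∈ = begin
    (n ∸ r ∸ 3) C j                ≤⟨ C-monoˡ-≤ j (complement-size B W 3 (F-size FB) (λ v∈ → x∈p∪q⁺ (inj₁ v∈))) ⟩
    (∣ W ∣ ∸ 3) C j
      ≡⟨ sym (count-interval T W (∣ W ∣ ∸ 3) j T⊆W
           (trans (sym (m+[n∸m]≡n (subst (_≤ ∣ W ∣) ∣T∣ (p⊆q⇒∣p∣≤∣q∣ T⊆W)))) (cong (_+ (∣ W ∣ ∸ 3)) (sym ∣T∣)))
           (cong (_+ j) (sym ∣T∣))) ⟩
    ∑ V (λ A → ⟦ sub T A ∧ sub A W ⟧) ≤⟨ forced B v T W deg T⊆W headˢ tailˢ adjacent ⟩
    8 * L + missing-through v      ∎
    where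
    open ≤-Reasoning
    FB = proj₁ (low⁻ e)
    deg = proj₂ (proj₂ (low⁻ e))
    T W : Subset n
    T = toSet (v ∷ q ∷ p ∷ [])
    W = ∁ B ∪ T
    T⊆W : T ⊆ W
    T⊆W v∈ = x∈p∪q⁺ (inj₂ v∈)
    P∩B : ∀ {w} → w ∈ˢ P → w ∉ B
    P∩B w∈P w∈B = [ (λ { refl → q∉ w∈B }) , (λ { refl → p∉ w∈B }) ]′ (pair⁻ w∈P)
    ∣T∣ : ∣ T ∣ ≡ 3
    ∣T∣ = trans (∣toSet∣-∷ (λ v∈P → P∩B v∈P v∈)) (cong suc ∣P∣)
    adjacent : ∀ A → T ⊆ A → A ⊆ W → adj B A ≡ true
    adjacent A T⊆A A⊆W = singleton-∩⇒adj B A v v∈ (T⊆A headˢ) (λ w w∈B w∈A →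
        [ (λ w∈∁ → contradiction w∈B (x∈∁p⇒x∉p w∈∁))
        , (λ w∈T → [ id , (λ w∈P → contradiction w∈B (P∩B w∈P)) ]′ (unconsˢ w∈T)) ]′ (x∈p∪q⁻ (∁ B) T (A⊆W w∈A)))

  -- In the second alternative no low set meets the pair, and u is the size of the union U of the
  -- low sets. Summing `avoiding` over U counts each missing set at most r times; the low sets are
  -- r-subsets of U, so they number at most u^r.
  dichotomy : (n ∸ r ∸ 2) C suc j ≤ 8 * L + b ⊎
    ∃[ u ] (u * c₁ ≤ 8 * L * u + r * b × b ≤ 2 * u ^ r × c₁ ≤ 8 * L + b)
  dichotomy with all (λ B → not (low B ∧ (does (p ∈? B) ∨ does (q ∈? B)))) V in eq
  ... | false =
    let B , _ , e = all-false _ V eq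
        e₁ , e₂ = ∧-true⁻ {low B} (not-false e)
    in inj₁ (touching e₁ (touch B e₂))
    where
    not-false : ∀ {x} → not x ≡ false → x ≡ true
    not-false {true} _ = refl
    touch : ∀ B → does (p ∈? B) ∨ does (q ∈? B) ≡ true → p ∈ˢ B ⊎ q ∈ˢ B
    touch B e with p ∈? B | q ∈? B
    ... | yes p∈ | _      = inj₁ p∈
    ... | no _   | yes q∈ = inj₂ q∈
  ... | true = inj₂ (∣ U ∣ , bound₁ , ≤-trans b≤2b′ (*-monoʳ-≤ 2 bound₂) , bound₃)
    where
    open ≤-Reasoning
    apart : ∀ {B} → B ∈ V → low B ≡ true → p ∉ B × q ∉ B
    apart {B} B∈ e with all-true⁻ _ V eq B∈
    ... | h rewrite e with p ∈? B | q ∈? B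
    ...   | no p∉ | no q∉ = p∉ , q∉
    in-low? : ∀ v → Dec (any (λ B → low B ∧ does (v ∈? B)) V ≡ true)
    in-low? v = any (λ B → low B ∧ does (v ∈? B)) V Data.Bool.≟ true
    U : Subset n
    U = setOf in-low?
    any-true⁻ : ∀ {X : Set} (f : X → Bool) xs → any f xs ≡ true → ∃[ x ] (x ∈ xs × f x ≡ true)
    any-true⁻ f (y ∷ xs) e with f y in fy
    ... | true  = y , here refl , fy
    ... | false = let x , x∈ , fx = any-true⁻ f xs e in x , there x∈ , fx
    any-true⁺ : ∀ {X : Set} (f : X → Bool) {xs x} → x ∈ xs → f x ≡ true → any f xs ≡ true
    any-true⁺ f (here refl) e rewrite e = refl
    any-true⁺ f {y ∷ _} (there x∈) e with f y
    ... | true  = refl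
    ... | false = any-true⁺ f x∈ e
    c₁-≤ : ∀ v → v ∈ˢ U → c₁ ≤ 8 * L + missing-through v
    c₁-≤ v v∈ =
      let B , B∈ , e = any-true⁻ _ V (setOf⁻ in-low? v∈)
          e₁ , e₂ = ∧-true⁻ {low B} e
          p∉ , q∉ = apart B∈ e₁
      in avoiding e₁ p∉ q∉ (true-does (v ∈? B) e₂)
    low⊆U : ∀ {B} → B ∈ V → low B ≡ true → B ⊆ U
    low⊆U {B} B∈ e {v} v∈ = setOf⁺ in-low? (any-true⁺ (λ B → low B ∧ does (v ∈? B)) B∈ (∧-true⁺ e (does-true (v ∈? B) v∈)))
    missing-sum : ∑ (fins n) missing-through ≤ r * b
    missing-sum = begin
      ∑ (fins n) missing-through                                ≡⟨ ∑-swap (fins n) V _ ⟩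
      ∑ V (λ A → ∑ (fins n) (λ v → ⟦ missing A ⟧ * 𝟙 (v ∈? A))) ≡⟨ ∑-cong V (λ {A} A∈ →
          trans (∑-*ˡ (fins n) ⟦ missing A ⟧ _) (trans (cong (⟦ missing A ⟧ *_) (trans (∑-∈? A) (∈-vertices⁻ A∈))) (*-comm ⟦ missing A ⟧ r))) ⟩
      ∑ V (λ A → r * ⟦ missing A ⟧)                             ≡⟨ ∑-*ˡ V r _ ⟩
      r * m                                                     ≤⟨ *-monoʳ-≤ r (<⇒≤ m<b) ⟩
      r * b                                                     ∎
    bound₁ : ∣ U ∣ * c₁ ≤ 8 * L * ∣ U ∣ + r * b
    bound₁ = begin
      ∣ U ∣ * c₁                               ≡⟨ cong (_* c₁) (sym (∑-∈? U)) ⟩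
      ∑ (fins n) (λ v → 𝟙 (v ∈? U)) * c₁       ≡⟨ sym (∑-*ʳ (fins n) c₁ _) ⟩
      ∑ (fins n) (λ v → 𝟙 (v ∈? U) * c₁)       ≤⟨ ∑-mono (fins n) (λ {v} _ → pointwise v) ⟩
      ∑ (fins n) (λ v → 8 * L * 𝟙 (v ∈? U) + missing-through v)
        ≡⟨ trans (∑-+ (fins n) _ _) (cong (_+ ∑ (fins n) missing-through) (trans (∑-*ˡ (fins n) (8 * L) _) (cong (8 * L *_) (∑-∈? U)))) ⟩
      8 * L * ∣ U ∣ + ∑ (fins n) missing-through ≤⟨ +-monoʳ-≤ _ missing-sum ⟩
      8 * L * ∣ U ∣ + r * b                    ∎
      where
      pointwise : ∀ v → 𝟙 (v ∈? U) * c₁ ≤ 8 * L * 𝟙 (v ∈? U) + missing-through v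
      pointwise v = go (v ∈? U)
        where
        go : (d : Dec (v ∈ˢ U)) → 𝟙 d * c₁ ≤ 8 * L * 𝟙 d + missing-through v
        go (no _)   = z≤n
        go (yes v∈) = ≤-trans (≤-reflexive (+-identityʳ c₁)) (≤-trans (c₁-≤ v v∈)
                        (+-monoˡ-≤ (missing-through v) (≤-reflexive (sym (*-identityʳ (8 * L))))))
    bound₂ : b′ ≤ ∣ U ∣ ^ r
    bound₂ = begin
      b′                                  ≤⟨ ∑-mono V (λ {B} B∈ → ⟦⟧-≤ (λ e → ⟦⟧-true (∧-true⁺
                                               (⊆⇒sub ⊥ B (λ v∈ → contradiction v∈ ∉⊥)) (⊆⇒sub B U (low⊆U B∈ e))))) ⟩
      ∑ V (λ B → ⟦ sub ⊥ B ∧ sub B U ⟧)   ≡⟨ count-interval ⊥ U ∣ U ∣ r (λ v∈ → contradiction v∈ ∉⊥)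
                                               (cong (_+ ∣ U ∣) (sym (∣⊥∣≡0 n))) (cong (_+ r) (sym (∣⊥∣≡0 n))) ⟩
      ∣ U ∣ C r                           ≤⟨ C≤^ ∣ U ∣ r ⟩
      ∣ U ∣ ^ r                           ∎
    bound₃ : c₁ ≤ 8 * L + b
    bound₃ =
      let B , B∈ , e = ∑-positive low V (b′-positive b′ b≤2b′)
          v , v∈ , _ = ∃-outside B ⊥ (subst₂ _<_ (sym (∣⊥∣≡0 n)) (sym (∈-vertices⁻ B∈)) (s≤s z≤n))
      in ≤-trans (c₁-≤ v (low⊆U B∈ e v∈)) (+-monoʳ-≤ (8 * L) (≤-trans (missing-through-≤ v) (<⇒≤ m<b)))
      where
      b′-positive : ∀ x → b ≤ 2 * x → 1 ≤ x
      b′-positive zero    h = contradiction (≤-trans m<b h) λ ()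
      b′-positive (suc x) h = s≤s z≤n

-- The extremal bound for sparse families

!-mono-≤ : ∀ {i k} → i ≤ k → i ! ≤ k !
!-mono-≤ {i} {k} i≤k with ≤⇒≤′ i≤k
... | ≤′-refl = ≤-refl
... | ≤′-step {k} q = ≤-trans (!-mono-≤ (≤′⇒≤ q)) (m≤m+n (k !) _)

^-distribʳ-* : ∀ m n i → (m * n) ^ i ≡ m ^ i * n ^ i
^-distribʳ-* m n zero    = refl
^-distribʳ-* m n (suc i) = trans (cong (m * n *_) (^-distribʳ-* m n i)) (arith m n (m ^ i) (n ^ i))
  where
  arith : ∀ a b x y → a * b * (x * y) ≡ a * x * (b * y)
  arith = solve-∀

opaque
  κ : ℕ → ℕ
  κ r = 2 ^ r * r !

  κ-def : ∀ r → κ r ≡ 2 ^ r * r !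
  κ-def r = refl

-- With h = n - x - i at least n/2, the product i! C(n-x,i) is at least h^i, hence at least (n/2)^i;
-- `κ` absorbs 2^i and i! for all i up to r.
^≤κ*C : ∀ {r} i x n → i ≤ r → 2 * (x + i) ≤ n → n ^ i ≤ κ r * ((n ∸ x) C i)
^≤κ*C {r} i x n i≤r le = begin
  n ^ i                            ≤⟨ ^-monoˡ-≤ i n≤2h ⟩
  (2 * h) ^ i                      ≡⟨ ^-distribʳ-* 2 h i ⟩
  2 ^ i * h ^ i                    ≤⟨ *-mono-≤ (^-monoʳ-≤ 2 i≤r) (^≤!*C h i) ⟩
  2 ^ r * (i ! * ((h + i) C i))    ≤⟨ *-monoʳ-≤ (2 ^ r) (*-mono-≤ (!-mono-≤ i≤r) (≤-reflexive (cong (_C i) h+i))) ⟩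
  2 ^ r * (r ! * ((n ∸ x) C i))    ≡⟨ trans (sym (*-assoc (2 ^ r) (r !) _)) (cong (_* ((n ∸ x) C i)) (sym (κ-def r))) ⟩
  κ r * ((n ∸ x) C i)              ∎
  where
  open ≤-Reasoning
  h = n ∸ (x + i)
  x+i≤n : x + i ≤ n
  x+i≤n = ≤-trans (m≤m+n (x + i) _) le
  n≤2h : n ≤ 2 * h
  n≤2h = +-cancelʳ-≤ (2 * (x + i)) n (2 * h) (begin
    n + 2 * (x + i)              ≤⟨ +-monoʳ-≤ n le ⟩
    n + n                        ≡⟨ cong (n +_) (sym (+-identityʳ n)) ⟩
    2 * n                        ≡⟨ cong (2 *_) (sym (m∸n+n≡m x+i≤n)) ⟩
    2 * (h + (x + i))            ≡⟨ *-distribˡ-+ 2 h (x + i) ⟩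
    2 * h + 2 * (x + i)          ∎)
  h+i : h + i ≡ n ∸ x
  h+i = trans (cong (_+ i) (sym (∸-+-assoc n x i))) (m∸n+n≡m (m+n≤o⇒m≤o∸n i (subst (_≤ n) (+-comm x i) x+i≤n)))

module Params (r L : ℕ) where

  -- E n^(r-3) bounds the number of negligible sets, d the complement of the largest territory,
  -- and t the vertices covered by the low-degree sets outside the star.
  opaque
    E d t : ℕ
    E = 2 ^ r * (2 ^ r * (suc r * (suc r * suc (4 * L + 2 * r)) * r)) ^ 3
    d = 2 * κ r * (2 + r * E)
    t = 2 * κ r * (r * suc E)

    E-def : E ≡ 2 ^ r * (2 ^ r * (suc r * (suc r * suc (4 * L + 2 * r)) * r)) ^ 3
    E-def = refl

    d-def : d ≡ 2 * κ r * (2 + r * E)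
    d-def = refl

    t-def : t ≡ 2 * κ r * (r * suc E)
    t-def = refl

  opaque
    -- Every lower bound on n used below is a summand.
    threshold : ℕ
    threshold = 2 * (3 + d + r + r + 2) + (15 + 2 * r * E * κ r) + d ^ r + suc (κ r * (8 * L + suc E))
      + 16 * κ r * L + suc (κ r * (8 * L + 2 * t ^ r))

    threshold-def : threshold ≡ 2 * (3 + d + r + r + 2) + (15 + 2 * r * E * κ r) + d ^ r + suc (κ r * (8 * L + suc E))
      + 16 * κ r * L + suc (κ r * (8 * L + 2 * t ^ r))
    threshold-def = refl

-- The case where the larger load bound is n. Here N = n - 3, k = r - 2 and c = C(N,r-3). Then k G
-- is at most n²/2, about half of the required (N + 1) c even when c = N; the slack covers the
-- negligible sets, and the 15 covers the lower-order terms of (N + 3)².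
contradiction-paired : ∀ N k E κ c n^j G neg → 15 + 2 * k * E * κ ≤ 3 + N → N ≤ c → n^j ≤ κ * c → neg ≤ E * n^j →
  suc (suc N * c) ≤ k * G + k * neg → 2 * (k * G) ≤ (3 + N) * (3 + N) → Absurd
contradiction-paired N k E κ c n^j G neg big N≤c n^j≤ neg≤ upper G≤ = <-irrefl refl (begin-strict
  2 * (suc N * c)                                 <⟨ *-monoʳ-< 2 upper ⟩
  2 * (k * G + k * neg)                           ≡⟨ *-distribˡ-+ 2 (k * G) (k * neg) ⟩
  2 * (k * G) + 2 * (k * neg)                     ≤⟨ +-mono-≤ G≤ (*-monoʳ-≤ 2 (*-monoʳ-≤ k (≤-trans neg≤ (*-monoʳ-≤ E n^j≤)))) ⟩
  (3 + N) * (3 + N) + 2 * (k * (E * (κ * c)))     ≡⟨ cong₂ _+_ (cong (λ z → (3 + z) * (3 + z)) (sym N≡)) (arith₁ k E κ c) ⟩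
  (3 + (12 + K + e)) * (3 + (12 + K + e)) + K * c ≤⟨ +-monoˡ-≤ (K * c) (≤-trans (m≤m+n _ _) (≤-reflexive (arith₂ K e))) ⟩
  (12 + K + e + 14 + e) * (12 + K + e) + K * c    ≤⟨ +-monoˡ-≤ (K * c) (*-monoʳ-≤ (12 + K + e + 14 + e) (subst (_≤ c) (sym N≡) N≤c)) ⟩
  (12 + K + e + 14 + e) * c + K * c               ≡⟨ arith₃ K e c ⟩
  2 * (suc (12 + K + e) * c)                      ≡⟨ cong (λ z → 2 * (suc z * c)) N≡ ⟩
  2 * (suc N * c)                                 ∎)
  where
  open ≤-Reasoning
  K e : ℕ
  K = 2 * k * E * κ
  e = N ∸ (12 + K)
  N≡ : 12 + K + e ≡ N
  N≡ = m+[n∸m]≡n (+-cancelˡ-≤ 3 (12 + K) N big)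
  arith₁ : ∀ k E κ c → 2 * (k * (E * (κ * c))) ≡ 2 * k * E * κ * c
  arith₁ = solve-∀
  arith₂ : ∀ K e → (3 + (12 + K + e)) * (3 + (12 + K + e)) + (87 + 8 * K + 8 * e + e * (12 + K + e)) ≡
    (12 + K + e + 14 + e) * (12 + K + e)
  arith₂ = solve-∀
  arith₃ : ∀ K e c → (12 + K + e + 14 + e) * c + K * c ≡ 2 * (suc (12 + K + e) * c)
  arith₃ = solve-∀

-- Beyond (N + 1) c′ the upper bound has an excess of at most 2 + r E units of n^(r-3): two from N +
-- 3 against N + 1, the rest from negligible sets. Omitting `d` vertices saves (N + 1) d x. In the
-- choice of `d`, κ compares x with n^ρ and the leading 2 compares N + 3 with N + 1.
contradiction-territory : ∀ N k r E κ d c c′ x n^ρ G neg → 1 ≤ N → k ≤ r → d ≡ 2 * κ * (2 + r * E) →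
  c′ + d * x ≤ c → c′ ≤ (3 + N) * n^ρ → n^ρ ≤ κ * x → neg ≤ E * ((3 + N) * n^ρ) →
  suc (suc N * c) ≤ k * G + k * neg → k * G ≤ (3 + N) * c′ → Absurd
contradiction-territory N k r E κ d c c′ x n^ρ G neg 1≤N k≤r refl gain c′≤ n^ρ≤ neg≤ upper G≤ = <-irrefl refl (begin-strict
  suc N * c′ + (3 + N) * n^ρ * (2 + r * E)            ≤⟨ +-monoʳ-≤ (suc N * c′) lower ⟩
  suc N * c′ + suc N * (d * x)                        ≡⟨ sym (*-distribˡ-+ (suc N) c′ (d * x)) ⟩
  suc N * (c′ + d * x)                                ≤⟨ *-monoʳ-≤ (suc N) gain ⟩
  suc N * c                                           <⟨ upper ⟩
  k * G + k * neg                                     ≤⟨ +-mono-≤ G≤ (*-mono-≤ k≤r neg≤) ⟩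
  (3 + N) * c′ + r * (E * ((3 + N) * n^ρ))            ≡⟨ cong (_+ r * (E * ((3 + N) * n^ρ))) (arith₁ N c′) ⟩
  suc N * c′ + 2 * c′ + r * (E * ((3 + N) * n^ρ))     ≤⟨ +-monoˡ-≤ _ (+-monoʳ-≤ (suc N * c′) (*-monoʳ-≤ 2 c′≤)) ⟩
  suc N * c′ + 2 * ((3 + N) * n^ρ) + r * (E * ((3 + N) * n^ρ)) ≡⟨ arith₂ (suc N * c′) ((3 + N) * n^ρ) r E ⟩
  suc N * c′ + (3 + N) * n^ρ * (2 + r * E)            ∎)
  where
  open ≤-Reasoning
  arith₁ : ∀ N c → (3 + N) * c ≡ suc N * c + 2 * c
  arith₁ = solve-∀
  arith₂ : ∀ a y r E → a + 2 * y + r * (E * y) ≡ a + y * (2 + r * E)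
  arith₂ = solve-∀
  arith₃ : ∀ N κ x z → 2 * suc N * (κ * x) * z ≡ suc N * (2 * κ * z * x)
  arith₃ = solve-∀
  arith₄ : ∀ N → N + (N + 2) ≡ 2 * suc N
  arith₄ = solve-∀
  3+N≤ : 3 + N ≤ 2 * suc N
  3+N≤ = begin
    3 + N          ≡⟨ +-comm 3 N ⟩
    N + 3          ≤⟨ +-monoʳ-≤ N (+-monoˡ-≤ 2 1≤N) ⟩
    N + (N + 2)    ≡⟨ arith₄ N ⟩
    2 * suc N      ∎
  lower : (3 + N) * n^ρ * (2 + r * E) ≤ suc N * (d * x)
  lower = begin
    (3 + N) * n^ρ * (2 + r * E)               ≤⟨ *-monoˡ-≤ (2 + r * E) (*-mono-≤ 3+N≤ n^ρ≤) ⟩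
    2 * suc N * (κ * x) * (2 + r * E)         ≡⟨ arith₃ N κ x (2 + r * E) ⟩
    suc N * (d * x)                           ∎

-- c is of order n^(r-2), whereas b is at most E + 1 times n^(r-3).
contradiction-touching : ∀ n κ L E c n^j b → suc (κ * (8 * L + suc E)) ≤ n → 1 ≤ n^j →
  n * n^j ≤ κ * c → c ≤ 8 * L + b → b ≤ suc E * n^j → Absurd
contradiction-touching n κ L E c n^j b big 1≤n^j lower c≤ b≤ = <-irrefl refl (begin-strict
  n * n^j                            ≤⟨ lower ⟩
  κ * c                              ≤⟨ *-monoʳ-≤ κ (≤-trans c≤ (+-mono-≤ 8L≤ b≤)) ⟩
  κ * (8 * L * n^j + suc E * n^j)    ≡⟨ arith κ (8 * L) (suc E) n^j ⟩
  κ * (8 * L + suc E) * n^j          <⟨ *-monoˡ-< n^j {{>-nonZero 1≤n^j}} big ⟩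
  n * n^j                            ∎)
  where
  open ≤-Reasoning
  arith : ∀ κ a b y → κ * (a * y + b * y) ≡ κ * (a + b) * y
  arith = solve-∀
  8L≤ : 8 * L ≤ 8 * L * n^j
  8L≤ = ≤-trans (≤-reflexive (sym (*-identityʳ (8 * L)))) (*-monoʳ-≤ (8 * L) 1≤n^j)

-- The first bound on b gives u ≤ t; then b ≤ 2 t^r, which is too small for c. In `doubled` the term
-- 8 L u uses up at most half of the left side, whence the 2 in `t`.
contradiction-avoiding : ∀ n r κ L E t c n^j b u → t ≡ 2 * κ * (r * suc E) → 16 * κ * L ≤ n →
  suc (κ * (8 * L + 2 * t ^ r)) ≤ n → n ≤ n^j → n^j ≤ κ * c → b ≤ suc E * n^j →
  u * c ≤ 8 * L * u + r * b → b ≤ 2 * u ^ r → c ≤ 8 * L + b → Absurd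
contradiction-avoiding n r κ L E t c n^j b u refl big₁ big₂ n≤ lower b≤ bound₁ bound₂ bound₃ = <-irrefl refl (begin-strict
  n                                 ≤⟨ n≤ ⟩
  n^j                               ≤⟨ lower ⟩
  κ * c                             ≤⟨ *-monoʳ-≤ κ (≤-trans bound₃ (+-monoʳ-≤ (8 * L) (≤-trans bound₂ (*-monoʳ-≤ 2 (^-monoˡ-≤ r u≤t))))) ⟩
  κ * (8 * L + 2 * t ^ r)           <⟨ big₂ ⟩
  n                                 ∎)
  where
  open ≤-Reasoning
  arith₁ : ∀ κ L u r e y → 2 * (κ * (8 * L * u + r * (e * y))) ≡ 16 * κ * L * u + 2 * κ * (r * e) * y
  arith₁ = solve-∀
  arith₂ : ∀ κ u c → u * (κ * c) ≡ κ * (u * c)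
  arith₂ = solve-∀
  1≤n^j : 1 ≤ n^j
  1≤n^j = ≤-trans (s≤s z≤n) (≤-trans big₂ n≤)
  doubled : u * n^j + u * n^j ≤ u * n^j + t * n^j
  doubled = begin
    u * n^j + u * n^j                          ≡⟨ cong (u * n^j +_) (sym (+-identityʳ _)) ⟩
    2 * (u * n^j)                              ≤⟨ *-monoʳ-≤ 2 (≤-trans (*-monoʳ-≤ u lower) (≤-reflexive (arith₂ κ u c))) ⟩
    2 * (κ * (u * c))                          ≤⟨ *-monoʳ-≤ 2 (*-monoʳ-≤ κ (≤-trans bound₁ (+-monoʳ-≤ (8 * L * u) (*-monoʳ-≤ r b≤)))) ⟩
    2 * (κ * (8 * L * u + r * (suc E * n^j)))  ≡⟨ arith₁ κ L u r (suc E) n^j ⟩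
    16 * κ * L * u + t * n^j                   ≤⟨ +-monoˡ-≤ (t * n^j) (≤-trans (*-monoˡ-≤ u (≤-trans big₁ n≤)) (≤-reflexive (*-comm n^j u))) ⟩
    u * n^j + t * n^j                          ∎
  u≤t : u ≤ t
  u≤t = *-cancelʳ-≤ u t n^j {{>-nonZero 1≤n^j}} (+-cancelˡ-≤ (u * n^j) _ _ doubled)

module Extremal (ρ L n : ℕ) (F : Subset n → Bool)
  (F-size : ∀ {A} → F A ≡ true → ∣ A ∣ ≡ 4 + ρ)
  (sparse : ∀ J → (∀ {A} → J A ≡ true → F A ≡ true) → degreeSum n (4 + ρ) J ≤ 2 * L * card n (4 + ρ) J)
  (sparse-near-star : ∀ P → ∣ P ∣ ≡ 2 → 1 ≤ card n (4 + ρ) (λ A → F A xor sub P A) →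
    degreeSum n (4 + ρ) F ≤ 2 * L * card n (4 + ρ) (λ A → F A xor sub P A))
  (big : Params.threshold (4 + ρ) L ≤ n) where

  open Params (4 + ρ) L using (E; d; t; E-def; d-def; t-def; threshold-def)
  open Counting (4 + ρ) L (m≤m+n 4 ρ) F F-size sparse

  r j : ℕ
  r = 4 + ρ
  j = 1 + ρ

  private
    x₁ x₂ x₃ x₄ x₅ x₆ : ℕ
    x₁ = 2 * (3 + d + r + r + 2)
    x₂ = 15 + 2 * r * E * κ r
    x₃ = d ^ r
    x₄ = suc (κ r * (8 * L + suc E))
    x₅ = 16 * κ r * L
    x₆ = suc (κ r * (8 * L + 2 * t ^ r))

    big₆₀ : x₁ + x₂ + x₃ + x₄ + x₅ + x₆ ≤ n
    big₆₀ = ≤-trans (≤-reflexive (sym threshold-def)) big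
    big₅₀ : x₁ + x₂ + x₃ + x₄ + x₅ ≤ n
    big₅₀ = ≤-trans (m≤m+n _ x₆) big₆₀
    big₄₀ : x₁ + x₂ + x₃ + x₄ ≤ n
    big₄₀ = ≤-trans (m≤m+n _ x₅) big₅₀
    big₃₀ : x₁ + x₂ + x₃ ≤ n
    big₃₀ = ≤-trans (m≤m+n _ x₄) big₄₀
    big₂₀ : x₁ + x₂ ≤ n
    big₂₀ = ≤-trans (m≤m+n _ x₃) big₃₀
    big₁ : x₁ ≤ n
    big₁ = ≤-trans (m≤m+n _ x₂) big₂₀
    big₂ : x₂ ≤ n
    big₂ = ≤-trans (m≤n+m _ x₁) big₂₀
    big₃ : x₃ ≤ n
    big₃ = ≤-trans (m≤n+m _ (x₁ + x₂)) big₃₀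
    big₄ : x₄ ≤ n
    big₄ = ≤-trans (m≤n+m _ (x₁ + x₂ + x₃)) big₄₀
    big₅ : x₅ ≤ n
    big₅ = ≤-trans (m≤n+m _ (x₁ + x₂ + x₃ + x₄)) big₅₀
    big₆ : x₆ ≤ n
    big₆ = ≤-trans (m≤n+m _ (x₁ + x₂ + x₃ + x₄ + x₅)) big₆₀

    -- One summand of the threshold serves several size conditions; `z` is what a particular use
    -- leaves over.
    room : ∀ y z → 3 + d + r + r + 2 ≡ y + z → 2 * y ≤ n
    room y z e = ≤-trans (*-monoʳ-≤ 2 (≤-trans (m≤m+n y z) (≤-reflexive (sym e)))) big₁

    N w : ℕ
    N = n ∸ 3
    w = n ∸ (3 + d)

    3+d≤n : 3 + d ≤ n
    3+d≤n = ≤-trans (m≤m+n (3 + d) _) (room (3 + d) (r + r + 2) (arith d r))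
      where
      arith : ∀ d r → 3 + d + r + r + 2 ≡ (3 + d) + (r + r + 2)
      arith = solve-∀

    n≡3+N : n ≡ 3 + N
    n≡3+N = sym (m+[n∸m]≡n (≤-trans (m≤m+n 3 d) 3+d≤n))

    N≡d+w : N ≡ d + w
    N≡d+w = sym (trans (cong (d +_) (sym (∸-+-assoc n 3 d))) (m+[n∸m]≡n (m+n≤o⇒m≤o∸n d (subst (_≤ n) (+-comm 3 d) 3+d≤n))))

    1≤n : 1 ≤ n
    1≤n = ≤-trans (s≤s z≤n) big₂

    1≤N : 1 ≤ N
    1≤N = +-cancelˡ-≤ 3 1 N (subst (4 ≤_) n≡3+N (≤-trans (m≤m+n 4 _) big₂))

    5+ρ≤n : 5 + ρ ≤ n
    5+ρ≤n = ≤-trans (m≤m+n (5 + ρ) _) (room (5 + ρ) (8 + d + ρ) (arith d ρ))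
      where
      arith : ∀ d ρ → 3 + d + (4 + ρ) + (4 + ρ) + 2 ≡ (5 + ρ) + (8 + d + ρ)
      arith = solve-∀

    neg≤ : length negligible ≤ E * n ^ j
    neg≤ = *-cancelʳ-≤ _ _ (n ^ 3) {{m^n≢0 n 3 {{>-nonZero 1≤n}}}} (begin
      length negligible * n ^ 3       ≤⟨ length-negligible ⟩
      2 ^ r * c₀ ^ 3 * n ^ r          ≡⟨ cong (_* n ^ r) (trans (cong (λ z → 2 ^ r * (2 ^ r * (z * r)) ^ 3) s₃≡) (sym E-def)) ⟩
      E * n ^ (3 + j)                 ≡⟨ cong (E *_) (trans (^-distribˡ-+-* n 3 j) (*-comm (n ^ 3) (n ^ j))) ⟩
      E * (n ^ j * n ^ 3)             ≡⟨ sym (*-assoc E (n ^ j) (n ^ 3)) ⟩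
      E * n ^ j * n ^ 3               ∎)
      where
      open ≤-Reasoning
      s₃≡ : s₃ ≡ suc r * (suc r * suc (4 * L + 2 * r))
      s₃≡ = trans s₃-def (cong (suc r *_) (trans s₂-def (cong (suc r *_) s-def)))

  module _ (large : (n ∸ 2) C suc j < card n r F) where

    G : ℕ
    G = card n r good

    -- The assumption multiplied by r - 2, with the star rewritten by absorption as a multiple of
    -- C(n-3,r-3).
    upper : suc (suc N * (N C j)) ≤ suc j * G + suc j * length negligible
    upper = begin
      suc (suc N * (N C j))                      ≡⟨ cong suc (sym (C-absorb N j)) ⟩
      suc (suc j * (suc N C suc j))              ≤⟨ s≤s (m≤n+m _ j) ⟩
      suc j + suc j * (suc N C suc j)            ≡⟨ sym (*-suc (suc j) _) ⟩
      suc j * suc (suc N C suc j)                ≡⟨ cong (λ z → suc j * suc (z C suc j)) (sym (cong (_∸ 2) n≡3+N)) ⟩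
      suc j * suc ((n ∸ 2) C suc j)              ≤⟨ *-monoʳ-≤ (suc j) (≤-trans large card-F-≤) ⟩
      suc j * (G + length negligible)            ≡⟨ *-distribˡ-+ (suc j) G _ ⟩
      suc j * G + suc j * length negligible      ∎
      where open ≤-Reasoning

    no-small-territories : (∀ p q → RichPair p q → ∣ territory p q ∣ ≤ 3 + w) → Absurd
    no-small-territories small-territory = [ paired-case , territory-case ]′ (⊔-sel n (2 * (w C j)))
      where
      open ≤-Reasoning
      halved : 2 * (suc j * G) ≤ n * (n ⊔ 2 * (w C j))
      halved = +-cancelʳ-≤ (4 * G) _ _ (begin
        2 * (suc j * G) + 4 * G              ≡⟨ arith ρ G ⟩
        2 * r * G                            ≤⟨ card-good-≤ w j refl small-territory ⟩
        n * (n ⊔ 2 * (w C j)) + 4 * G        ∎)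
        where
        arith : ∀ ρ G → 2 * (suc (1 + ρ) * G) + 4 * G ≡ 2 * (4 + ρ) * G
        arith = solve-∀
      n^j≤ : n ^ j ≤ κ r * (N C j)
      n^j≤ = ^≤κ*C j 3 n (m≤n+m j 3) (room (3 + j) (3 + d + r + 2) (arith d ρ))
        where
        arith : ∀ d ρ → 3 + d + (4 + ρ) + (4 + ρ) + 2 ≡ (3 + (1 + ρ)) + (3 + d + (4 + ρ) + 2)
        arith = solve-∀
      paired-case : n ⊔ 2 * (w C j) ≡ n → Absurd
      paired-case e = contradiction-paired N (suc j) E (κ r) (N C j) (n ^ j) G (length negligible)
        (≤-trans (+-monoʳ-≤ 15 (*-monoˡ-≤ (κ r) (*-monoˡ-≤ E (*-monoʳ-≤ 2 (m≤n+m (suc j) 2))))) (subst (x₂ ≤_) n≡3+N big₂))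
        (n≤C {ρ} (+-cancelˡ-≤ 3 _ _ (subst (3 + suc (suc ρ) ≤_) n≡3+N 5+ρ≤n)))
        n^j≤ neg≤ upper (≤-trans halved (≤-reflexive (trans (cong (n *_) e) (cong₂ _*_ n≡3+N n≡3+N))))
      territory-case : n ⊔ 2 * (w C j) ≡ 2 * (w C j) → Absurd
      territory-case e = contradiction-territory N (suc j) r E (κ r) d (N C j) (w C j) (w C ρ) (n ^ ρ) G (length negligible)
        1≤N (m≤n+m (suc j) 2) d-def
        (subst (λ z → w C j + d * (w C ρ) ≤ z C j) (sym N≡d+w) (C-gain w d ρ))
        (≤-trans (C≤^ w j) (≤-trans (^-monoˡ-≤ j (m∸n≤m n (3 + d))) (≤-reflexive n^j≡)))
        (^≤κ*C ρ (3 + d) n (m≤n+m ρ 4) (room (3 + d + ρ) (10 + ρ) (arith₁ d ρ)))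
        (≤-trans neg≤ (≤-reflexive (cong (E *_) n^j≡)))
        upper (*-cancelˡ-≤ 2 (≤-trans halved (≤-reflexive (trans (cong₂ _*_ n≡3+N e) (arith₂ (3 + N) (w C j))))))
        where
        arith₁ : ∀ d ρ → 3 + d + (4 + ρ) + (4 + ρ) + 2 ≡ (3 + d + ρ) + (10 + ρ)
        arith₁ = solve-∀
        arith₂ : ∀ a b → a * (2 * b) ≡ 2 * (a * b)
        arith₂ = solve-∀
        n^j≡ : n ^ j ≡ (3 + N) * n ^ ρ
        n^j≡ = cong (_* n ^ ρ) n≡3+N

    no-large-territory : ∀ p q → RichPair p q → n ≤ ∣ territory p q ∣ + d → Absurd
    no-large-territory p q R huge = [ touching-case , avoiding-case ]′ NS.dichotomy
      where
      open ≤-Reasoning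
      ∣P∣ : ∣ toSet (q ∷ p ∷ []) ∣ ≡ 2
      ∣P∣ = trans (∣toSet∣-∷ (fresh₁ (λ e → proj₁ R (sym e)))) (cong suc (trans (∣toSet∣-∷ nil∉) (cong suc ∣toSet[]∣)))
      module NS = NearStar j L F F-size p q (proj₁ R) large (sparse-near-star (toSet (q ∷ p ∷ [])) ∣P∣)
      n≤n^j : n ≤ n ^ j
      n≤n^j = ≤-trans (≤-reflexive (sym (*-identityʳ n))) (*-monoʳ-≤ n (m^n>0 n {{>-nonZero 1≤n}} ρ))
      b≤ : NS.b ≤ suc E * n ^ j
      b≤ = begin
        NS.b                          ≤⟨ card-outside-star-≤ p q d R huge ⟩
        length negligible + d ^ r     ≤⟨ +-mono-≤ neg≤ (≤-trans big₃ n≤n^j) ⟩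
        E * n ^ j + n ^ j             ≡⟨ +-comm _ (n ^ j) ⟩
        suc E * n ^ j                 ∎
      touching-case : (n ∸ r ∸ 2) C suc j ≤ 8 * L + NS.b → Absurd
      touching-case h = contradiction-touching n (κ r) L E ((n ∸ r ∸ 2) C suc j) (n ^ j) NS.b big₄ (≤-trans 1≤n n≤n^j)
        (subst (λ z → n ^ suc j ≤ κ r * (z C suc j)) (sym (∸-+-assoc n r 2))
          (^≤κ*C (suc j) (r + 2) n (m≤n+m (suc j) 2) (room (r + 2 + suc j) (5 + d) (arith d ρ))))
        h b≤
        where
        arith : ∀ d ρ → 3 + d + (4 + ρ) + (4 + ρ) + 2 ≡ (4 + ρ + 2 + suc (1 + ρ)) + (5 + d)
        arith = solve-∀
      avoiding-case : ∃[ u ] (u * NS.c₁ ≤ 8 * L * u + r * NS.b × NS.b ≤ 2 * u ^ r × NS.c₁ ≤ 8 * L + NS.b) → Absurd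
      avoiding-case (u , h₁ , h₂ , h₃) = contradiction-avoiding n r (κ r) L E t NS.c₁ (n ^ j) NS.b u t-def big₅ big₆ n≤n^j
        (subst (λ z → n ^ j ≤ κ r * (z C j)) (sym (∸-+-assoc n r 3))
          (^≤κ*C j (r + 3) n (m≤n+m j 3) (room (r + 3 + j) (5 + d) (arith d ρ))))
        b≤ h₁ h₂ h₃
        where
        arith : ∀ d ρ → 3 + d + (4 + ρ) + (4 + ρ) + 2 ≡ (4 + ρ + 3 + (1 + ρ)) + (5 + d)
        arith = solve-∀

    impossible : Absurd
    impossible with anyFin? (λ p → anyFin? (λ q →
      (¬? (p ≟ᶠ q) ×-dec rich? s₂ (toSet (q ∷ p ∷ []))) ×-dec (n ≤? ∣ territory p q ∣ + d)))
    ... | yes (p , q , R , huge) = no-large-territory p q R huge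
    ... | no none = no-small-territories (λ p q R → ≮⇒≥ (λ lt → none (p , q , R , (begin
        n                          ≡⟨ sym (m∸n+n≡m (≤-trans (m≤n+m d 3) 3+d≤n)) ⟩
        n ∸ d + d                  ≡⟨ cong (_+ d) (trans (cong (_∸ d) n≡3+N) (trans (cong (λ z → 3 + z ∸ d) N≡d+w) (arith w))) ⟩
        3 + w + d                  ≤⟨ +-monoˡ-≤ d (<⇒≤ lt) ⟩
        ∣ territory p q ∣ + d      ∎))))
      where
      open ≤-Reasoning
      arith : ∀ w → 3 + (d + w) ∸ d ≡ 3 + w
      arith w = trans (cong (_∸ d) (trans (cong (3 +_) (+-comm d w)) (sym (+-assoc 3 w d)))) (m+n∸n≡m (3 + w) d)

  card-F-≤-star : card n r F ≤ (n ∸ 2) C suc j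
  card-F-≤-star = ≮⇒≥ impossible

-- The union bound

select-⊑ : ∀ {X : Set} (xs : List X) c → select xs c ⊑ xs
select-⊑ []       []          = []
select-⊑ (x ∷ xs) (true ∷ c)  = refl ∷ select-⊑ xs c
select-⊑ (x ∷ xs) (false ∷ c) = x ∷ʳ select-⊑ xs c

indicator : ∀ {X : Set} (p : X → Bool) (xs : List X) → Vec Bool (length xs)
indicator p []       = []
indicator p (x ∷ xs) = p x ∷ indicator p xs

select-indicator : ∀ {X : Set} (p : X → Bool) (xs : List X) → select xs (indicator p xs) ≡ filterᵇ p xs
select-indicator p []       = refl
select-indicator p (x ∷ xs) with p x
... | true  = cong (x ∷_) (select-indicator p xs)
... | false = select-indicator p xs

-- Each edge satisfying q halves the number of realisations that keep none of them.
count-avoiding : ∀ {X : Set} (q : X → Bool) (es : List X) →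
  ∑ (allSubsets (length es)) (λ c → ⟦ all (λ e → not (q e)) (select es c) ⟧) * 2 ^ ∑ es (λ e → ⟦ q e ⟧) ≡ 2 ^ length es
count-avoiding q []       = refl
count-avoiding q (x ∷ es)
  rewrite ∑-allSubsets (length es) (λ c → ⟦ all (λ e → not (q e)) (select (x ∷ es) c) ⟧) with q x
... | true  = trans (cong (λ z → (z + S) * (2 * 2 ^ R)) (n≤0⇒n≡0 (∑-zero (allSubsets (length es)) (λ _ → z≤n))))
    (trans (arith S (2 ^ R)) (cong (2 *_) (count-avoiding q es)))
  where
  S = ∑ (allSubsets (length es)) (λ c → ⟦ all (λ e → not (q e)) (select es c) ⟧)
  R = ∑ es (λ e → ⟦ q e ⟧)
  arith : ∀ S x → S * (2 * x) ≡ 2 * (S * x)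
  arith = solve-∀
... | false = trans (arith S (2 ^ R)) (cong (2 *_) (count-avoiding q es))
  where
  S = ∑ (allSubsets (length es)) (λ c → ⟦ all (λ e → not (q e)) (select es c) ⟧)
  R = ∑ es (λ e → ⟦ q e ⟧)
  arith : ∀ S x → (S + S) * x ≡ 2 * (S * x)
  arith = solve-∀

pairs-∈ : ∀ {X : Set} (xs : List X) {x y} → (x , y) ∈ pairs xs → x ∈ xs × y ∈ xs
pairs-∈ (z ∷ xs) e∈ with ∈-++⁻ (map (z ,_) xs) e∈
... | inj₂ h = let a , b = pairs-∈ xs h in there a , there b
... | inj₁ h with ∈-map⁻ (z ,_) h
...   | _ , y∈ , refl = here refl , there y∈

∑-pairs : ∀ {X : Set} (xs : List X) (f : X → X → ℕ) → (∀ x y → f x y ≡ f y x) → (∀ {x} → x ∈ xs → f x x ≡ 0) →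
  ∑ xs (λ x → ∑ xs (f x)) ≡ 2 * ∑ (pairs xs) (λ { (x , y) → f x y })
∑-pairs []       f sy dg = refl
∑-pairs (z ∷ xs) f sy dg = begin
  (f z z + ∑ xs (f z)) + ∑ xs (λ x → f x z + ∑ xs (f x))
    ≡⟨ cong₂ _+_ (cong (_+ ∑ xs (f z)) (dg (here refl))) (∑-+ xs _ _) ⟩
  ∑ xs (f z) + (∑ xs (λ x → f x z) + ∑ xs (λ x → ∑ xs (f x)))
    ≡⟨ cong₂ (λ a b → ∑ xs (f z) + (a + b)) (∑-cong xs (λ {x} _ → sy x z)) (∑-pairs xs f sy (dg ∘ there)) ⟩
  ∑ xs (f z) + (∑ xs (f z) + 2 * Q)
    ≡⟨ arith (∑ xs (f z)) Q ⟩
  2 * (∑ xs (f z) + Q)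
    ≡⟨ cong (2 *_) (trans (cong (_+ Q) (sym (∑-map (z ,_) xs g))) (sym (∑-++ (map (z ,_) xs) (pairs xs) g))) ⟩
  2 * ∑ (pairs (z ∷ xs)) g ∎
  where
  open ≡-Reasoning
  g : _ → ℕ
  g (x , y) = f x y
  Q = ∑ (pairs xs) g
  arith : ∀ a q → a + (a + 2 * q) ≡ 2 * (a + q)
  arith = solve-∀

-- A crude enumeration of families of j sets as ordered tuples with repetition, so that their number
-- is at most N^j.
words : ∀ {X : Set} → List X → ℕ → List (List X)
words xs zero    = [] ∷ []
words xs (suc j) = concatMap (λ t → map (_∷ t) xs) (words xs j)

length-words : ∀ {X : Set} (xs : List X) j → length (words xs j) ≤ length xs ^ j
length-words xs zero    = ≤-refl
length-words xs (suc j) = ≤-trans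
  (length-concatMap-≤ (λ t → map (_∷ t) xs) (words xs j) (length xs) (λ {t} _ → ≤-reflexive (length-map (_∷ t) xs)))
  (≤-trans (*-monoˡ-≤ (length xs) (length-words xs j)) (≤-reflexive (*-comm (length xs ^ j) (length xs))))

∈-words : ∀ {X : Set} {xs : List X} (t : List X) → (∀ {x} → x ∈ t → x ∈ xs) → t ∈ words xs (length t)
∈-words []      h = here refl
∈-words {xs = xs} (x ∷ t) h = ∈-concatMap (λ t → map (_∷ t) xs) (∈-words t (h ∘ there)) (∈-map⁺ (_∷ t) (h (here refl)))

range : ℕ → List ℕ
range zero    = []
range (suc N) = suc N ∷ range N

∈-range : ∀ {j N} → 1 ≤ j → j ≤ N → j ∈ range N
∈-range {j} {zero}  1≤j j≤0 = contradiction (≤-trans 1≤j j≤0) λ ()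
∈-range {j} {suc N} 1≤j j≤N with m≤n⇒m<n∨m≡n j≤N
... | inj₁ (s≤s lt) = there (∈-range 1≤j lt)
... | inj₂ refl     = here refl

range-∈ : ∀ {j} N → j ∈ range N → 1 ≤ j
range-∈ (suc N) (here refl) = s≤s z≤n
range-∈ (suc N) (there h)   = range-∈ N h

length-range : ∀ N → length (range N) ≡ N
length-range zero    = refl
length-range (suc N) = cong suc (length-range N)

-- Each size j gets a share E / N of the total. One factor N in N * N pays for the number of sizes;
-- the other, together with 2^L beating N for each further unit of j, pays for N^j.
union-bound : ∀ k B N L E (X : ℕ → ℕ) → suc k * suc B * (N * N) ≤ 2 ^ L →
  (∀ {j} → j ∈ range N → X j * 2 ^ (L * j) ≤ suc B * N ^ j * E) → suc k * ∑ (range N) X ≤ E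
union-bound k B zero    L E X big h = ≤-trans (≤-reflexive (*-zeroʳ (suc k))) z≤n
union-bound k B (suc N) L E X big h = *-cancelˡ-≤ (suc N) (begin
  suc N * (suc k * ∑ (range (suc N)) X)           ≡⟨ sym (*-assoc (suc N) (suc k) _) ⟩
  suc N * suc k * ∑ (range (suc N)) X             ≡⟨ sym (∑-*ˡ (range (suc N)) (suc N * suc k) X) ⟩
  ∑ (range (suc N)) (λ j → suc N * suc k * X j)   ≤⟨ ∑-≤-const (range (suc N)) E each ⟩
  length (range (suc N)) * E                      ≡⟨ cong (_* E) (length-range (suc N)) ⟩
  suc N * E                                       ∎)
  where
  open ≤-Reasoning
  Y : ℕ
  Y = suc k * suc B * (suc N * suc N)
  sN≤Y : suc N ≤ Y
  sN≤Y = ≤-trans (m≤m*n (suc N) (suc N)) (m≤n*m (suc N * suc N) (suc k * suc B))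
  arith₁ : ∀ n k b x → n * k * (b * (n * x)) ≡ k * b * (n * n) * x
  arith₁ = solve-∀
  arith₂ : ∀ a x y → a * x * y ≡ a * (x * y)
  arith₂ = solve-∀
  growth : ∀ i → suc N * suc k * (suc B * suc N ^ suc i) ≤ 2 ^ (L * suc i)
  growth i = begin
    suc N * suc k * (suc B * suc N ^ suc i) ≡⟨ arith₁ (suc N) (suc k) (suc B) (suc N ^ i) ⟩
    Y * suc N ^ i                           ≤⟨ *-monoʳ-≤ Y (^-monoˡ-≤ i sN≤Y) ⟩
    Y ^ suc i                               ≤⟨ ^-monoˡ-≤ (suc i) big ⟩
    (2 ^ L) ^ suc i                         ≡⟨ ^-*-assoc 2 L (suc i) ⟩
    2 ^ (L * suc i)                         ∎
  growth′ : ∀ j → 1 ≤ j → suc N * suc k * (suc B * suc N ^ j) ≤ 2 ^ (L * j)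
  growth′ (suc i) _ = growth i
  each : ∀ {j} → j ∈ range (suc N) → suc N * suc k * X j ≤ E
  each {j} j∈ = *-cancelʳ-≤ _ _ (2 ^ (L * j)) {{m^n≢0 2 (L * j)}} (begin
    suc N * suc k * X j * 2 ^ (L * j)               ≡⟨ arith₂ (suc N * suc k) (X j) _ ⟩
    suc N * suc k * (X j * 2 ^ (L * j))             ≤⟨ *-monoʳ-≤ (suc N * suc k) (h j∈) ⟩
    suc N * suc k * (suc B * suc N ^ j * E)         ≡⟨ sym (arith₂ (suc N * suc k) (suc B * suc N ^ j) E) ⟩
    suc N * suc k * (suc B * suc N ^ j) * E         ≤⟨ *-monoˡ-≤ E (growth′ j (range-∈ (suc N) j∈)) ⟩
    2 ^ (L * j) * E                                 ≡⟨ *-comm (2 ^ (L * j)) E ⟩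
    E * 2 ^ (L * j)                                 ∎)

xor-cancel : ∀ x y → x xor (x xor y) ≡ y
xor-cancel true  true  = refl
xor-cancel true  false = refl
xor-cancel false y     = refl

all-cong : ∀ {X : Set} {p q : X → Bool} (xs : List X) → (∀ {x} → x ∈ xs → p x ≡ q x) → all p xs ≡ all q xs
all-cong []       h = refl
all-cong (x ∷ xs) h = cong₂ _∧_ (h (here refl)) (all-cong xs (h ∘ there))

foldr-⊔-member : ∀ {X : Set} (f : X → ℕ) {xs x} → x ∈ xs → f x ≤ foldr _⊔_ 0 (map f xs)
foldr-⊔-member f (here refl) = m≤m⊔n _ _
foldr-⊔-member f {y ∷ xs} (there x∈) = ≤-trans (foldr-⊔-member f x∈) (m≤n⊔m (f y) _)

foldr-⊔-≤ : ∀ {X : Set} (f : X → ℕ) xs m → (∀ x → f x ≤ m) → foldr _⊔_ 0 (map f xs) ≤ m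
foldr-⊔-≤ f []       m h = z≤n
foldr-⊔-≤ f (x ∷ xs) m h = ⊔-lub (h x) (foldr-⊔-≤ f xs m h)

not-∧ : ∀ a b → (a ≡ true → b ≡ true → Absurd) → not (a ∧ b) ≡ true
not-∧ true  true  h = absurd (h refl refl)
not-∧ true  false h = refl
not-∧ false b     h = refl

if-≤ : ∀ b {x m} → (b ≡ true → x ≤ m) → (if b then x else 0) ≤ m
if-≤ true  h = h refl
if-≤ false h = z≤n

if-true : ∀ {b} {x y : ℕ} → b ≡ true → (if b then x else y) ≡ x
if-true refl = refl

not-true⇒false : ∀ b → (b ≡ true → Absurd) → b ≡ false
not-true⇒false true  h = absurd (h refl)
not-true⇒false false h = refl

≡-by-truth : ∀ a b → (a ≡ true → b ≡ true) → (b ≡ true → a ≡ true) → a ≡ b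
≡-by-truth true  b     f g = sym (f refl)
≡-by-truth false true  f g = g refl
≡-by-truth false false f g = refl

-- Sparseness of the independent sets of a random subgraph

module RandomSubgraph (ρ n L : ℕ) where

  r : ℕ
  r = 4 + ρ

  V : List (Subset n)
  V = vertices n r

  es : List (Subset n × Subset n)
  es = edges n r 1

  M : ℕ
  M = (n ∸ 2) C (2 + ρ)

  inside : (Subset n → Bool) → Subset n × Subset n → Bool
  inside J (A , B) = J A ∧ J B

  edgesIn : (Subset n → Bool) → ℕ
  edgesIn J = ∑ es (λ e → ⟦ inside J e ⟧)

  quiet : (Subset n → Bool) → Vec Bool (length es) → Bool
  quiet J c = all (λ e → not (inside J e)) (select es c)

  edge⁻ : ∀ {A B} → (A , B) ∈ es → A ∈ V × B ∈ V × adj A B ≡ true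
  edge⁻ e∈ =
    let e∈′ , a = filterᵇ-∈⁻ _ (pairs V) e∈
        A∈ , B∈ = pairs-∈ V e∈′
    in A∈ , B∈ , a

  degreeSum-≤ : ∀ J → degreeSum n r J ≤ 2 * edgesIn J
  degreeSum-≤ J = ≤-reflexive (begin
    degreeSum n r J
      ≡⟨ ∑-cong V (λ {A} _ → sym (∑-*ˡ V ⟦ J A ⟧ _)) ⟩
    ∑ V (λ A → ∑ V (f A))
      ≡⟨ ∑-pairs V f f-sym f-diag ⟩
    2 * ∑ (pairs V) (λ { (A , B) → f A B })
      ≡⟨ cong (2 *_) (∑-cong (pairs V) (λ { {A , B} _ → arith (J A) (J B) (adj A B) })) ⟩
    2 * ∑ (pairs V) (λ e → ⟦ adj (proj₁ e) (proj₂ e) ⟧ * ⟦ inside J e ⟧)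
      ≡⟨ cong (2 *_) (sym (trans (∑-filterᵇ _ (pairs V) (λ e → ⟦ inside J e ⟧)) (∑-cong (pairs V) (λ { {A , B} _ → refl })))) ⟩
    2 * edgesIn J ∎)
    where
    open ≡-Reasoning
    f : Subset n → Subset n → ℕ
    f A B = ⟦ J A ⟧ * (⟦ J B ⟧ * ⟦ adj A B ⟧)
    f-sym : ∀ A B → f A B ≡ f B A
    f-sym A B rewrite ∩-comm A B = swap ⟦ J A ⟧ ⟦ J B ⟧ _
      where
      swap : ∀ x y z → x * (y * z) ≡ y * (x * z)
      swap = solve-∀
    f-diag : ∀ {A} → A ∈ V → f A A ≡ 0
    f-diag {A} A∈ rewrite ∩-idem A | ∈-vertices⁻ A∈ = trans (cong (⟦ J A ⟧ *_) (*-zeroʳ ⟦ J A ⟧)) (*-zeroʳ ⟦ J A ⟧)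
    arith : ∀ x y z → ⟦ x ⟧ * (⟦ y ⟧ * ⟦ z ⟧) ≡ ⟦ z ⟧ * ⟦ x ∧ y ⟧
    arith true  true  true  = refl
    arith true  true  false = refl
    arith true  false true  = refl
    arith true  false false = refl
    arith false y     z     = sym (*-zeroʳ ⟦ z ⟧)

  -- The independent sets to exclude are the small families and the small modifications of stars.
  bases : List (Subset n → Bool)
  bases = (λ _ → false) ∷ map sub (vertices n 2)

  -- A family is encoded by its difference S from a base, so the union bound is governed by the size
  -- of the difference and not of the family.
  family : (Subset n → Bool) → List (Subset n) → Subset n → Bool
  family base S A = base A xor memb A S

  event : (Subset n → Bool) → List (Subset n) → ℕ → Vec Bool (length es) → Bool
  event base S j c = does (L * j ≤? edgesIn (family base S)) ∧ quiet (family base S) c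

  -- If the family spans at least L j edges, all of them must be deleted, which has probability at
  -- most 2^(-L j); otherwise the event is empty.
  event-count : ∀ base S j → ∑ (allSubsets (length es)) (λ c → ⟦ event base S j c ⟧) * 2 ^ (L * j) ≤ 2 ^ length es
  event-count base S j = go (L * j ≤? edgesIn J)
    where
    open ≤-Reasoning
    J : Subset n → Bool
    J = family base S
    go : (d : Dec (L * j ≤ edgesIn J)) →
      ∑ (allSubsets (length es)) (λ c → ⟦ does d ∧ quiet J c ⟧) * 2 ^ (L * j) ≤ 2 ^ length es
    go (no _)   = ≤-trans (*-monoˡ-≤ (2 ^ (L * j)) (∑-zero (allSubsets (length es)) (λ _ → z≤n))) z≤n
    go (yes le) = begin
      ∑ (allSubsets (length es)) (λ c → ⟦ quiet J c ⟧) * 2 ^ (L * j)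
        ≤⟨ *-monoʳ-≤ (∑ (allSubsets (length es)) (λ c → ⟦ quiet J c ⟧)) (^-monoʳ-≤ 2 le) ⟩
      ∑ (allSubsets (length es)) (λ c → ⟦ quiet J c ⟧) * 2 ^ edgesIn J
        ≡⟨ count-avoiding (inside J) es ⟩
      2 ^ length es ∎

  events : ℕ → Vec Bool (length es) → ℕ
  events j c = ∑ bases (λ base → ∑ (words V j) (λ S → ⟦ event base S j c ⟧))

  events-count : ∀ j → ∑ (allSubsets (length es)) (events j) * 2 ^ (L * j) ≤
    suc (length (vertices n 2)) * length V ^ j * 2 ^ length es
  events-count j = begin
    ∑ Ω (events j) * p
      ≡⟨ cong (_* p) (trans (∑-swap Ω bases _) (∑-cong bases (λ _ → ∑-swap Ω (words V j) _))) ⟩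
    ∑ bases (λ base → ∑ (words V j) (λ S → ∑ Ω (λ c → ⟦ event base S j c ⟧))) * p
      ≡⟨ trans (sym (∑-*ʳ bases p (λ base → ∑ (words V j) (count base))))
           (∑-cong bases (λ {base} _ → sym (∑-*ʳ (words V j) p (count base)))) ⟩
    ∑ bases (λ base → ∑ (words V j) (λ S → ∑ Ω (λ c → ⟦ event base S j c ⟧) * p))
      ≤⟨ ∑-≤-const bases (length V ^ j * 2 ^ length es) (λ {base} _ → ≤-trans
           (∑-≤-const (words V j) (2 ^ length es) (λ {S} _ → event-count base S j))
           (*-monoˡ-≤ (2 ^ length es) (length-words V j))) ⟩
    length bases * (length V ^ j * 2 ^ length es)
      ≡⟨ cong (λ z → suc z * (length V ^ j * 2 ^ length es)) (length-map sub (vertices n 2)) ⟩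
    suc (length (vertices n 2)) * (length V ^ j * 2 ^ length es)
      ≡⟨ sym (*-assoc (suc (length (vertices n 2))) (length V ^ j) (2 ^ length es)) ⟩
    suc (length (vertices n 2)) * length V ^ j * 2 ^ length es ∎
    where
    open ≤-Reasoning
    Ω : List (Vec Bool (length es))
    Ω = allSubsets (length es)
    count : (Subset n → Bool) → List (Subset n) → ℕ
    count base S = ∑ Ω (λ c → ⟦ event base S j c ⟧)
    p = 2 ^ (L * j)

  total : Vec Bool (length es) → ℕ
  total c = ∑ (range (length V)) (λ j → events j c)

  module _ (c : Vec Bool (length es)) (no-events : total c ≡ 0) where

    kept : List (Subset n × Subset n)
    kept = select es c

    kept-∈ : ∀ {e} → e ∈ kept → e ∈ es
    kept-∈ = ⊑-∈ (select-⊑ es c)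

    no-event : ∀ {base S} → base ∈ bases → (∀ {A} → A ∈ S → A ∈ V) → 1 ≤ length S → length S ≤ length V →
      event base S (length S) c ≡ false
    no-event {base} {S} base∈ S⊆V 1≤ ≤N = not-true⇒false (event base S (length S) c) (λ e → contradiction (begin
      1                                                          ≤⟨ ⟦⟧-true e ⟩
      ⟦ event base S (length S) c ⟧                              ≤⟨ ∑-member (λ S′ → ⟦ event base S′ (length S) c ⟧) (∈-words S S⊆V) ⟩
      ∑ (words V (length S)) (λ S′ → ⟦ event base S′ (length S) c ⟧)
        ≤⟨ ∑-member (λ b → ∑ (words V (length S)) (λ S′ → ⟦ event b S′ (length S) c ⟧)) base∈ ⟩
      events (length S) c                                        ≤⟨ ∑-member (λ j → events j c) (∈-range 1≤ ≤N) ⟩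
      total c                                                    ≡⟨ no-events ⟩
      0                                                          ∎) λ ())
      where open ≤-Reasoning

    -- Let S list the r-sets on which base and J differ; then `family base S` agrees with J on all
    -- r-sets. Since J is quiet and the event for S does not occur, J spans few edges. S must be
    -- nonempty because the events start at size 1.
    sparse-relative : ∀ base J → base ∈ bases → quiet J c ≡ true → 1 ≤ card n r (λ A → base A xor J A) →
      degreeSum n r J ≤ 2 * L * card n r (λ A → base A xor J A)
    sparse-relative base J base∈ q 1≤ = begin
      degreeSum n r J                             ≤⟨ degreeSum-≤ J ⟩
      2 * edgesIn J                               ≡⟨ cong (2 *_) (sym edgesIn≡) ⟩
      2 * edgesIn (family base S)                 ≤⟨ *-monoʳ-≤ 2 few ⟩
      2 * (L * length S)                          ≡⟨ sym (*-assoc 2 L _) ⟩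
      2 * L * length S                            ≡⟨ cong (2 * L *_) ∣S∣ ⟩
      2 * L * card n r (λ A → base A xor J A)     ∎
      where
      open ≤-Reasoning
      S : List (Subset n)
      S = filterᵇ (λ A → base A xor J A) V
      ∣S∣ : length S ≡ card n r (λ A → base A xor J A)
      ∣S∣ = length-filterᵇ _ V
      memb-S : ∀ {A} → A ∈ V → memb A S ≡ base A xor J A
      memb-S {A} A∈ = ≡-by-truth (memb A S) (base A xor J A)
        (λ e → proj₂ (filterᵇ-∈⁻ (λ A → base A xor J A) V (memb⇒∈ A S e)))
        (λ e → ∈⇒memb (filterᵇ-∈⁺ (λ A → base A xor J A) A∈ e))
      family≡ : ∀ {A} → A ∈ V → family base S A ≡ J A
      family≡ {A} A∈ = trans (cong (base A xor_) (memb-S A∈)) (xor-cancel (base A) (J A))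
      inside≡ : ∀ {e} → e ∈ es → inside (family base S) e ≡ inside J e
      inside≡ {A , B} e∈ = let A∈ , B∈ , _ = edge⁻ e∈ in cong₂ _∧_ (family≡ A∈) (family≡ B∈)
      edgesIn≡ : edgesIn (family base S) ≡ edgesIn J
      edgesIn≡ = ∑-cong es (λ e∈ → cong ⟦_⟧ (inside≡ e∈))
      quiet≡ : quiet (family base S) c ≡ true
      quiet≡ = trans (all-cong kept (λ e∈ → cong not (inside≡ (kept-∈ e∈)))) q
      ∣S∣≤ : length S ≤ length V
      ∣S∣≤ = begin
        length S                                ≡⟨ ∣S∣ ⟩
        card n r (λ A → base A xor J A)         ≤⟨ ∑-mono V (λ {A} _ → ⟦⟧≤1 (base A xor J A)) ⟩
        ∑ V (λ _ → 1)                           ≡⟨ sym (length≡∑1 V) ⟩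
        length V                                ∎
      few : edgesIn (family base S) ≤ L * length S
      few = ≮⇒≥ (λ lt → contradiction
        (trans (sym (∧-true⁺ (does-true (L * length S ≤? edgesIn (family base S)) (<⇒≤ lt)) quiet≡))
          (no-event {base} {S} base∈ (λ A∈ → proj₁ (filterᵇ-∈⁻ _ V A∈)) (subst (1 ≤_) (sym ∣S∣) 1≤) ∣S∣≤)) λ ())

    module _ (big : Params.threshold (4 + ρ) L ≤ n) where

      independent-≤ : ∀ x → isIndependent kept (select V x) ≡ true → length (select V x) ≤ M
      independent-≤ x ind = begin
        length (select V x)               ≡⟨ length≡∑1 (select V x) ⟩
        ∑ (select V x) (λ _ → 1)          ≤⟨ ∑-sublist F (λ _ → 1) (select-⊑ V x) (λ {A} A∈ → ∈⇒memb {A = A} A∈) ⟩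
        ∑ V (λ A → ⟦ F A ⟧ * 1)           ≡⟨ ∑-cong V (λ _ → *-identityʳ _) ⟩
        card n r F                        ≤⟨ Extremal.card-F-≤-star ρ L n F (λ {A} → F-size {A}) sparse near big ⟩
        M                                 ∎
        where
        open ≤-Reasoning
        F : Subset n → Bool
        F A = memb A (select V x)
        F-size : ∀ {A} → F A ≡ true → ∣ A ∣ ≡ r
        F-size {A} e = ∈-vertices⁻ {A = A} (⊑-∈ (select-⊑ V x) (memb⇒∈ A (select V x) e))
        quiet-⊆ : ∀ J → (∀ {A} → J A ≡ true → F A ≡ true) → quiet J c ≡ true
        quiet-⊆ J J⊆F = all-true⁺ _ kept (λ { {A , B} e∈ → not-∧ (J A) (J B) (λ JA JB →
          contradiction (trans (sym (all-true⁻ _ kept ind e∈)) (cong not (∧-true⁺ (J⊆F JA) (J⊆F JB)))) λ ()) })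
        sparse : ∀ J → (∀ {A} → J A ≡ true → F A ≡ true) → degreeSum n r J ≤ 2 * L * card n r J
        -- An empty J lies outside the range of the events and is treated directly.
        sparse J J⊆F = go (card n r J ≤? 0)
          where
          go : Dec (card n r J ≤ 0) → degreeSum n r J ≤ 2 * L * card n r J
          go (no ¬0) = sparse-relative (λ _ → false) J (here refl) (quiet-⊆ J J⊆F) (≰⇒> ¬0)
          go (yes 0≥) = ≤-trans (∑-zero V (λ {A} A∈ → *-monoˡ-≤ _ (≤-trans (∑-member (λ A → ⟦ J A ⟧) A∈) 0≥))) z≤n
        near : ∀ P → ∣ P ∣ ≡ 2 → 1 ≤ card n r (λ A → F A xor sub P A) →
          degreeSum n r F ≤ 2 * L * card n r (λ A → F A xor sub P A)
        near P ∣P∣ 1≤ = subst (λ z → degreeSum n r F ≤ 2 * L * z) flip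
          (sparse-relative (sub P) F (there (∈-map⁺ sub {P} (∈-vertices⁺ {A = P} ∣P∣))) (quiet-⊆ F id) (subst (1 ≤_) (sym flip) 1≤))
          where
          flip : card n r (λ A → sub P A xor F A) ≡ card n r (λ A → F A xor sub P A)
          flip = ∑-cong V (λ {A} _ → cong ⟦_⟧ (xor-comm (sub P A) (F A)))

      α-upper : αReal n r 1 c ≤ M
      α-upper = foldr-⊔-≤ _ (allSubsets (length V)) M go
        where
        go : ∀ x → (if isIndependent kept (select V x) then length (select V x) else 0) ≤ M
        go x = if-≤ (isIndependent kept (select V x)) (independent-≤ x)

  -- Two members of a star share at least two vertices, so no edge of G(n,r,1) joins them, whichever
  -- edges are kept.
  α-lower : ∀ c → (P : Subset n) → ∣ P ∣ ≡ 2 → M ≤ αReal n r 1 c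
  α-lower c P ∣P∣ = ≤-trans (≤-reflexive (sym value))
    (foldr-⊔-member (λ x → if isIndependent (select es c) (select V x) then length (select V x) else 0)
      (∈-allSubsets (indicator (sub P) V)))
    where
    I : List (Subset n)
    I = filterᵇ (sub P) V
    independent : isIndependent (select es c) I ≡ true
    independent = all-true⁺ _ (select es c) (λ { {A , B} e∈ → not-∧ (memb A I) (memb B I) (λ A∈ B∈ →
      contradiction (subst₂ _≤_ ∣P∣ (≡ᵇ-true ∣ A ∩ B ∣ 1 (proj₂ (proj₂ (edge⁻ (⊑-∈ (select-⊑ es c) e∈)))))
        (p⊆q⇒∣p∣≤∣q∣ {p = P} {A ∩ B} (λ v∈ → x∈p∩q⁺ (star⁻ A A∈ v∈ , star⁻ B B∈ v∈)))) λ { (s≤s ()) }) })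
      where
      star⁻ : ∀ A → memb A I ≡ true → P ⊆ A
      star⁻ A e = sub⇒⊆ P A (proj₂ (filterᵇ-∈⁻ (sub P) V (memb⇒∈ A I e)))
    value : (if isIndependent (select es c) (select V (indicator (sub P) V)) then length (select V (indicator (sub P) V)) else 0) ≡ M
    value = trans (cong (λ I → if isIndependent (select es c) I then length I else 0) (select-indicator (sub P) V))
      (trans (if-true independent) (trans (length-filterᵇ (sub P) V) (card-star r (2 + ρ) P ∣P∣ refl)))

  badCount-≤ : ∀ k (P : Subset n) → ∣ P ∣ ≡ 2 → Params.threshold (4 + ρ) L ≤ n →
    suc k * suc (length (vertices n 2)) * (length V * length V) ≤ 2 ^ L → suc k * badCount n r ≤ 2 ^ edgeCount n r
  badCount-≤ k P ∣P∣ big small = ≤-trans (*-monoʳ-≤ (suc k) (begin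
    badCount n r
      ≡⟨ length-filterᵇ _ (allSubsets (length es)) ⟩
    ∑ (allSubsets (length es)) (λ c → ⟦ not (αReal n r 1 c ≡ᵇ M) ⟧)
      ≤⟨ ∑-mono (allSubsets (length es)) (λ {c} _ → ⟦⟧-≤ (λ e → bad⇒event c e)) ⟩
    ∑ (allSubsets (length es)) total
      ≡⟨ ∑-swap (allSubsets (length es)) (range (length V)) _ ⟩
    ∑ (range (length V)) (λ j → ∑ (allSubsets (length es)) (events j)) ∎))
    (union-bound k (length (vertices n 2)) (length V) L (2 ^ length es) _ small (λ {j} _ → events-count j))
    where
    open ≤-Reasoning
    bad⇒event : ∀ c → not (αReal n r 1 c ≡ᵇ M) ≡ true → 1 ≤ total c
    bad⇒event c e = ≮⇒≥ (λ lt → contradiction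
      (trans (sym e) (cong not (trans (cong (_≡ᵇ M)
        (≤-antisym (α-upper c (n≤0⇒n≡0 (≤-pred lt)) big) (α-lower c P ∣P∣))) (≡ᵇ-refl M)))) λ ())

-- Asymptotics

length-vertices-≤ : ∀ n r → length (vertices n r) ≤ n ^ r
length-vertices-≤ n r = begin
  length (vertices n r)                                  ≡⟨ length≡∑1 (vertices n r) ⟩
  ∑ (vertices n r) (λ _ → 1)
    ≤⟨ ∑-mono (vertices n r) (λ {A} _ → ⟦⟧-true (∧-true⁺ (⊆⇒sub ⊥ A (λ v∈ → contradiction v∈ ∉⊥)) (⊆⇒sub A ⊤ (λ _ → ∈⊤)))) ⟩
  ∑ (vertices n r) (λ A → ⟦ sub ⊥ A ∧ sub A ⊤ ⟧)
    ≡⟨ count-interval {n} {r} ⊥ ⊤ n r (λ v∈ → contradiction v∈ ∉⊥)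
         (trans (∣⊤∣≡n n) (cong (_+ n) (sym (∣⊥∣≡0 n)))) (cong (_+ r) (sym (∣⊥∣≡0 n))) ⟩
  n C r                                                  ≤⟨ C≤^ n r ⟩
  n ^ r                                                  ∎
  where open ≤-Reasoning

∃-pair : ∀ {n} → 2 ≤ n → ∃[ P ] ∣_∣ {n} P ≡ 2
∃-pair {suc zero}    (s≤s ())
∃-pair {suc (suc n)} _ = true ∷ true ∷ ⊥ , cong (2 +_) (∣⊥∣≡0 n)

-- Polynomial growth. The argument is `suc x` so that powers increase with the exponent.
record Bounded (f : ℕ → ℕ) : Set where
  constructor bounded
  field
    coefficient exponent : ℕ
    bound : ∀ x → f (suc x) ≤ coefficient * suc x ^ exponent

bounded-≡ : ∀ {f g} → (∀ x → f x ≡ g x) → Bounded g → Bounded f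
bounded-≡ eq (bounded c e h) = bounded c e λ x → ≤-trans (≤-reflexive (eq (suc x))) (h x)

bounded-const : ∀ c → Bounded (λ _ → c)
bounded-const c = bounded c 0 λ x → ≤-reflexive (sym (*-identityʳ c))

bounded-id : Bounded (λ x → x)
bounded-id = bounded 1 1 λ x → ≤-reflexive (sym (trans (+-identityʳ _) (*-identityʳ (suc x))))

bounded-+ : ∀ {f g} → Bounded f → Bounded g → Bounded (λ x → f x + g x)
bounded-+ {f} {g} (bounded c e h) (bounded c′ e′ h′) = bounded (c + c′) (e + e′) λ x → begin
  f (suc x) + g (suc x)                                  ≤⟨ +-mono-≤ (h x) (h′ x) ⟩
  c * suc x ^ e + c′ * suc x ^ e′
    ≤⟨ +-mono-≤ (*-monoʳ-≤ c (^-monoʳ-≤ (suc x) (m≤m+n e e′))) (*-monoʳ-≤ c′ (^-monoʳ-≤ (suc x) (m≤n+m e′ e))) ⟩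
  c * suc x ^ (e + e′) + c′ * suc x ^ (e + e′)           ≡⟨ sym (*-distribʳ-+ (suc x ^ (e + e′)) c c′) ⟩
  (c + c′) * suc x ^ (e + e′)                            ∎
  where open ≤-Reasoning

bounded-* : ∀ {f g} → Bounded f → Bounded g → Bounded (λ x → f x * g x)
bounded-* {f} {g} (bounded c e h) (bounded c′ e′ h′) = bounded (c * c′) (e + e′) λ x → begin
  f (suc x) * g (suc x)                  ≤⟨ *-mono-≤ (h x) (h′ x) ⟩
  c * suc x ^ e * (c′ * suc x ^ e′)      ≡⟨ arith c (suc x ^ e) c′ (suc x ^ e′) ⟩
  c * c′ * (suc x ^ e * suc x ^ e′)      ≡⟨ cong (c * c′ *_) (sym (^-distribˡ-+-* (suc x) e e′)) ⟩
  c * c′ * suc x ^ (e + e′)              ∎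
  where
  open ≤-Reasoning
  arith : ∀ c x d y → c * x * (d * y) ≡ c * d * (x * y)
  arith = solve-∀

bounded-^ : ∀ {f} k → Bounded f → Bounded (λ x → f x ^ k)
bounded-^ zero    b = bounded 1 0 λ x → ≤-refl
bounded-^ (suc k) b = bounded-* b (bounded-^ k b)

-- Through a binomial coefficient, (x+1)^(e+1) is at most (e+1)! 2^(x+e+2); the additional factor x
-- + 1 absorbs the constants.
^≤2^ : ∀ c e x → c * (suc e ! * 2 ^ (e + 2)) ≤ suc x → c * suc x ^ e ≤ 2 ^ x
^≤2^ c e x le = *-cancelˡ-≤ (suc x) (begin
  suc x * (c * suc x ^ e)                                ≡⟨ arith₁ (suc x) c (suc x ^ e) ⟩
  c * suc x ^ suc e                                      ≤⟨ *-monoʳ-≤ c (^≤!*C (suc x) (suc e)) ⟩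
  c * (suc e ! * ((suc x + suc e) C suc e))              ≤⟨ *-monoʳ-≤ c (*-monoʳ-≤ (suc e !) (C≤2^ (suc x + suc e) (suc e))) ⟩
  c * (suc e ! * 2 ^ (suc x + suc e))                    ≡⟨ cong (λ z → c * (suc e ! * 2 ^ z)) (arith₃ x e) ⟩
  c * (suc e ! * 2 ^ (e + 2 + x))                        ≡⟨ cong (λ z → c * (suc e ! * z)) (^-distribˡ-+-* 2 (e + 2) x) ⟩
  c * (suc e ! * (2 ^ (e + 2) * 2 ^ x))                  ≡⟨ arith₂ c (suc e !) (2 ^ (e + 2)) (2 ^ x) ⟩
  c * (suc e ! * 2 ^ (e + 2)) * 2 ^ x                    ≤⟨ *-monoˡ-≤ (2 ^ x) le ⟩
  suc x * 2 ^ x                                          ∎)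
  where
  open ≤-Reasoning
  arith₁ : ∀ a c y → a * (c * y) ≡ c * (a * y)
  arith₁ = solve-∀
  arith₂ : ∀ c f p q → c * (f * (p * q)) ≡ c * (f * p) * q
  arith₂ = solve-∀
  arith₃ : ∀ x e → suc x + suc e ≡ e + 2 + x
  arith₃ = solve-∀

bounded⇒≤2^ : ∀ {f} → Bounded f → ∃[ x₀ ] (∀ x → x₀ ≤ x → f (suc x) ≤ 2 ^ x)
bounded⇒≤2^ (bounded c e h) = c * (suc e ! * 2 ^ (e + 2)) , λ x le → ≤-trans (h x) (^≤2^ c e x (≤-trans le (n≤1+n x)))

-- `x` stands in for log n: L is chosen proportional to x + 1, so the threshold is polynomial in x
-- and eventually at most 2^x, hence at most n.
binary-length : ∀ n → 1 ≤ n → ∃[ x ] (2 ^ x ≤ n × n < 2 ^ suc x)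
binary-length (suc zero)    _ = 0 , ≤-refl , ≤-refl
binary-length (suc (suc n)) _ with binary-length (suc n) (s≤s z≤n)
... | x , lo , hi with suc (suc n) <? 2 ^ suc x
...   | yes lt = x , ≤-trans lo (n≤1+n _) , lt
...   | no ¬lt = suc x , ≮⇒≥ ¬lt , (begin-strict
  suc (suc n)            ≤⟨ hi ⟩
  2 ^ suc x              <⟨ ^-monoʳ-< 2 (s≤s (s≤s z≤n)) (n<1+n (suc x)) ⟩
  2 ^ suc (suc x)        ∎)
  where open ≤-Reasoning

module _ (r a : ℕ) where

  private
    module At (x : ℕ) = Params r (a * x)

    infixl 6 _⊕_
    infixl 7 _⊗_

    _⊕_ : ∀ {f g} → Bounded f → Bounded g → Bounded (λ x → f x + g x)
    _⊕_ = bounded-+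

    _⊗_ : ∀ {f g} → Bounded f → Bounded g → Bounded (λ x → f x * g x)
    _⊗_ = bounded-*

    # : ∀ c → Bounded (λ _ → c)
    # = bounded-const

    L : Bounded (λ x → a * x)
    L = # a ⊗ bounded-id

  E-bounded : Bounded (λ x → At.E x)
  E-bounded = bounded-≡ (λ x → At.E-def x)
    (# (2 ^ r) ⊗ bounded-^ 3 (# (2 ^ r) ⊗ (# (suc r) ⊗ (# (suc r) ⊗ (# 1 ⊕ (# 4 ⊗ L ⊕ # (2 * r)))) ⊗ # r)))

  d-bounded : Bounded (λ x → At.d x)
  d-bounded = bounded-≡ (λ x → At.d-def x) (# (2 * κ r) ⊗ (# 2 ⊕ # r ⊗ E-bounded))

  t-bounded : Bounded (λ x → At.t x)
  t-bounded = bounded-≡ (λ x → At.t-def x) (# (2 * κ r) ⊗ (# r ⊗ (# 1 ⊕ E-bounded)))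

  threshold-bounded : Bounded (λ x → At.threshold x)
  threshold-bounded = bounded-≡ (λ x → At.threshold-def x) (
    # 2 ⊗ (# 3 ⊕ d-bounded ⊕ # r ⊕ # r ⊕ # 2) ⊕ (# 15 ⊕ # (2 * r) ⊗ E-bounded ⊗ # (κ r)) ⊕ bounded-^ r d-bounded
      ⊕ (# 1 ⊕ # (κ r) ⊗ (# 8 ⊗ L ⊕ (# 1 ⊕ E-bounded))) ⊕ # (16 * κ r) ⊗ L
      ⊕ (# 1 ⊕ # (κ r) ⊗ (# 8 ⊗ L ⊕ # 2 ⊗ bounded-^ r t-bounded)))

module _ (ρ : ℕ) where

  private
    r : ℕ
    r = 4 + ρ

  -- Chosen so that n ^ (2r + 4) ≤ 2 ^ density x as soon as n ≤ 2 ^ x.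
  density : ℕ → ℕ
  density x = (2 * r + 4) * x

  -- The exponent 2 r + 4 consists of 1 for `suc k`, 3 for the bases and 2 r for the square of the
  -- number of r-sets.
  badCount-bound : ∀ k n x → 2 ≤ n → suc k ≤ n → n ≤ 2 ^ suc x → Params.threshold r (density (suc x)) ≤ n →
    suc k * badCount n r ≤ 2 ^ edgeCount n r
  badCount-bound k n x 2≤n k<n n≤ big =
    let P , ∣P∣ = ∃-pair 2≤n in RandomSubgraph.badCount-≤ ρ n (density (suc x)) k P ∣P∣ big (begin
      suc k * suc (length (vertices n 2)) * (length (vertices n r) * length (vertices n r))
        ≤⟨ *-mono-≤ (*-mono-≤ k<n bases≤) (*-mono-≤ (length-vertices-≤ n r) (length-vertices-≤ n r)) ⟩
      n * n ^ 3 * (n ^ r * n ^ r)       ≡⟨ cong (n * n ^ 3 *_) (sym (^-distribˡ-+-* n r r)) ⟩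
      n ^ 4 * n ^ (r + r)               ≡⟨ sym (^-distribˡ-+-* n 4 (r + r)) ⟩
      n ^ (4 + (r + r))                 ≡⟨ cong (n ^_) (arith r) ⟩
      n ^ (2 * r + 4)                   ≤⟨ ^-monoˡ-≤ (2 * r + 4) n≤ ⟩
      (2 ^ suc x) ^ (2 * r + 4)         ≡⟨ ^-*-assoc 2 (suc x) (2 * r + 4) ⟩
      2 ^ (suc x * (2 * r + 4))         ≡⟨ cong (2 ^_) (*-comm (suc x) (2 * r + 4)) ⟩
      2 ^ density (suc x)               ∎)
    where
    open ≤-Reasoning
    arith : ∀ r → 4 + (r + r) ≡ 2 * r + 4
    arith = solve-∀
    bases≤ : suc (length (vertices n 2)) ≤ n ^ 3
    bases≤ = begin
      1 + length (vertices n 2)   ≤⟨ +-mono-≤ (m^n>0 n {{>-nonZero (≤-trans (s≤s z≤n) 2≤n)}} 2) (length-vertices-≤ n 2) ⟩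
      n ^ 2 + n ^ 2               ≡⟨ cong (n ^ 2 +_) (sym (+-identityʳ (n ^ 2))) ⟩
      2 * n ^ 2                   ≤⟨ *-monoˡ-≤ (n ^ 2) 2≤n ⟩
      n ^ 3                       ∎

  opaque
    dominated : ∃[ x₀ ] (∀ x → x₀ ≤ x → Params.threshold r (density (suc x)) ≤ 2 ^ x)
    dominated = bounded⇒≤2^ (threshold-bounded r (2 * r + 4))

  eventually : ∀ k → ∃[ N ] ((n : ℕ) → N ≤ n → suc k * badCount n r ≤ 2 ^ edgeCount n r)
  eventually k = 2 ^ x₀ + suc k + 2 , λ n le →
      let x , lo , hi = binary-length n (≤-trans (s≤s z≤n) (2≤ n le)) in
      badCount-bound k n x (2≤ n le) (≤-trans (m≤n+m (suc k) (2 ^ x₀)) (≤-trans (m≤m+n _ 2) le)) (<⇒≤ hi)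
        (≤-trans (small x (^-cancelʳ-≤ x₀ x (≤-trans (m≤m+n (2 ^ x₀) (suc k)) (≤-trans (m≤m+n _ 2) le)) hi)) lo)
    where
    x₀ : ℕ
    x₀ = proj₁ dominated
    small : ∀ x → x₀ ≤ x → Params.threshold r (density (suc x)) ≤ 2 ^ x
    small = proj₂ dominated
    2≤ : ∀ n → 2 ^ x₀ + suc k + 2 ≤ n → 2 ≤ n
    2≤ n = ≤-trans (m≤n+m 2 (2 ^ x₀ + suc k))
    ^-cancelʳ-≤ : ∀ y x {n} → 2 ^ y ≤ n → n < 2 ^ suc x → y ≤ x
    ^-cancelʳ-≤ y x le hi = ≮⇒≥ (λ lt → <⇒≱ hi (≤-trans (^-monoʳ-≤ 2 lt) le))

-- For every k the bad event eventually has probability at most 1/(k+1), which is convergence to 0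
-- in integer form.
theorem2 : (r : ℕ) → 4 ≤ r → (k : ℕ) → ∃[ N ] ((n : ℕ) → N ≤ n →
    suc k * badCount n r ≤ 2 ^ edgeCount n r)
theorem2 r 4≤r k = subst (λ r → ∃[ N ] ((n : ℕ) → N ≤ n → suc k * badCount n r ≤ 2 ^ edgeCount n r))
  (m+[n∸m]≡n 4≤r) (eventually (r ∸ 4) k)
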